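{- Let $\alpha$ be a weak composition and $\varphi$ a flag. Then $$\sum_{T\in\mathrm{SSKT}(\alpha,\varphi)}x^{\mathsf{wt}(T)}=\sum_{u^\bullet\in\mathscr W(\alpha,\varphi)}x^{\mathsf{wt}(u^\bullet)}.$$
   Context: Tableaux: fillings by positive integers of finite sets of boxes (row $r$, column $c\in\mathbb{Z}_{>0}$), rows left-justified, French notation (rows indexed increasing upward); $T_{rc}$ is an entry; shape = weak composition of row lengths. Weight of a word $u$: $\mathsf{wt}(u)=(\beta_1,\beta_2,\dots)$, $\beta_j$ the multiplicity of $j$; $\mathsf{wt}(T)$ = weight of its multiset of entries. A flag is a weakly increasing $\varphi:\mathbb{Z}_{>0}\to\mathbb{Z}_{>0}$ with $\varphi(m)\ge m$. A key tableau: (a) rows weakly decreasing left to right; (b) columns with distinct entries; (c) if boxes $(i,j),(k,j)$ with $i<k$ have $T_{ij}>T_{kj}$ then $(i,j+1)$ is a box with $T_{i,j+1}>T_{kj}$. $\varphi$-flagged: $T_{ij}\le\varphi(i)$. $\mathrm{SSKT}(\alpha,\varphi)$: $\varphi$-flagged key tableaux of shape $\alpha$. A semistandard Young tableau (SSYT) has partition shape, rows weakly increasing left to right, columns strictly increasing bottom to top; it is standard if its entries are $1,\dots,m$ without repetition. The standardization $\mathsf{std}(T)$ of an SSYT of weight $\beta$ replaces its $1$'s from left to right by $1,\dots,\beta_1$, its $2$'s from left to right by $\beta_1+1,\dots,\beta_1+\beta_2$, etc. $\mathsf{key}(\alpha)$ is the unique SSYT of weight $\alpha$ such that for every $c$ the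 set of entries of column $c+1$ is contained in the set of entries of column $c$. Column insertion of $x$ into an SSYT: set $x_1=x$; at column $c=1,2,\dots$: if $x_c>z$ for all $z$ in column $c$, place $x_c$ at the top of column $c$ and stop; if column $c$ contains $x_c$, set $x_{c+1}=x_c$ and go to column $c+1$; otherwise let $x_{c+1}$ be the smallest entry of column $c$ greater than $x_c$, replace it by $x_c$, and go to column $c+1$. For a word $v=v_1\cdots v_m$, let $P_j$ be the result of column inserting $v_m,v_{m-1},\dots,v_{m+1-j}$ successively into the empty tableau; $(v\to\varnothing)=(P,Q)$ where $P=P_m$ and $Q$ is the standard tableau whose entries $\le j$ form the shape of $P_j$ for each $j$. A maximal factorization $u^\bullet=\cdots u^2u^1$ of a word $u$ factors $u$ into weakly increasing (possibly empty) consecutive sequences $u^i$ such that the nonempty components have maximal length; it is $\varphi$-flagged if no letter of $u^i$ exceeds $\varphi(i)$; $\mathsf{wt}(u^\bullet)=\mathsf{wt}(u)$. $\mathscr W(\alpha,\varphi)$ is the set of $\varphi$-flagged maximal factorizations $u^\bullet=u^n\cdots u^2u^1$ with $\ell(u^i)=\alpha_i$ for all $i$ and $(u\to\varnothing)=(P,\mathsf{std}(\mathsf{key}(\alpha)))$ for some $P$. -}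

module Defs where

open import Data.Nat using (ℕ; zero; suc; _+_; _≤_; _<ᵇ_; _≡ᵇ_; _≤ᵇ_; _⊔_)
open import Data.Bool using (Bool; true; false; _∧_; _∨_; not; if_then_else_)
open import Data.List using (List; []; _∷_; _++_; [_]; map; concat; concatMap;
  filterᵇ; upTo; reverse; length; foldr; zip)
open import Data.Maybe using (Maybe; just; nothing)
open import Data.Product using (_×_; _,_; proj₁; proj₂)

range1 : ℕ → List ℕ
range1 m = map suc (upTo m)

count : ℕ → List ℕ → ℕ
count j u = length (filterᵇ (j ≡ᵇ_) u)

maxL : List ℕ → ℕ
maxL = foldr _⊔_ 0

-- Weight of a word, as the finitely supported sequence (β₁, β₂, …)
-- written canonically as the list (β₁, …, β_m) with m = the largest letter
-- (so all omitted entries are 0 and the last listed entry is nonzero).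
-- This is the exponent vector of the monomial x^{wt(u)}.
wt : List ℕ → List ℕ
wt u = map (λ j → count j u) (range1 (maxL u))

allB : {A : Set} → (A → Bool) → List A → Bool
allB p []       = true
allB p (x ∷ xs) = p x ∧ allB p xs

anyB : {A : Set} → (A → Bool) → List A → Bool
anyB p []       = false
anyB p (x ∷ xs) = p x ∨ anyB p xs

nth : {A : Set} → List A → ℕ → Maybe A
nth []       _       = nothing
nth (x ∷ xs) zero    = just x
nth (x ∷ xs) (suc i) = nth xs i

weaklyDecr : List ℕ → Bool
weaklyDecr (a ∷ b ∷ r) = (b ≤ᵇ a) ∧ weaklyDecr (b ∷ r)
weaklyDecr _           = true

weaklyIncr : List ℕ → Bool
weaklyIncr (a ∷ b ∷ r) = (a ≤ᵇ b) ∧ weaklyIncr (b ∷ r)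
weaklyIncr _           = true

allLists : ℕ → ℕ → List (List ℕ)
allLists zero    m = [] ∷ []
allLists (suc ℓ) m = concatMap (λ x → map (x ∷_) (allLists ℓ m)) (range1 m)

eqL : List ℕ → List ℕ → Bool
eqL []       []       = true
eqL (a ∷ as) (b ∷ bs) = (a ≡ᵇ b) ∧ eqL as bs
eqL _        _        = false

eqLL : List (List ℕ) → List (List ℕ) → Bool
eqLL []       []       = true
eqLL (a ∷ as) (b ∷ bs) = eqL a b ∧ eqLL as bs
eqLL _        _        = false

record IsFlag (φ : ℕ → ℕ) : Set where
  field
    monotone : ∀ m n → 1 ≤ m → m ≤ n → φ m ≤ φ n
    above    : ∀ m → 1 ≤ m → m ≤ φ m

-- Tableaux of shape α: a list of rows, the i-th list (i = 1, 2, …) is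
-- row i (French notation, row 1 at the bottom), read left to right.
-- Box (i, j) exists iff row i has length ≥ j.

Tableau : Set
Tableau = List (List ℕ)

-- entry at (row i, column j), both 0-based here
entry : Tableau → ℕ → ℕ → Maybe ℕ
entry T i j with nth T i
... | nothing = nothing
... | just r  = nth r j

boxAbove : ℕ → Maybe ℕ → Bool
boxAbove b (just c) = b <ᵇ c
boxAbove b nothing  = false

pairOK : Tableau → ℕ → ℕ → ℕ → Bool
pairOK T i k j with entry T i j | entry T k j
... | just a | just b =
      not (a ≡ᵇ b) ∧
      (if b <ᵇ a
         then boxAbove b (entry T i (suc j))
         else true)
... | _ | _ = true

isKey : Tableau → Bool
isKey T =
  allB weaklyDecr T ∧
  allB (λ i → allB (λ k → allB (λ j → not (i <ᵇ k) ∨ pairOK T i k j)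
                            (upTo w))
                 (upTo n))
      (upTo n)
  where
    n = length T
    w = maxL (map length T)

flaggedFillings : (ℕ → ℕ) → ℕ → List ℕ → List Tableau
flaggedFillings φ i []       = [] ∷ []
flaggedFillings φ i (a ∷ as) =
  concatMap (λ r → map (r ∷_) (flaggedFillings φ (suc i) as)) (allLists a (φ i))

-- SSKT(α, φ), as a (duplicate-free) list
SSKT : List ℕ → (ℕ → ℕ) → List Tableau
SSKT α φ = filterᵇ isKey (flaggedFillings φ 1 α)

-- Semistandard Young tableaux, represented as the list of their columns
-- (column 1 first), each column listed bottom to top.

-- replace the smallest entry > x of a strictly increasing column by x,
-- returning the new column and the bumped entry
bump : ℕ → List ℕ → List ℕ × ℕ
bump x []       = [] , x
bump x (z ∷ zs) with x <ᵇ z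
... | true  = (x ∷ zs) , z
... | false with bump x zs
...   | zs' , y = (z ∷ zs') , y

-- column insertion of x; also returns the (0-based) column in which the
-- new box was created
colInsert : ℕ → List (List ℕ) → List (List ℕ) × ℕ
colInsert x []           = ([ x ] ∷ []) , 0
colInsert x (col ∷ cols) with allB (_<ᵇ x) col
... | true  = ((col ++ [ x ]) ∷ cols) , 0
... | false with anyB (x ≡ᵇ_) col
...   | true with colInsert x cols
...     | r , c = (col ∷ r) , suc c
colInsert x (col ∷ cols) | false | false with bump x col
...     | col' , y with colInsert y cols
...       | r , c = (col' ∷ r) , suc c

addAt : ℕ → ℕ → List (List ℕ) → List (List ℕ)
addAt zero    j []       = [ j ] ∷ []
addAt zero    j (q ∷ qs) = (q ++ [ j ]) ∷ qs
addAt (suc c) j []       = [] ∷ addAt c j []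
addAt (suc c) j (q ∷ qs) = q ∷ addAt c j qs

insertAll : ℕ → List ℕ → List (List ℕ) → List (List ℕ) →
            List (List ℕ) × List (List ℕ)
insertAll j []       P Q = P , Q
insertAll j (x ∷ xs) P Q with colInsert x P
... | P' , c = insertAll (suc j) xs P' (addAt c j Q)

rsk : List ℕ → List (List ℕ) × List (List ℕ)
rsk v = insertAll 1 (reverse v) [] []

key : List ℕ → List (List ℕ)
key α = map (λ c → map proj₁ (filterᵇ (λ p → c ≤ᵇ proj₂ p)
                                       (zip (range1 (length α)) α)))
            (range1 (maxL α))

std : List (List ℕ) → List (List ℕ)
std T = go [] T
  where
    es = concat T
    go : List ℕ → List (List ℕ) → List (List ℕ)
    go prev []           = []
    go prev (col ∷ cols) =
      map (λ v → suc (length (filterᵇ (_<ᵇ v) es) + count v prev)) col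
        ∷ go (prev ++ col) cols

-- Factorizations.  A factorization u^n ⋯ u^1 with ℓ(u^i) = α_i is given
-- by the list (u^1, u^2, …, u^n); the word is u = u^n ⋯ u^2 u^1.

word : List (List ℕ) → List ℕ
word fs = concat (reverse fs)

lastN : List ℕ → ℕ
lastN []       = 0
lastN (x ∷ []) = x
lastN (x ∷ xs) = lastN xs

headN : List ℕ → ℕ
headN []      = 0
headN (x ∷ _) = x

nonempty : List ℕ → Bool
nonempty [] = false
nonempty _  = true

-- consecutive nonempty factors (in left-to-right order) cannot be merged:
-- last letter of the left one > first letter of the right one
adjOK : List (List ℕ) → Bool
adjOK (a ∷ b ∷ r) = (headN b <ᵇ lastN a) ∧ adjOK (b ∷ r)
adjOK _           = true

isMaximal : List (List ℕ) → Bool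
isMaximal fs = allB weaklyIncr fs ∧ adjOK (filterᵇ nonempty (reverse fs))

flaggedFactors : (ℕ → ℕ) → ℕ → List ℕ → List (List (List ℕ))
flaggedFactors φ i []       = [] ∷ []
flaggedFactors φ i (a ∷ as) =
  concatMap (λ r → map (r ∷_) (flaggedFactors φ (suc i) as)) (allLists a (φ i))

-- 𝒲(α, φ), as a (duplicate-free) list
𝒲 : List ℕ → (ℕ → ℕ) → List (List (List ℕ))
𝒲 α φ = filterᵇ (λ fs → isMaximal fs ∧ eqLL (proj₂ (rsk (word fs))) (std (key α)))
                (flaggedFactors φ 1 α)

{-# OPTIONS --safe #-}
module Submission where

-- Write a factorization as its blocks D = (D₁, D₂, …), D_i being u^i read backwards, hence weakly
-- decreasing. A letter y passes through a column c (a finite set) from the left by replacing the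
-- least x ≥ y of c, and x comes out on the right; read from right to left this is insertion into
-- reverse tableaux. The recording tableau is std(key α) iff the first letter of every block lands
-- in column 1 and the letters that column 1 bumps out again form such a family of blocks.
--
-- Let C be the first column of a key tableau T and T′ the rest of T. If T′ corresponds to D′, then
-- T corresponds to the blocks D obtained by letting the letters of D′ pass through C, followed in
-- every nonempty row by the removal of the least element of C. All properties of this map follow
-- from one exchange rule: bracketing the elements of two adjacent columns and moving the unmatched
-- brackets from one column to the other commutes with passing a letter through both (pass-sim).
-- The rule shows that the condition on the recording tableau is inherited from D′ by D and
-- conversely. Applied from right to left, it shows that inserting D_k, …, D₁ from the right into
-- the empty column yields {T₁₁, …, T_k1} for every k. So the largest entries of the first k rows of
-- T and of the first k blocks of D agree, and for monotone φ the two flag conditions are equivalent.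

open import Defs
open import Data.Bool using (Bool; true; false; T; T?; _∧_; _∨_; not; if_then_else_)
open import Data.Empty using (⊥; ⊥-elim)
open import Data.List using (List; []; _∷_; [_]; _++_; map; concat; concatMap; length; drop; filterᵇ; reverse; reverseAcc; applyUpTo; upTo; zip; cartesianProductWith) renaming (take to takeL)
open import Data.List.Membership.Propositional using (_∈_)
open import Data.List.Membership.Propositional.Properties
open import Data.List.Properties using (∷-injective; ∷-injectiveˡ; ∷-injectiveʳ; ++-assoc; ++-identityʳ; concat-++; length-++; length-map; length-reverse; map-∘; map-cong; map-id; map-upTo; reverse-++; reverse-involutive; take-all; take-map; unfold-reverse)
open import Data.List.Relation.Binary.Permutation.Propositional using (_↭_; prep; swap; ↭-prep; ↭-refl; ↭-reflexive; ↭-sym; ↭-trans; module PermutationReasoning)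
open import Data.List.Relation.Binary.Permutation.Propositional.Properties using (++⁺ʳ; ++⁺ˡ; All-resp-↭; map⁺; shift; shifts; ↭-reverse)
open import Data.List.Relation.Unary.All as All using (All; []; _∷_)
open import Data.List.Relation.Unary.All.Properties using (concat⁺; concat⁻)
open import Data.List.Relation.Unary.AllPairs using (AllPairs; []; _∷_)
open import Data.List.Relation.Unary.Any using (here; there)
open import Data.List.Relation.Unary.Linked using (Linked; []; [-]; _∷_)
open import Data.List.Relation.Unary.Unique.Propositional using (Unique)
open import Data.List.Relation.Unary.Unique.Propositional.Properties using (cartesianProductWith⁺; filter⁺; upTo⁺) renaming (map⁺ to unique-map⁺)
open import Data.Maybe using (Maybe; just; nothing)
open import Data.Nat using (ℕ; zero; suc; _+_; _∸_; _⊓_; _⊔_; _≤_; _<_; _≥_; _≤ᵇ_; _<ᵇ_; _≡ᵇ_; z≤n; s≤s; s≤s⁻¹)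
open import Data.Nat.ListAction using (sum)
open import Data.Nat.Properties
open import Data.Product using (∃-syntax; _×_; _,_; proj₁; proj₂)
open import Data.Sum as Sum using (_⊎_; inj₁; inj₂)
open import Data.Unit using (⊤; tt)
open import Data.Vec using (Vec; []; _∷_; _∷ʳ_; replicate)
open import Function using (_∘_; flip)
open import Relation.Binary.PropositionalEquality using (_≡_; _≢_; refl; sym; trans; cong; cong₂; subst; subst₂; module ≡-Reasoning)
open import Relation.Nullary using (¬_)

-- With bit vectors, passing through a column is a finite automaton that reads the alphabet, so the
-- exchange rule is a finite table (`tile-sim`) propagated by induction.
--
-- T and D meet because one exchange computes both first columns. Let S be the first column of T′
-- and, inductively, the right insertion of D′. Condition (c) means that the first column of T is
-- filled greedily from C, which is the bracketing of S against C. Moving the letters of D from the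
-- right through C and then through the column of D′ is the same exchange. As (f, d) determines (c,
-- e), the results agree. Rows that are empty in T′ but not in T contribute nothing to S; elements
-- -∞ stand for them, and the pending numbers count these.
--
-- Two things could go wrong on the way back from words. Run backwards from the empty column, a
-- block of D need not end with the removal of a least element; a count of brackets against nonempty
-- blocks excludes this. And the greedy choice might find no element left; here the right insertions
-- of all prefixes are needed, not just that of the whole word.

-- The exchange rule, one letter of the alphabet at a time

-- Columns are bit vectors indexed by the alphabet, and so are letters (one-hot). Pass s t y c c′ x
-- scans the alphabet upwards: y passes through c from the left, turning it into c′, and x comes
-- out. A start in carry stands for the letter y = −∞, an end in carry for x = ∞.
data State : Set where
  before carry after : State

data Tile : State → State → (y c c′ x : Bool) → Set where
  skip₀ : ∀ {b} → Tile before before false b b false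
  here  : Tile before after true true true true
  put   : Tile before carry true false true false
  move  : Tile carry carry false false false false
  take  : Tile carry after false true false true
  skip₁ : ∀ {b} → Tile after after false b b false

data Pass : State → State → ∀ {n} (y c c′ x : Vec Bool n) → Set where
  []  : ∀ {s} → Pass s s [] [] [] []
  _∷_ : ∀ {s t u n y c c′ x} {ys cs cs′ xs : Vec Bool n} →
        Tile s t y c c′ x → Pass t u ys cs cs′ xs →
        Pass s u (y ∷ ys) (c ∷ cs) (c′ ∷ cs′) (x ∷ xs)

-- In Swap p q c e f d, elements of the left column c are opening and elements of the right column e
-- are closing brackets; f consists of the matched elements of c, and d of e and the unmatched
-- elements of c (free, possible only if no bracket is pending). The number of pending brackets
-- runs from p to q; nonzero boundary values account for elements −∞ of c, f and ∞ of e, d.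
data Link : ℕ → ℕ → (c e f d : Bool) → Set where
  none  : ∀ {p} → Link p p false false false false
  open′ : ∀ {p} → Link p (suc p) true false true false
  close : ∀ {p} → Link (suc p) p false true false true
  both  : ∀ {p} → Link p p true true true true
  free  : Link 0 0 true false false true

data Swap : ℕ → ℕ → ∀ {n} (c e f d : Vec Bool n) → Set where
  []  : ∀ {p} → Swap p p [] [] [] []
  _∷_ : ∀ {p q r n c e f d} {cs es fs ds : Vec Bool n} →
        Link p q c e f d → Swap q r cs es fs ds →
        Swap p r (c ∷ cs) (e ∷ es) (f ∷ fs) (d ∷ ds)

-- Joint states of a letter passing through (c, e) and through (f, d), with the numbers of pending
-- brackets before and after: before both, in c and f, in e and d, in e and f, after both.
data Sim : (sC sE sF sD : State) → ℕ → ℕ → Set where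
  bb : ∀ {p} → Sim before before before before p p
  kk : ∀ {p} → Sim carry before carry before p (suc p)
  ee : ∀ {p} → Sim after carry after carry (suc p) p
  ek : Sim after carry carry before 0 0
  dd : ∀ {p} → Sim after after after after p p

data TileSim (tC tE sF sD : State) (y f d z c′ e′ : Bool) (q p′ : ℕ) : Set where
  result : ∀ {f′ v d′ tF tD q′} → Tile sF tF y f f′ v → Tile sD tD v d d′ z →
           Link p′ q′ c′ e′ f′ d′ → Sim tC tE tF tD q q′ →
           TileSim tC tE sF sD y f d z c′ e′ q p′

-- The state `ek` arises when the x taken out of c is a free element: put into e, it is the closing
-- bracket that y lacks, so d keeps x while y still waits in f. The next element of f, if there is
-- one, becomes free in its place.
tile-sim : ∀ {sC sE sF sD tC tE p p′ q c e f d y c′ x e′ z} →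
  Sim sC sE sF sD p p′ → Link p q c e f d → Tile sC tC y c c′ x → Tile sE tE x e e′ z →
  TileSim tC tE sF sD y f d z c′ e′ q p′
tile-sim bb none  skip₀ skip₀ = result skip₀ skip₀ none bb
tile-sim bb none  put   skip₀ = result put skip₀ open′ kk
tile-sim bb open′ skip₀ skip₀ = result skip₀ skip₀ open′ bb
tile-sim bb open′ here  put   = result here put both ee
tile-sim bb close skip₀ skip₀ = result skip₀ skip₀ close bb
tile-sim bb close put   skip₀ = result put skip₀ both kk
tile-sim bb both  skip₀ skip₀ = result skip₀ skip₀ both bb
tile-sim bb both  here  here  = result here here both dd
tile-sim bb free  skip₀ skip₀ = result skip₀ skip₀ free bb
tile-sim bb free  here  put   = result put skip₀ both ek
tile-sim kk none  move  skip₀ = result move skip₀ none kk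
tile-sim kk open′ take  put   = result take put close ee
tile-sim kk close move  skip₀ = result move skip₀ close kk
tile-sim kk both  take  here  = result take here close dd
tile-sim kk free  take  put   = result move skip₀ close ek
tile-sim ee none  skip₁ move  = result skip₁ move none ee
tile-sim ee open′ skip₁ move  = result skip₁ move open′ ee
tile-sim ee close skip₁ take  = result skip₁ take none dd
tile-sim ee both  skip₁ take  = result skip₁ take open′ dd
tile-sim ek none  skip₁ move  = result move skip₀ none ek
tile-sim ek open′ skip₁ move  = result take put free ee
tile-sim ek both  skip₁ take  = result take here free dd
tile-sim ek free  skip₁ move  = result move skip₀ free ek
tile-sim dd none  skip₁ skip₁ = result skip₁ skip₁ none dd
tile-sim dd open′ skip₁ skip₁ = result skip₁ skip₁ open′ dd
tile-sim dd close skip₁ skip₁ = result skip₁ skip₁ close dd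
tile-sim dd both  skip₁ skip₁ = result skip₁ skip₁ both dd
tile-sim dd free  skip₁ skip₁ = result skip₁ skip₁ free dd

data PassSim (tC tE sF sD : State) {n} (y f d z c′ e′ : Vec Bool n) (q p′ : ℕ) : Set where
  result : ∀ {f′ v d′ tF tD q′} → Pass sF tF y f f′ v → Pass sD tD v d d′ z →
           Swap p′ q′ c′ e′ f′ d′ → Sim tC tE tF tD q q′ →
           PassSim tC tE sF sD y f d z c′ e′ q p′

pass-sim : ∀ {sC sE sF sD tC tE p p′ q n} {c e f d y c′ x e′ z : Vec Bool n} →
  Sim sC sE sF sD p p′ → Swap p q c e f d → Pass sC tC y c c′ x → Pass sE tE x e e′ z →
  PassSim tC tE sF sD y f d z c′ e′ q p′
pass-sim s [] [] [] = result [] [] [] s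
pass-sim s (l ∷ ls) (t ∷ ts) (u ∷ us) with tile-sim s l t u
... | result t′ u′ l′ s′ with pass-sim s′ ls ts us
...   | result ts′ us′ ls′ s″ = result (t′ ∷ ts′) (u′ ∷ us′) (l′ ∷ ls′) s″

-- Reversing the alphabet exchanges the two directions of Pass.

mirror : State → State
mirror before = after
mirror carry  = carry
mirror after  = before

rev : ∀ {n} → Vec Bool n → Vec Bool n
rev []       = []
rev (x ∷ xs) = rev xs ∷ʳ x

rev-∷ʳ : ∀ {n} (xs : Vec Bool n) x → rev (xs ∷ʳ x) ≡ x ∷ rev xs
rev-∷ʳ []       x = refl
rev-∷ʳ (y ∷ xs) x = cong (_∷ʳ y) (rev-∷ʳ xs x)

rev-rev : ∀ {n} (xs : Vec Bool n) → rev (rev xs) ≡ xs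
rev-rev []       = refl
rev-rev (x ∷ xs) = trans (rev-∷ʳ (rev xs) x) (cong (x ∷_) (rev-rev xs))

tile-flip : ∀ {s t y c c′ x} → Tile s t y c c′ x → Tile (mirror t) (mirror s) x c′ c y
tile-flip skip₀ = skip₁
tile-flip here  = here
tile-flip put   = take
tile-flip move  = move
tile-flip take  = put
tile-flip skip₁ = skip₀

link-flip : ∀ {p q c e f d} → Link p q c e f d → Link q p d f e c
link-flip none  = none
link-flip open′ = close
link-flip close = open′
link-flip both  = both
link-flip free  = free

pass-∷ʳ : ∀ {s t u n y c c′ x} {ys cs cs′ xs : Vec Bool n} →
  Pass s t ys cs cs′ xs → Tile t u y c c′ x → Pass s u (ys ∷ʳ y) (cs ∷ʳ c) (cs′ ∷ʳ c′) (xs ∷ʳ x)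
pass-∷ʳ []       t = t ∷ []
pass-∷ʳ (u ∷ us) t = u ∷ pass-∷ʳ us t

swap-∷ʳ : ∀ {p q r n c e f d} {cs es fs ds : Vec Bool n} →
  Swap p q cs es fs ds → Link q r c e f d → Swap p r (cs ∷ʳ c) (es ∷ʳ e) (fs ∷ʳ f) (ds ∷ʳ d)
swap-∷ʳ []       l = l ∷ []
swap-∷ʳ (k ∷ ks) l = k ∷ swap-∷ʳ ks l

pass-rev : ∀ {s t n} {y c c′ x : Vec Bool n} → Pass s t y c c′ x →
  Pass (mirror t) (mirror s) (rev x) (rev c′) (rev c) (rev y)
pass-rev []       = []
pass-rev (t ∷ ts) = pass-∷ʳ (pass-rev ts) (tile-flip t)

swap-rev : ∀ {p q n} {c e f d : Vec Bool n} → Swap p q c e f d → Swap q p (rev d) (rev f) (rev e) (rev c)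
swap-rev []       = []
swap-rev (l ∷ ls) = swap-∷ʳ (swap-rev ls) (link-flip l)

pass-unrev : ∀ {s t n} {y c c′ x : Vec Bool n} → Pass s t (rev y) (rev c) c′ x →
  Pass (mirror t) (mirror s) (rev x) (rev c′) c y
pass-unrev {y = y} {c} {c′} {x} p =
  subst₂ (λ a b → Pass _ _ (rev x) (rev c′) a b) (rev-rev c) (rev-rev y) (pass-rev p)

swap-unrev : ∀ {p q n} {c e f d : Vec Bool n} → Swap p q (rev c) (rev e) f d → Swap q p (rev d) (rev f) e c
swap-unrev {c = c} {e} {f} {d} w =
  subst₂ (λ a b → Swap _ _ (rev d) (rev f) a b) (rev-rev e) (rev-rev c) (swap-rev w)

-- Determinism of passing and of exchanging

tile-detL : ∀ {s t t₂ y c c′ c₂ x x₂} → Tile s t y c c′ x → Tile s t₂ y c c₂ x₂ →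
  t ≡ t₂ × c′ ≡ c₂ × x ≡ x₂
tile-detL skip₀ skip₀ = refl , refl , refl
tile-detL here  here  = refl , refl , refl
tile-detL put   put   = refl , refl , refl
tile-detL move  move  = refl , refl , refl
tile-detL take  take  = refl , refl , refl
tile-detL skip₁ skip₁ = refl , refl , refl

tile-detR : ∀ {s s₂ t y y₂ c c₂ c′ x} → Tile s t y c c′ x → Tile s₂ t y₂ c₂ c′ x →
  s ≡ s₂ × y ≡ y₂ × c ≡ c₂
tile-detR skip₀ skip₀ = refl , refl , refl
tile-detR here  here  = refl , refl , refl
tile-detR put   put   = refl , refl , refl
tile-detR move  move  = refl , refl , refl
tile-detR take  take  = refl , refl , refl
tile-detR skip₁ skip₁ = refl , refl , refl

pass-detL : ∀ {s t t₂ n} {y c c′ c₂ x x₂ : Vec Bool n} → Pass s t y c c′ x → Pass s t₂ y c c₂ x₂ →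
  t ≡ t₂ × c′ ≡ c₂ × x ≡ x₂
pass-detL [] [] = refl , refl , refl
pass-detL (t ∷ ts) (u ∷ us) with tile-detL t u
... | refl , refl , refl with pass-detL ts us
...   | refl , refl , refl = refl , refl , refl

pass-detR : ∀ {s s₂ t n} {y y₂ c c₂ c′ x : Vec Bool n} → Pass s t y c c′ x → Pass s₂ t y₂ c₂ c′ x →
  s ≡ s₂ × y ≡ y₂ × c ≡ c₂
pass-detR [] [] = refl , refl , refl
pass-detR (t ∷ ts) (u ∷ us) with pass-detR ts us
... | refl , refl , refl with tile-detR t u
...   | refl , refl , refl = refl , refl , refl

link-det : ∀ {p q q₂ c c₂ e e₂ f d} → Link p q c e f d → Link p q₂ c₂ e₂ f d →
  q ≡ q₂ × c ≡ c₂ × e ≡ e₂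
link-det none  none  = refl , refl , refl
link-det open′ open′ = refl , refl , refl
link-det close close = refl , refl , refl
link-det both  both  = refl , refl , refl
link-det free  free  = refl , refl , refl

-- The exchange can be undone: only f = 0, d = 1 leaves two links, and there the pending number
-- decides between `close` and `free`. Two constructions of a column are later compared by
-- exhibiting both as the e of a `Swap` with the same f and d.
swap-det : ∀ {p q q₂ n} {c c₂ e e₂ f d : Vec Bool n} → Swap p q c e f d → Swap p q₂ c₂ e₂ f d →
  q ≡ q₂ × c ≡ c₂ × e ≡ e₂
swap-det [] [] = refl , refl , refl
swap-det (l ∷ ls) (k ∷ ks) with link-det l k
... | refl , refl , refl with swap-det ls ks
...   | refl , refl , refl = refl , refl , refl

-- Inserting, appending and removing a single letter

zeros : ∀ n → Vec Bool n
zeros n = replicate n false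

hot : ∀ n → ℕ → Vec Bool n
hot zero    _       = []
hot (suc n) zero    = true ∷ zeros n
hot (suc n) (suc a) = false ∷ hot n a

hot-injective : ∀ {n a b} → a < n → hot n a ≡ hot n b → a ≡ b
hot-injective {suc n} {zero}  {zero}  _ _ = refl
hot-injective {suc n} {suc a} {suc b} (s≤s a<n) eq = cong suc (hot-injective a<n (cong Data.Vec.tail eq))

infix 4 _∋_

data _∋_ : ∀ {n} → Vec Bool n → ℕ → Set where
  here  : ∀ {n} {v : Vec Bool n} → true ∷ v ∋ 0
  there : ∀ {n b a} {v : Vec Bool n} → v ∋ a → b ∷ v ∋ suc a

pass-after : ∀ {t n} {y c c′ x : Vec Bool n} → Pass after t y c c′ x →
  t ≡ after × y ≡ zeros n × c ≡ c′ × x ≡ zeros n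
pass-after [] = refl , refl , refl , refl
pass-after (skip₁ ∷ p) with pass-after p
... | refl , refl , refl , refl = refl , refl , refl , refl

pass-skip₁ : ∀ {n} (c : Vec Bool n) → Pass after after (zeros n) c c (zeros n)
pass-skip₁ []      = []
pass-skip₁ (b ∷ c) = skip₁ ∷ pass-skip₁ c

pass-skip₀ : ∀ {n} (c : Vec Bool n) → Pass before before (zeros n) c c (zeros n)
pass-skip₀ []      = []
pass-skip₀ (b ∷ c) = skip₀ ∷ pass-skip₀ c

pass-carry-carry : ∀ {n} {y c c′ x : Vec Bool n} → Pass carry carry y c c′ x →
  y ≡ zeros n × c ≡ zeros n × c′ ≡ zeros n × x ≡ zeros n
pass-carry-carry [] = refl , refl , refl , refl
pass-carry-carry (move ∷ p) with pass-carry-carry p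
... | refl , refl , refl , refl = refl , refl , refl , refl
pass-carry-carry (take ∷ p) with pass-after p
... | () , _

pass-before-carry : ∀ {n} {y c c′ x : Vec Bool n} → Pass before carry y c c′ x → x ≡ zeros n
pass-before-carry (skip₀ ∷ p) = cong (false ∷_) (pass-before-carry p)
pass-before-carry (put ∷ p)   = cong (false ∷_) (proj₂ (proj₂ (proj₂ (pass-carry-carry p))))
pass-before-carry (here ∷ p) with pass-after p
... | () , _

pass-carry-zeros : ∀ {s n} {y c c′ x : Vec Bool n} → s ≢ before → Pass s after y c c′ x → y ≡ zeros n
pass-carry-zeros {carry} _ (move ∷ p) = cong (false ∷_) (pass-carry-zeros (λ ()) p)
pass-carry-zeros {carry} _ (take ∷ p) = cong (false ∷_) (proj₁ (proj₂ (pass-after p)))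
pass-carry-zeros {after} _ p = proj₁ (proj₂ (pass-after p))
pass-carry-zeros {before} n p = ⊥-elim (n refl)

pass-out : ∀ {s n} {y c c′ x : Vec Bool n} → s ≢ after → Pass s after y c c′ x →
  ∃[ a ] a < n × x ≡ hot n a
pass-out s≢ [] = ⊥-elim (s≢ refl)
pass-out s≢ (skip₀ ∷ p) with pass-out (λ ()) p
... | a , a< , refl = suc a , s≤s a< , refl
pass-out s≢ (put ∷ p) with pass-out (λ ()) p
... | a , a< , refl = suc a , s≤s a< , refl
pass-out s≢ (move ∷ p) with pass-out (λ ()) p
... | a , a< , refl = suc a , s≤s a< , refl
pass-out s≢ (here ∷ p) with pass-after p
... | refl , refl , refl , refl = 0 , s≤s z≤n , refl
pass-out s≢ (take ∷ p) with pass-after p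
... | refl , refl , refl , refl = 0 , s≤s z≤n , refl
pass-out s≢ (skip₁ ∷ p) = ⊥-elim (s≢ refl)

pass-in : ∀ {t n} {y c c′ x : Vec Bool n} → t ≢ before → Pass before t y c c′ x →
  ∃[ a ] a < n × y ≡ hot n a
pass-in t≢ [] = ⊥-elim (t≢ refl)
pass-in t≢ (skip₀ ∷ p) with pass-in t≢ p
... | a , a< , refl = suc a , s≤s a< , refl
pass-in {after} t≢ (put ∷ p) rewrite pass-carry-zeros (λ ()) p = 0 , s≤s z≤n , refl
pass-in {carry} t≢ (put ∷ p) rewrite proj₁ (pass-carry-carry p) = 0 , s≤s z≤n , refl
pass-in {before} t≢ (put ∷ p) = ⊥-elim (t≢ refl)
pass-in t≢ (here ∷ p) with pass-after p
... | refl , refl , refl , refl = 0 , s≤s z≤n , refl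

-- Ins y c c′ x: y replaces x, the least element ≥ y of c.
Ins : ∀ {n} → ℕ → Vec Bool n → Vec Bool n → ℕ → Set
Ins {n} y c c′ x = Pass before after (hot n y) c c′ (hot n x)

-- App y c c′: y exceeds all elements of c and is added to c.
App : ∀ {n} → ℕ → Vec Bool n → Vec Bool n → Set
App {n} y c c′ = Pass before carry (hot n y) c c′ (zeros n)

-- Pop c c′ x: x is the least element of c and is removed from c.
Pop : ∀ {n} → Vec Bool n → Vec Bool n → ℕ → Set
Pop {n} c c′ x = Pass carry after (zeros n) c c′ (hot n x)

zeros-∌ : ∀ {n a} → ¬ (zeros n ∋ a)
zeros-∌ {suc n} (there m) = zeros-∌ m

∋-<  : ∀ {n a} {c : Vec Bool n} → c ∋ a → a < n
∋-< here      = s≤s z≤n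
∋-< (there m) = s≤s (∋-< m)

hot-∋ : ∀ {n a} → a < n → hot n a ∋ a
hot-∋ {suc n} {zero}  _ = here
hot-∋ {suc n} {suc a} (s≤s a<n) = there (hot-∋ a<n)

pop-∋ : ∀ {n x} {c c′ : Vec Bool n} → Pop c c′ x → c ∋ x
pop-∋ {x = zero}  (take ∷ p) = here
pop-∋ {x = suc x} (move ∷ p) = there (pop-∋ p)

pop-< : ∀ {n x} {c c′ : Vec Bool n} → Pop c c′ x → x < n
pop-< p = ∋-< (pop-∋ p)

pop-min : ∀ {n x a} {c c′ : Vec Bool n} → Pop c c′ x → c ∋ a → x ≤ a
pop-min {x = zero}  _          _         = z≤n
pop-min {x = suc x} (move ∷ p) (there m) = s≤s (pop-min p m)

pop-old : ∀ {n x a} {c c′ : Vec Bool n} → Pop c c′ x → c ∋ a → c′ ∋ a ⊎ a ≡ x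
pop-old {x = zero}  (take ∷ p) here = inj₂ refl
pop-old {x = zero}  (take ∷ p) (there m) with pass-after p
... | _ , _ , refl , _ = inj₁ (there m)
pop-old {x = suc x} (move ∷ p) (there m) = Sum.map there (cong suc) (pop-old p m)

pop-new : ∀ {n x a} {c c′ : Vec Bool n} → Pop c c′ x → c′ ∋ a → c ∋ a × x < a
pop-new {x = zero}  (take ∷ p) (there m) with pass-after p
... | _ , _ , refl , _ = there m , s≤s z≤n
pop-new {x = suc x} (move ∷ p) (there m) with pop-new p m
... | m′ , lt = there m′ , s≤s lt

ins-∋ : ∀ {n y x} {c c′ : Vec Bool n} → Ins y c c′ x → c ∋ x
ins-∋ {y = zero}  {zero}  (here ∷ p)  = here
ins-∋ {y = zero}  {suc x} (put ∷ p)   = there (pop-∋ p)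
ins-∋ {y = suc y} {suc x} (skip₀ ∷ p) = there (ins-∋ p)
ins-∋ {suc n} {suc y} {zero} (() ∷ _)

ins-≤ : ∀ {n y x} {c c′ : Vec Bool n} → Ins y c c′ x → y ≤ x
ins-≤ {y = zero}  _ = z≤n
ins-≤ {y = suc y} {suc x} (skip₀ ∷ p) = s≤s (ins-≤ p)
ins-≤ {suc n} {suc y} {zero} (() ∷ _)

ins-out-< : ∀ {n y x} {c c′ : Vec Bool n} → Ins y c c′ x → x < n
ins-out-< p = ∋-< (ins-∋ p)

ins-in-< : ∀ {n y x} {c c′ : Vec Bool n} → Ins y c c′ x → y < n
ins-in-< p = ≤-<-trans (ins-≤ p) (ins-out-< p)

ins-∋′ : ∀ {n y x} {c c′ : Vec Bool n} → Ins y c c′ x → c′ ∋ y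
ins-∋′ {y = zero}  {zero}  (here ∷ p)  = here
ins-∋′ {y = zero}  {suc x} (put ∷ p)   = here
ins-∋′ {y = suc y} {suc x} (skip₀ ∷ p) = there (ins-∋′ p)
ins-∋′ {suc n} {suc y} {zero} (() ∷ _)

ins-min : ∀ {n y x a} {c c′ : Vec Bool n} → Ins y c c′ x → c ∋ a → y ≤ a → x ≤ a
ins-min {y = zero}  {zero}  _ _ _ = z≤n
ins-min {y = zero}  {suc x} (put ∷ p)   (there m) _        = s≤s (pop-min p m)
ins-min {y = suc y} {suc x} (skip₀ ∷ p) (there m) (s≤s le) = s≤s (ins-min p m le)
ins-min {suc n} {suc y} {zero} (() ∷ _) _ _

ins-max : ∀ {n y x a} {c c′ : Vec Bool n} → Ins y c c′ x → c′ ∋ a → a ≤ x → a ≤ y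
ins-max _ here _ = z≤n
ins-max {y = zero}  {suc x} (put ∷ p) (there m) (s≤s le) = ⊥-elim (<⇒≱ (proj₂ (pop-new p m)) le)
ins-max {y = suc y} {suc x} (skip₀ ∷ p) (there m) (s≤s le) = s≤s (ins-max p m le)

ins-old : ∀ {n y x a} {c c′ : Vec Bool n} → Ins y c c′ x → c ∋ a → c′ ∋ a ⊎ a ≡ x
ins-old {y = zero} {zero} (here ∷ p) m with pass-after p
... | _ , _ , refl , _ = inj₁ m
ins-old {y = zero} {suc x} (put ∷ p) (there m) = Sum.map there (cong suc) (pop-old p m)
ins-old {y = suc y} {suc x} (skip₀ ∷ p) here = inj₁ here
ins-old {y = suc y} {suc x} (skip₀ ∷ p) (there m) = Sum.map there (cong suc) (ins-old p m)
ins-old {suc n} {suc y} {zero} (() ∷ _) _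

ins-new : ∀ {n y x a} {c c′ : Vec Bool n} → Ins y c c′ x → c′ ∋ a → c ∋ a ⊎ a ≡ y
ins-new {y = zero} {zero} (here ∷ p) m with pass-after p
... | _ , _ , refl , _ = inj₁ m
ins-new {y = zero} {suc x} (put ∷ p) here = inj₂ refl
ins-new {y = zero} {suc x} (put ∷ p) (there m) = inj₁ (there (proj₁ (pop-new p m)))
ins-new {y = suc y} {suc x} (skip₀ ∷ p) here = inj₁ here
ins-new {y = suc y} {suc x} (skip₀ ∷ p) (there m) = Sum.map there (cong suc) (ins-new p m)
ins-new {suc n} {suc y} {zero} (() ∷ _) _

app-∋ : ∀ {n y} {c c′ : Vec Bool n} → App y c c′ → c′ ∋ y
app-∋ {suc n} {zero}  (put ∷ p)   = here
app-∋ {suc n} {suc y} (skip₀ ∷ p) = there (app-∋ p)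

app-< : ∀ {n y} {c c′ : Vec Bool n} → App y c c′ → y < n
app-< p = ∋-< (app-∋ p)

app-max : ∀ {n y a} {c c′ : Vec Bool n} → App y c c′ → c ∋ a → a < y
app-max {y = zero}  (put ∷ p) (there m) with pass-carry-carry p
... | _ , refl , _ = ⊥-elim (zeros-∌ m)
app-max {y = suc y} (skip₀ ∷ p) here      = s≤s z≤n
app-max {y = suc y} (skip₀ ∷ p) (there m) = s≤s (app-max p m)

pop-total : ∀ {n} (c : Vec Bool n) → (∃[ c′ ] ∃[ x ] Pop c c′ x) ⊎ c ≡ zeros n
pop-total []          = inj₂ refl
pop-total (true ∷ c)  = inj₁ (false ∷ c , 0 , take ∷ pass-skip₁ c)
pop-total (false ∷ c) with pop-total c
... | inj₁ (c′ , x , p) = inj₁ (false ∷ c′ , suc x , move ∷ p)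
... | inj₂ refl         = inj₂ refl

pass-move : ∀ n → Pass carry carry (zeros n) (zeros n) (zeros n) (zeros n)
pass-move zero    = []
pass-move (suc n) = move ∷ pass-move n

insert-total : ∀ {n y} → y < n → (c : Vec Bool n) →
  (∃[ c′ ] ∃[ x ] Ins y c c′ x) ⊎ (∃[ c′ ] App y c c′)
insert-total {y = zero} _ (true ∷ c) = inj₁ (true ∷ c , 0 , here ∷ pass-skip₁ c)
insert-total {suc n} {y = zero} _ (false ∷ c) with pop-total c
... | inj₁ (c′ , x , p) = inj₁ (true ∷ c′ , suc x , put ∷ p)
... | inj₂ refl         = inj₂ (true ∷ zeros n , put ∷ pass-move n)
insert-total {y = suc y} (s≤s lt) (b ∷ c) with insert-total lt c
... | inj₁ (c′ , x , p) = inj₁ (b ∷ c′ , suc x , skip₀ ∷ p)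
... | inj₂ (c′ , p)     = inj₂ (b ∷ c′ , skip₀ ∷ p)

-- Seen from the right: x drives out the greatest y ≤ x of the column, and where there is none it
-- takes the place of -∞, which is a `Pop`.
remove-total : ∀ {n x} → x < n → (c′ : Vec Bool n) →
  (∃[ c ] ∃[ y ] Ins y c c′ x) ⊎ (∃[ c ] Pop c c′ x)
remove-total {x = zero} _ (true ∷ c′)  = inj₁ (true ∷ c′ , 0 , here ∷ pass-skip₁ c′)
remove-total {x = zero} _ (false ∷ c′) = inj₂ (true ∷ c′ , take ∷ pass-skip₁ c′)
remove-total {x = suc x} (s≤s lt) (b ∷ c′) with remove-total lt c′
... | inj₁ (c , y , p) = inj₁ (b ∷ c , suc y , skip₀ ∷ p)
remove-total {x = suc x} (s≤s lt) (true ∷ c′)  | inj₂ (c , p) = inj₁ (false ∷ c , 0 , put ∷ p)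
remove-total {x = suc x} (s≤s lt) (false ∷ c′) | inj₂ (c , p) = inj₂ (false ∷ c , move ∷ p)

ins-det : ∀ {n y x x₂} {c c′ c₂ : Vec Bool n} → Ins y c c′ x → Ins y c c₂ x₂ → c′ ≡ c₂ × x ≡ x₂
ins-det p q with pass-detL p q
... | _ , e , h = e , hot-injective (ins-out-< p) h

app-det : ∀ {n y} {c c′ c₂ : Vec Bool n} → App y c c′ → App y c c₂ → c′ ≡ c₂
app-det p q = proj₁ (proj₂ (pass-detL p q))

pop-det : ∀ {n x x₂} {c c′ c₂ : Vec Bool n} → Pop c c′ x → Pop c c₂ x₂ → c′ ≡ c₂ × x ≡ x₂
pop-det p q with pass-detL p q
... | _ , e , h = e , hot-injective (pop-< p) h

ins≢app : ∀ {n y x} {c c′ c₂ : Vec Bool n} → Ins y c c′ x → ¬ App y c c₂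
ins≢app p q with pass-detL p q
... | () , _

pop≢zeros : ∀ {n x} {c′ : Vec Bool n} → ¬ Pop (zeros n) c′ x
pop≢zeros p = zeros-∌ (pop-∋ p)

ins≢zeros : ∀ {n x y} {c′ : Vec Bool n} → ¬ Ins y (zeros n) c′ x
ins≢zeros p = zeros-∌ (ins-∋ p)

ins-detR : ∀ {n y y₂ x} {c c′ c₂ : Vec Bool n} → Ins y c c′ x → Ins y₂ c₂ c′ x → c ≡ c₂ × y ≡ y₂
ins-detR p q with pass-detR p q
... | _ , h , e = e , hot-injective (ins-in-< p) h

pop-detR : ∀ {n x} {c c′ c₂ : Vec Bool n} → Pop c c′ x → Pop c₂ c′ x → c ≡ c₂
pop-detR p q = proj₂ (proj₂ (pass-detR p q))

app-zeros : ∀ {n y} → y < n → App y (zeros n) (hot n y)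
app-zeros {suc n} {zero}  _        = put ∷ pass-move n
app-zeros {suc n} {suc y} (s≤s lt) = skip₀ ∷ app-zeros lt

pop-hot : ∀ {n x} → x < n → Pop (hot n x) (zeros n) x
pop-hot {suc n} {zero}  _        = take ∷ pass-skip₁ (zeros n)
pop-hot {suc n} {suc y} (s≤s lt) = move ∷ pop-hot lt

ins-hot : ∀ {n y x} → y ≤ x → x < n → Ins y (hot n x) (hot n y) x
ins-hot {suc n} {zero}  {zero}  _        _        = here ∷ pass-skip₁ (zeros n)
ins-hot {suc n} {zero}  {suc x} _        (s≤s lt) = put ∷ pop-hot lt
ins-hot {suc n} {suc y} {suc x} (s≤s le) (s≤s lt) = skip₀ ∷ ins-hot le lt

-- The exchange rule for single letters, in both directions

ins-ins-swap : ∀ {n p y x z} {c c′ e e′ f d : Vec Bool n} → Swap p 0 c e f d →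
  Ins y c c′ x → Ins x e e′ z →
  ∃[ f′ ] ∃[ v ] ∃[ d′ ] Ins y f f′ v × Ins v d d′ z × Swap p 0 c′ e′ f′ d′
ins-ins-swap w i j with pass-sim bb w i j
... | result i′ j′ w′ dd with pass-out (λ ()) i′
...   | v , _ , refl = _ , v , _ , i′ , j′ , w′

-- The end state is `ek`: on the other side y still waits in f, and nothing has entered d.
ins-app-swap : ∀ {n p y x} {c c′ e e′ f d : Vec Bool n} → Swap p 0 c e f d →
  Ins y c c′ x → App x e e′ →
  ∃[ f′ ] App y f f′ × Swap p 0 c′ e′ f′ d
ins-app-swap {d = d} w i j with pass-sim bb w i j
... | result i′ j′ w′ ek with pass-before-carry i′
...   | refl with pass-detL (pass-skip₀ d) j′
...     | _ , refl , _ = _ , i′ , w′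

pop-ins-swap : ∀ {n p x z} {c c′ e e′ f d : Vec Bool n} → Swap p 0 c e f d →
  Pop c c′ x → Ins x e e′ z →
  ∃[ f′ ] ∃[ v ] ∃[ d′ ] Pop f f′ v × Ins v d d′ z × Swap (suc p) 0 c′ e′ f′ d′
pop-ins-swap w i j with pass-sim kk w i j
... | result i′ j′ w′ dd with pass-out (λ ()) i′
...   | v , _ , refl = _ , v , _ , i′ , j′ , w′

-- Again the end state is `ek`, but now the scan of f runs from `carry` to `carry`, which only an
-- empty column allows.
pop-app-swap : ∀ {n p x} {c c′ e e′ f d : Vec Bool n} → Swap p 0 c e f d →
  Pop c c′ x → App x e e′ →
  f ≡ zeros n × Swap (suc p) 0 c′ e′ f d
pop-app-swap {d = d} w i j with pass-sim kk w i j
... | result i′ j′ w′ ek with pass-carry-carry i′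
...   | refl , refl , refl , refl with pass-detL (pass-skip₀ d) j′
...     | _ , refl , _ = refl , w′

ins-ins-swapR : ∀ {n q x y v} {X G Z Z′ C C₁ : Vec Bool n} → Swap q 0 X G Z C₁ →
  Ins y C C₁ x → Ins v Z′ Z y →
  ∃[ w ] ∃[ G′ ] ∃[ X′ ] Ins w G′ G x × Swap q 0 X′ G′ Z′ C
ins-ins-swapR {Z′ = Z′} {C} s i j with pass-sim bb (swap-rev s) (pass-rev i) (pass-rev j)
... | result i′ j′ s′ dd with pass-unrev i′ | swap-unrev s′
...   | i″ | s″ with pass-in (λ ()) i″
...     | w , _ , eq rewrite eq = w , _ , _ , i″ , s″

-- Here y takes the place of an -∞ of Z. In the reversed alphabet this is the end state `ee`, in
-- which the pending number drops by one.
ins-pop-swapR : ∀ {n q x y} {X G Z Z′ C C₁ : Vec Bool n} → Swap (suc q) 0 X G Z C₁ →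
  Ins y C C₁ x → Pop Z′ Z y →
  ∃[ w ] ∃[ G′ ] ∃[ X′ ] Ins w G′ G x × Swap q 0 X′ G′ Z′ C
ins-pop-swapR {Z′ = Z′} {C} s i j with pass-sim bb (swap-rev s) (pass-rev i) (pass-rev j)
... | result i′ j′ s′ ee with pass-unrev i′ | swap-unrev s′
...   | i″ | s″ with pass-in (λ ()) i″
...     | w , _ , eq rewrite eq = w , _ , _ , i″ , s″

-- Here x takes the place of an -∞ of C. This -∞ leaves C on the left and joins those of Z, so that
-- q grows while Z stays the same.
pop-swapR : ∀ {n q x} {X G Z C C₁ : Vec Bool n} → Swap q 0 X G Z C₁ → Pop C C₁ x →
  ∃[ G′ ] ∃[ X′ ] Pop G′ G x × Swap (suc q) 0 X′ G′ Z C
pop-swapR {n} {Z = Z} {C} s i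
  with pass-sim bb (swap-rev s) (pass-rev i) (pass-rev (pass-skip₁ Z))
... | result i′ j′ s′ kk with pass-unrev i′ | swap-unrev s′
...   | i″ | s″ with pass-carry-zeros (λ ()) i″
...     | eq rewrite eq = _ , _ , i″ , s″

Decr : List ℕ → Set
Decr = Linked _≥_

Blocks : Set
Blocks = List (List ℕ)

variable
  n : ℕ
  C C₁ C′ D D₁ D′ E E₁ E₂ E′ F F′ : Vec Bool n
  x y : ℕ
  xs ys zs vs : List ℕ
  X Y Z Z₂ V W : Blocks

-- Passing blocks of letters through a column

data InsRun : ∀ {n} → Vec Bool n → List ℕ → Vec Bool n → List ℕ → Set where
  []  : InsRun C [] C []
  _∷_ : Ins y C C₁ x → InsRun C₁ ys C′ xs → InsRun C (y ∷ ys) C′ (x ∷ xs)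

data InsRuns : ∀ {n} → Vec Bool n → Blocks → Vec Bool n → Blocks → Set where
  []  : InsRuns C [] C []
  _∷_ : InsRun C ys C₁ xs → InsRuns C₁ Y C′ X → InsRuns C (ys ∷ Y) C′ (xs ∷ X)

data QCols : ∀ {n} → Vec Bool n → Blocks → Vec Bool n → Blocks → Set where
  []   : QCols E [] E []
  skip : QCols E X E′ Z → QCols E ([] ∷ X) E′ ([] ∷ Z)
  blk  : App x E E₁ → InsRun E₁ xs E₂ zs → QCols E₂ X E′ Z → QCols E ((x ∷ xs) ∷ X) E′ (zs ∷ Z)

data PopRun : ∀ {n} → Vec Bool n → List ℕ → Vec Bool n → List ℕ → Set where
  pop : Pop C C′ x → PopRun C [] C′ (x ∷ [])
  _∷_ : Ins y C C₁ x → PopRun C₁ ys C′ xs → PopRun C (y ∷ ys) C′ (x ∷ xs)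

data PopRuns : ∀ {n} → Vec Bool n → Blocks → Vec Bool n → Blocks → Set where
  []   : PopRuns C [] C []
  skip : PopRuns C Y C′ X → PopRuns C ([] ∷ Y) C′ ([] ∷ X)
  blk  : PopRun C ys C₁ xs → PopRuns C₁ Y C′ X → PopRuns C (ys ∷ Y) C′ (xs ∷ X)

-- The recording tableau of X is std(key α), with α the block lengths, all at most m.
Q : ℕ → ℕ → Blocks → Set
Q n zero    X = All (_≡ []) X
Q n (suc m) X = ∃[ E ] ∃[ Z ] QCols (zeros n) X E Z × Q n m Z

insRun-det : ∀ {C₂ : Vec Bool n} {zs} → InsRun C ys C′ xs → InsRun C ys C₂ zs → C′ ≡ C₂ × xs ≡ zs
insRun-det [] [] = refl , refl
insRun-det (i ∷ r) (j ∷ s) with ins-det i j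
... | refl , refl with insRun-det r s
...   | refl , refl = refl , refl

qcols-det : QCols E X E′ Z → QCols E X E₂ Z₂ → E′ ≡ E₂ × Z ≡ Z₂
qcols-det [] [] = refl , refl
qcols-det (skip q) (skip r) with qcols-det q r
... | refl , refl = refl , refl
qcols-det (blk a i q) (blk b j r) with app-det a b
... | refl with insRun-det i j
...   | refl , refl with qcols-det q r
...     | refl , refl = refl , refl

insRun-swap : ∀ {p} → Swap p 0 C E F D → InsRun C ys C′ xs → InsRun E xs E′ zs →
  ∃[ F′ ] ∃[ vs ] ∃[ D′ ] InsRun F ys F′ vs × InsRun D vs D′ zs × Swap p 0 C′ E′ F′ D′
insRun-swap w [] [] = _ , _ , _ , [] , [] , w
insRun-swap w (i ∷ is) (j ∷ js) with ins-ins-swap w i j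
... | _ , _ , _ , i′ , j′ , w′ with insRun-swap w′ is js
...   | _ , _ , _ , is′ , js′ , w″ = _ , _ , _ , i′ ∷ is′ , j′ ∷ js′ , w″

insRun-swap⁻¹ : ∀ {p} → Swap p 0 C E F D → InsRun C ys C′ xs → InsRun F ys F′ vs →
  ∃[ E′ ] ∃[ zs ] InsRun E xs E′ zs
insRun-swap⁻¹ w [] [] = _ , _ , []
insRun-swap⁻¹ {E = E} w (i ∷ is) (k ∷ ks) with insert-total (ins-out-< i) E
... | inj₂ (_ , a) = ⊥-elim (ins≢app k (proj₁ (proj₂ (ins-app-swap w i a))))
... | inj₁ (_ , _ , j) with ins-ins-swap w i j
...   | _ , _ , _ , k′ , _ , w′ with ins-det k k′
...     | refl , refl with insRun-swap⁻¹ w′ is ks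
...       | _ , _ , js = _ , _ , j ∷ js

qcols-swap : ∀ {p} → Swap p 0 C E F D → InsRuns C Y C′ X → QCols E X E′ Z →
  ∃[ F′ ] ∃[ V ] ∃[ D′ ] QCols F Y F′ V × InsRuns D V D′ Z
qcols-swap w [] [] = _ , _ , _ , [] , []
qcols-swap w ([] ∷ is) (skip q) with qcols-swap w is q
... | _ , _ , _ , q′ , r = _ , _ , _ , skip q′ , [] ∷ r
qcols-swap w ((i ∷ is) ∷ iss) (blk a js q) with ins-app-swap w i a
... | _ , a′ , w₁ with insRun-swap w₁ is js
...   | _ , _ , _ , is′ , js′ , w₂ with qcols-swap w₂ iss q
...     | _ , _ , _ , q′ , r = _ , _ , _ , blk a′ is′ q′ , js′ ∷ r

qcols-swap⁻¹ : ∀ {p} → Swap p 0 C E F D → InsRuns C Y C′ X → QCols F Y F′ V →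
  ∃[ E′ ] ∃[ Z ] QCols E X E′ Z
qcols-swap⁻¹ w [] [] = _ , _ , []
qcols-swap⁻¹ w ([] ∷ is) (skip q) with qcols-swap⁻¹ w is q
... | _ , _ , q′ = _ , _ , skip q′
qcols-swap⁻¹ {E = E} w ((i ∷ is) ∷ iss) (blk a ks q) with insert-total (ins-out-< i) E
... | inj₁ (_ , _ , j) = ⊥-elim (ins≢app (proj₁ (proj₂ (proj₂ (proj₂ (ins-ins-swap w i j))))) a)
... | inj₂ (_ , b) with ins-app-swap w i b
...   | _ , a′ , w₁ with app-det a a′
...     | refl with insRun-swap⁻¹ w₁ is ks
...       | _ , _ , js with insRun-swap w₁ is js
...         | _ , _ , _ , ks′ , _ , w₂ with insRun-det ks ks′
...           | refl , refl with qcols-swap⁻¹ w₂ iss q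
...             | _ , _ , q′ = _ , _ , blk b js q′

swap-free : (C : Vec Bool n) → Swap 0 0 C (zeros n) (zeros n) C
swap-free []          = []
swap-free (true ∷ C)  = free ∷ swap-free C
swap-free (false ∷ C) = none ∷ swap-free C

insRuns-empty : InsRuns C Y C′ X → All (_≡ []) X → All (_≡ []) Y
insRuns-empty [] [] = []
insRuns-empty ([] ∷ is) (refl ∷ es) = refl ∷ insRuns-empty is es

insRuns-empty⁻¹ : InsRuns C Y C′ X → All (_≡ []) Y → All (_≡ []) X
insRuns-empty⁻¹ [] [] = []
insRuns-empty⁻¹ ([] ∷ is) (refl ∷ es) = refl ∷ insRuns-empty⁻¹ is es

-- While the recording column is empty, all of C is free, and the exchange moves C as a whole behind
-- it. Hence Y meets an empty recording column first, and the letters bumped there pass through C;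
-- the induction hypothesis applies to these.
Q-insRuns : ∀ m {C C′ : Vec Bool n} → InsRuns C Y C′ X → Q n m X → Q n m Y
Q-insRuns zero    is es = insRuns-empty is es
Q-insRuns (suc m) {C} is (_ , _ , q , h) with qcols-swap (swap-free C) is q
... | _ , _ , _ , q′ , r = _ , _ , q′ , Q-insRuns m r h

Q-insRuns⁻¹ : ∀ m {C C′ : Vec Bool n} → InsRuns C Y C′ X → Q n m Y → Q n m X
Q-insRuns⁻¹ zero    is es = insRuns-empty⁻¹ is es
Q-insRuns⁻¹ (suc m) {C} is (_ , _ , q , h) with qcols-swap⁻¹ (swap-free C) is q
... | _ , _ , q′ with qcols-swap (swap-free C) is q′
...   | _ , _ , _ , q″ , r with qcols-det q q″
...     | refl , refl = _ , _ , q′ , Q-insRuns⁻¹ m r h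

hot≢zeros : ∀ {a} → a < n → hot n a ≢ zeros n
hot≢zeros a<n eq = zeros-∌ (subst (_∋ _) eq (hot-∋ a<n))

-- The column f holds just the preceding letter y of the block. The next letter is at most y,
-- replaces it and sends it on to d; the final `Pop` sends the last letter. So f merely delays the
-- block by one letter, and d receives it unchanged.
popRun-swap : ∀ {p} {D E : Vec Bool n} → Swap p 0 C E (hot n y) D → y < n → Decr (y ∷ ys) → PopRun C ys C′ xs →
  ∃[ E′ ] ∃[ zs ] ∃[ D′ ] InsRun E xs E′ zs × InsRun D (y ∷ ys) D′ zs × Swap (suc p) 0 C′ E′ (zeros n) D′
popRun-swap {E = E} w y<n _ (pop p) with insert-total (pop-< p) E
... | inj₂ (_ , a) = ⊥-elim (hot≢zeros y<n (proj₁ (pop-app-swap w p a)))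
... | inj₁ (_ , _ , j) with pop-ins-swap w p j
...   | _ , _ , _ , p′ , j′ , w′ with pop-det (pop-hot y<n) p′
...     | refl , refl = _ , _ , _ , j ∷ [] , j′ ∷ [] , w′
popRun-swap {E = E} w y<n (le ∷ dec) (i ∷ is) with insert-total (ins-out-< i) E
... | inj₂ (_ , a) = ⊥-elim (ins≢app (ins-hot le y<n) (proj₁ (proj₂ (ins-app-swap w i a))))
... | inj₁ (_ , _ , j) with ins-ins-swap w i j
...   | _ , _ , _ , i′ , j′ , w′ with ins-det (ins-hot le y<n) i′
...     | refl , refl with popRun-swap w′ (ins-in-< i) dec is
...       | _ , _ , _ , js , ks , w″ = _ , _ , _ , j ∷ js , j′ ∷ ks , w″

-- Between two blocks the matched column f of Swap is empty.
popRuns-qcols : ∀ {p} {C E D : Vec Bool n} → Swap p 0 C E (zeros n) D → All Decr Y → PopRuns C Y C′ X →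
  ∃[ E′ ] ∃[ Z ] ∃[ D′ ] QCols E X E′ Z × InsRuns D Y D′ Z
popRuns-qcols w _ [] = _ , _ , _ , [] , []
popRuns-qcols w (_ ∷ decs) (skip r) with popRuns-qcols w decs r
... | _ , _ , _ , q , is = _ , _ , _ , skip q , [] ∷ is
popRuns-qcols {E = E} w (_ ∷ decs) (blk (pop p) r) with insert-total (pop-< p) E
... | inj₁ (_ , _ , j) = ⊥-elim (pop≢zeros (proj₁ (proj₂ (proj₂ (proj₂ (pop-ins-swap w p j))))))
... | inj₂ (_ , a) with popRuns-qcols (proj₂ (pop-app-swap w p a)) decs r
...   | _ , _ , _ , q , is = _ , _ , _ , blk a [] q , [] ∷ is
popRuns-qcols {E = E} w (dec ∷ decs) (blk (i ∷ is) r) with insert-total (ins-out-< i) E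
... | inj₁ (_ , _ , j) = ⊥-elim (ins≢zeros (proj₁ (proj₂ (proj₂ (proj₂ (ins-ins-swap w i j))))))
... | inj₂ (_ , a) with ins-app-swap w i a
...   | _ , a′ , w₁ with app-det (app-zeros (ins-in-< i)) a′
...     | refl with popRun-swap w₁ (ins-in-< i) dec is
...       | _ , _ , _ , js , ks , w₂ with popRuns-qcols w₂ decs r
...         | _ , _ , _ , q , kss = _ , _ , _ , blk a js q , ks ∷ kss

-- By `popRuns-qcols` the letters Z that the recording column bumps out of X are those of Y passed
-- through C without any removal. This reduces the claim to plain runs.
Q-popRuns : ∀ m {C C′ : Vec Bool n} → All Decr Y → PopRuns C Y C′ X → Q n m Y → Q n (suc m) X
Q-popRuns m {C} decs r h with popRuns-qcols (swap-free C) decs r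
... | _ , _ , _ , q , is = _ , _ , q , Q-insRuns⁻¹ m is h

-- Inverting the removal step by counting

size : Vec Bool n → ℕ
size []          = 0
size (true ∷ c)  = suc (size c)
size (false ∷ c) = size c

count-zeros : ∀ n → size (zeros n) ≡ 0
count-zeros zero    = refl
count-zeros (suc n) = count-zeros n

count-hot : ∀ {n a} → a < n → size (hot n a) ≡ 1
count-hot {suc n} {zero}  _        = cong suc (count-zeros n)
count-hot {suc n} {suc a} (s≤s lt) = count-hot lt

pass-count : ∀ {s t} {y c c′ x : Vec Bool n} → Pass s t y c c′ x → size y + size c ≡ size c′ + size x
pass-count [] = refl
pass-count {y = y ∷ ys} (skip₀ {true} ∷ p) = trans (+-suc (size ys) _) (cong suc (pass-count p))
pass-count (skip₀ {false} ∷ p) = pass-count p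
pass-count {y = true ∷ ys} {c′ = _ ∷ cs} (here ∷ p) =
  cong suc (trans (+-suc (size ys) _) (trans (cong suc (pass-count p)) (sym (+-suc (size cs) _))))
pass-count (put ∷ p)   = cong suc (pass-count p)
pass-count (move ∷ p)  = pass-count p
pass-count {y = y ∷ ys} {c′ = _ ∷ cs} (take ∷ p) =
  trans (+-suc (size ys) _) (trans (cong suc (pass-count p)) (sym (+-suc (size cs) _)))
pass-count {y = y ∷ ys} (skip₁ {true} ∷ p) = trans (+-suc (size ys) _) (cong suc (pass-count p))
pass-count (skip₁ {false} ∷ p) = pass-count p

ins-count : {c c′ : Vec Bool n} → Ins y c c′ x → size c ≡ size c′
ins-count {c′ = c′} i with pass-count i
... | eq rewrite count-hot (ins-in-< i) | count-hot (ins-out-< i) | +-comm (size c′) 1 = suc-injective eq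

app-count : {c c′ : Vec Bool n} → App y c c′ → size c′ ≡ suc (size c)
app-count {n} {c′ = c′} i with pass-count i
... | eq rewrite count-hot (app-< i) | count-zeros n | +-identityʳ (size c′) = sym eq

pop-count : {c c′ : Vec Bool n} → Pop c c′ x → size c ≡ suc (size c′)
pop-count {n} {c′ = c′} i with pass-count i
... | eq rewrite count-hot (pop-< i) | count-zeros n | +-comm (size c′) 1 = eq

swap-count : ∀ {p q} {c e f d : Vec Bool n} → Swap p q c e f d → size e + q ≡ p + size f
swap-count {p = p} [] = sym (+-identityʳ p)
swap-count (none ∷ w) = swap-count w
swap-count {p = p} (open′ ∷ w) = trans (swap-count w) (sym (+-suc p _))
swap-count (close ∷ w) = cong suc (swap-count w)
swap-count {p = p} (both ∷ w) = trans (cong suc (swap-count w)) (sym (+-suc p _))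
swap-count (free ∷ w) = swap-count w

swap-zeros : ∀ {p q} {e f d : Vec Bool n} → Swap p q (zeros n) e f d → f ≡ zeros n
swap-zeros {zero}  [] = refl
swap-zeros {suc n} (none ∷ w)  = cong (false ∷_) (swap-zeros w)
swap-zeros {suc n} (close ∷ w) = cong (false ∷_) (swap-zeros w)

-- PopRuns with b defective blocks, in which no letter is popped.
data MixedRuns : ∀ {n} → Vec Bool n → Blocks → Vec Bool n → Blocks → ℕ → Set where
  []   : MixedRuns C [] C [] 0
  skip : ∀ {b} → MixedRuns C Y C′ X b → MixedRuns C ([] ∷ Y) C′ ([] ∷ X) b
  good : ∀ {b} → PopRun C ys C₁ xs → MixedRuns C₁ Y C′ X b → MixedRuns C (ys ∷ Y) C′ (xs ∷ X) b
  bad  : ∀ {b} → Ins y C C₁ x → InsRun C₁ ys D₁ xs → MixedRuns D₁ Y C′ X b →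
         MixedRuns C ((y ∷ ys) ∷ Y) C′ ((x ∷ xs) ∷ X) (suc b)

mixed-popRuns : MixedRuns C Y C′ X 0 → PopRuns C Y C′ X
mixed-popRuns []         = []
mixed-popRuns (skip r)   = skip (mixed-popRuns r)
mixed-popRuns (good p r) = blk p (mixed-popRuns r)

-- The block is undone from its last letter on, and only this one can turn out to be a `Pop`:
-- afterwards the column contains the letter just put back, which is at most the letter before it,
-- so that this one finds something to drive out.
mixed-block : All (_< n) (x ∷ xs) → Decr (x ∷ xs) → (C′ : Vec Bool n) →
  ∃[ C ] ∃[ ys ] (PopRun C ys C′ (x ∷ xs) ⊎ InsRun C ys C′ (x ∷ xs)) × C ∋ x × Decr (x ∷ ys) × All (_< n) ys
mixed-block {xs = []} (x<n ∷ []) _ C′ with remove-total x<n C′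
... | inj₁ (_ , _ , i) = _ , _ , inj₂ (i ∷ []) , ins-∋ i , ins-≤ i ∷ [-] , ins-in-< i ∷ []
... | inj₂ (_ , p)     = _ , _ , inj₁ (pop p) , pop-∋ p , [-] , []
mixed-block {xs = x₂ ∷ xs} (x<n ∷ lts) (le ∷ dec) C′ with mixed-block lts dec C′
... | C₁ , ys , r , m , dec′ , lts′ with remove-total x<n C₁
...   | inj₂ (_ , p) = ⊥-elim (<⇒≱ (proj₂ (pop-new p m)) le)
...   | inj₁ (C , y , i) =
        C , y ∷ ys , Sum.map (i ∷_) (i ∷_) r , ins-∋ i , ins-≤ i ∷ raise (ins-max i m le) dec′ , ins-in-< i ∷ lts′
  where
    raise : ∀ {a b zs} → a ≤ b → Decr (a ∷ zs) → Decr (b ∷ zs)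
    raise a≤b [-]       = [-]
    raise a≤b (h ∷ dec) = ≤-trans h a≤b ∷ dec

decr-tail : Decr (x ∷ xs) → Decr xs
decr-tail [-]      = []
decr-tail (_ ∷ ds) = ds

mixed-runs : (X : Blocks) → All (All (_< n)) X → All Decr X →
  ∃[ C ] ∃[ Y ] ∃[ b ] MixedRuns C Y (zeros n) X b × All Decr Y × All (All (_< n)) Y
mixed-runs [] _ _ = _ , _ , _ , [] , [] , []
mixed-runs ([] ∷ X) (_ ∷ lts) (_ ∷ decs) with mixed-runs X lts decs
... | _ , _ , _ , r , decs′ , lts′ = _ , _ , _ , skip r , [] ∷ decs′ , [] ∷ lts′
mixed-runs ((x ∷ xs) ∷ X) (lt ∷ lts) (dec ∷ decs) with mixed-runs X lts decs
... | C₁ , _ , _ , r , decs′ , lts′ with mixed-block lt dec C₁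
...   | _ , _ , inj₁ p , _ , dec′ , lt′ = _ , _ , _ , good p r , decr-tail dec′ ∷ decs′ , lt′ ∷ lts′
...   | _ , _ , inj₂ (i ∷ is) , _ , dec′ , lt′ = _ , _ , _ , bad i is r , decr-tail dec′ ∷ decs′ , lt′ ∷ lts′

insRun-count : {C C′ : Vec Bool n} → InsRun C ys C′ xs → size C ≡ size C′
insRun-count []       = refl
insRun-count (i ∷ is) = trans (ins-count i) (insRun-count is)

popRun-swap′ : ∀ {p} → Swap p 0 C E F D → PopRun C ys C′ xs → InsRun E xs E′ zs →
  ∃[ F′ ] ∃[ D′ ] Swap (suc p) 0 C′ E′ F′ D′
popRun-swap′ w (pop p) (j ∷ []) with pop-ins-swap w p j
... | _ , _ , _ , _ , _ , w′ = _ , _ , w′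
popRun-swap′ w (i ∷ is) (j ∷ js) with ins-ins-swap w i j
... | _ , _ , _ , _ , _ , w′ = popRun-swap′ w′ is js

-- Once all letters have passed, c and hence f are empty, so that the number of popped letters is
-- the size of e, which is the number of nonempty blocks: no block is defective.
mixed-count : ∀ {p b} → Swap p 0 C E F D → MixedRuns C Y C′ X b → QCols E X E′ Z →
  ∃[ F′ ] ∃[ D′ ] ∃[ p′ ] Swap p′ 0 C′ E′ F′ D′ × p′ + b + size E ≡ p + size E′
mixed-count {E = E} {p = p} w [] [] = _ , _ , p , w , cong (_+ size E) (+-identityʳ p)
mixed-count w (skip r) (skip q) = mixed-count w r q
mixed-count {p = p} w (good (pop o) r) (blk {E₁ = E₁} a [] q) with mixed-count (proj₂ (pop-app-swap w o a)) r q
... | _ , _ , p′ , w′ , eq rewrite app-count a = _ , _ , _ , w′ , suc-injective (trans (sym (+-suc _ _)) eq)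
mixed-count {p = p} w (good (i ∷ is) r) (blk a js q) with ins-app-swap w i a
... | _ , _ , w₁ with popRun-swap′ w₁ is js
...   | _ , _ , w₂ with mixed-count w₂ r q
...     | _ , _ , p′ , w′ , eq rewrite sym (insRun-count js) | app-count a =
          _ , _ , _ , w′ , suc-injective (trans (sym (+-suc _ _)) eq)
mixed-count {E = E} {b = suc b} w (bad i is r) (blk a js q) with ins-app-swap w i a
... | _ , _ , w₁ with insRun-swap w₁ is js
...   | _ , _ , _ , _ , _ , w₂ with mixed-count w₂ r q
...     | _ , _ , p′ , w′ , eq rewrite sym (insRun-count js) | app-count a =
          _ , _ , _ , w′ , trans (trans (cong (_+ size E) (+-suc p′ b)) (sym (+-suc (p′ + b) (size E)))) eq

-- Running X backwards from the empty column yields C and Y. Once no block is defective, the forward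
-- lemma `popRuns-qcols` shows that the letters bumped out of X are those of Y passed through C.
Q-popRuns⁻¹ : ∀ m → All (All (_< n)) X → All Decr X → Q n (suc m) X →
  ∃[ C ] ∃[ Y ] PopRuns C Y (zeros n) X × All Decr Y × All (All (_< n)) Y × Q n m Y
Q-popRuns⁻¹ {n} {X} m lts decs (_ , _ , q , h) with mixed-runs X lts decs
... | C , _ , b , r , decs′ , lts′ with mixed-count (swap-free C) r q
...   | _ , _ , p′ , w , eq with swap-zeros w
...     | refl with b≡0 (swap-count w) eq
  where
    b≡0 : ∀ {e} → e + 0 ≡ p′ + size (zeros n) → p′ + b + size (zeros n) ≡ e → b ≡ 0
    b≡0 eq₁ eq₂ rewrite count-zeros n | +-identityʳ p′ | +-identityʳ (p′ + b) =
      +-cancelˡ-≡ p′ b 0 (trans eq₂ (trans (sym (+-identityʳ _)) (trans eq₁ (sym (+-identityʳ p′)))))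
...       | refl with mixed-popRuns r
...         | r′ with popRuns-qcols (swap-free C) decs′ r′
...           | _ , _ , _ , q′ , is with qcols-det q q′
...             | refl , refl = _ , _ , r′ , decs′ , lts′ , Q-insRuns m is h

-- Insertion from the right

acts : Blocks → List Bool
acts = map nonempty

-- A marks the rows that are nonempty once a further column is put in front of X.
data Act : List Bool → Blocks → Set where
  []  : Act [] []
  off : ∀ {A X} → Act A X → Act (false ∷ A) ([] ∷ X)
  on  : ∀ {A X xs} → Act A X → Act (true ∷ A) (xs ∷ X)

-- Active rows without a letter: no letter takes the -∞ they create, so this is the number of -∞
-- left at the end.
idle : List Bool → List Bool → ℕ
idle (true ∷ A) (false ∷ B) = suc (idle A B)
idle (_ ∷ A)    (_ ∷ B)     = idle A B
idle _          _           = 0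

-- Insertion from the right, starting from the empty column with the last block; the index q
-- counts elements −∞, one of which is created at the beginning of every active block.
data KRun {n} (q : ℕ) (Z : Vec Bool n) : List ℕ → ℕ → Vec Bool n → Set where
  []  : KRun q Z [] q Z
  ins : ∀ {y v ys q′ Z′ Z″} → KRun q Z ys q′ Z′ → Ins v Z″ Z′ y → KRun q Z (y ∷ ys) q′ Z″
  pop : ∀ {y ys q′ Z′ Z″} → KRun q Z ys (suc q′) Z′ → Pop Z″ Z′ y → KRun q Z (y ∷ ys) q′ Z″

data KRuns {n} : List Bool → Blocks → ℕ → Vec Bool n → Set where
  []  : KRuns [] [] 0 (zeros n)
  off : ∀ {A Y q Z} → KRuns A Y q Z → KRuns (false ∷ A) ([] ∷ Y) q Z
  on  : ∀ {A Y q Z ys q′ Z′} → KRuns A Y q Z → KRun (suc q) Z ys q′ Z′ → KRuns (true ∷ A) (ys ∷ Y) q′ Z′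

-- The last letter of xs is the first to enter G and takes the -∞ that its block has just created;
-- the others replace letters. Hence no older -∞ is touched, and `q₂` is arbitrary.
krun-popRun : ∀ {q q′ Z′} {R G Z C₁ C : Vec Bool n} → Swap q 0 R G Z C₁ → PopRun C ys C₁ xs →
  KRun (suc q) Z ys q′ Z′ → ∀ q₂ →
  ∃[ R′ ] ∃[ G′ ] Swap q′ 0 R′ G′ Z′ C × KRun (suc q₂) G xs q₂ G′
krun-popRun w (pop p) [] q₂ with pop-swapR w p
... | _ , _ , p′ , w′ = _ , _ , w′ , pop [] p′
krun-popRun w (i ∷ is) (ins ks k) q₂ with krun-popRun w is ks q₂
... | _ , _ , w₁ , ks′ with ins-ins-swapR w₁ i k
...   | _ , _ , _ , i′ , w₂ = _ , _ , w₂ , ins ks′ i′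
krun-popRun w (i ∷ is) (pop ks k) q₂ with krun-popRun w is ks q₂
... | _ , _ , w₁ , ks′ with ins-pop-swapR w₁ i k
...   | _ , _ , _ , i′ , w₂ = _ , _ , w₂ , ins ks′ i′

-- From the last block on, the letters of X enter C from the right and leave it as letters of Y,
-- which enter Z. Exchanging the two columns lets them enter G first.
kruns-popRuns : ∀ {q A Z} {C C′ : Vec Bool n} → PopRuns C Y C′ X → KRuns (acts X) Y q Z → Act A X →
  ∃[ R ] ∃[ G ] Swap q 0 R G Z C × KRuns A X (idle A (acts X)) G
kruns-popRuns {C = C} [] [] [] = _ , _ , swap-free C , []
kruns-popRuns (skip r) (off k) (off a) with kruns-popRuns r k a
... | _ , _ , w , k′ = _ , _ , w , off k′
kruns-popRuns (skip r) (off k) (on a) with kruns-popRuns r k a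
... | _ , _ , w , k′ = _ , _ , w , on k′ []
kruns-popRuns {A = true ∷ A} (blk {X = X} p@(pop _) r) (on k ks) (on a) with kruns-popRuns r k a
... | _ , _ , w , k′ with krun-popRun w p ks (idle A (acts X))
...   | _ , _ , w′ , ks′ = _ , _ , w′ , on k′ ks′
kruns-popRuns {A = true ∷ A} (blk {X = X} p@(_ ∷ _) r) (on k ks) (on a) with kruns-popRuns r k a
... | _ , _ , w , k′ with krun-popRun w p ks (idle A (acts X))
...   | _ , _ , w′ , ks′ = _ , _ , w′ , on k′ ks′

popRuns-take : ∀ k {C C′ : Vec Bool n} → PopRuns C Y C′ X → ∃[ C″ ] PopRuns C (takeL k Y) C″ (takeL k X)
popRuns-take zero    r         = _ , []
popRuns-take (suc k) []        = _ , []
popRuns-take (suc k) (skip r)  = _ , skip (proj₂ (popRuns-take k r))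
popRuns-take (suc k) (blk p r) = _ , blk p (proj₂ (popRuns-take k r))

popRuns-act : {C C′ : Vec Bool n} → PopRuns C Y C′ X → Act (acts X) Y
popRuns-act []                = []
popRuns-act (skip r)          = off (popRuns-act r)
popRuns-act (blk (pop _) r)   = on (popRuns-act r)
popRuns-act (blk (_ ∷ _) r)   = on (popRuns-act r)

act-take : ∀ k {A X} → Act A X → Act (takeL k A) (takeL k X)
act-take zero    a       = []
act-take (suc k) []      = []
act-take (suc k) (off a) = off (act-take k a)
act-take (suc k) (on a)  = on (act-take k a)

act-acts : ∀ X → Act (acts X) X
act-acts []             = []
act-acts ([] ∷ X)       = off (act-acts X)
act-acts ((_ ∷ _) ∷ X)  = on (act-acts X)

act-cong : ∀ {A X} Y → acts X ≡ acts Y → Act A X → Act A Y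
act-cong []             refl []      = []
act-cong ([] ∷ Y)       eq   (off a) = off (act-cong Y (cong (Data.List.drop 1) eq) a)
act-cong ((_ ∷ _) ∷ Y)  ()   (off a)
act-cong (_ ∷ Y)        eq   (on a)  = on (act-cong Y (cong (Data.List.drop 1) eq) a)

-- Greedy choice of the first column of a key tableau

set : ℕ → Vec Bool n → Vec Bool n
set _       []      = []
set zero    (_ ∷ v) = true ∷ v
set (suc a) (b ∷ v) = b ∷ set a v

heads : Vec Bool n → Blocks → Vec Bool n
heads S []             = S
heads S ([] ∷ T)       = heads S T
heads S ((t ∷ _) ∷ T)  = heads (set t S) T

data GTile : State → State → (s σ σ′ g g′ c t : Bool) → Set where
  skip₀ : ∀ {σ g c} → GTile before before false σ σ g g c false
  here  : GTile before after true false true false true true true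
  put   : ∀ {b} → GTile before carry true false true b b b false
  move  : ∀ {σ b} → GTile carry carry false σ σ b b b false
  take  : ∀ {σ} → GTile carry after false σ σ false true true true
  skip₁ : ∀ {σ g c} → GTile after after false σ σ g g c false

data Grab : State → State → ∀ {n} (s σ σ′ g g′ c t : Vec Bool n) → Set where
  []  : ∀ {s} → Grab s s [] [] [] [] [] [] []
  _∷_ : ∀ {a b d n s σ σ′ g g′ c t} {ss Σ Σ′ gs gs′ cs ts : Vec Bool n} →
        GTile a b s σ σ′ g g′ c t → Grab b d ss Σ Σ′ gs gs′ cs ts →
        Grab a d (s ∷ ss) (σ ∷ Σ) (σ′ ∷ Σ′) (g ∷ gs) (g′ ∷ gs′) (c ∷ cs) (t ∷ ts)

data GSim : State → ℕ → ℕ → Set where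
  bb : ∀ {p} → GSim before p p
  kk : ∀ {p} → GSim carry p (suc p)
  dd : ∀ {p} → GSim after p p

-- In `Swap r g σ c` the free brackets are the elements of c outside g. The search opens a bracket
-- at s and lets the first free element from there on close it: greedy choice is bracketing.
gtile-swap : ∀ {a b p p′ q s σ σ′ g g′ c t r} → GSim a p p′ → GTile a b s σ σ′ g g′ c t → Link p q r g σ c →
  ∃[ r′ ] ∃[ q′ ] Link p′ q′ r′ g′ σ′ c × GSim b q q′
gtile-swap bb skip₀ l     = _ , _ , l , bb
gtile-swap bb here  free  = _ , _ , both , dd
gtile-swap bb put   none  = _ , _ , open′ , kk
gtile-swap bb put   close = _ , _ , both , kk
gtile-swap kk move  none  = _ , _ , none , kk
gtile-swap kk move  open′ = _ , _ , open′ , kk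
gtile-swap kk move  close = _ , _ , close , kk
gtile-swap kk move  both  = _ , _ , both , kk
gtile-swap kk take  free  = _ , _ , close , dd
gtile-swap dd skip₁ l     = _ , _ , l , dd

grab-swap : ∀ {a b p p′ q} {s σ σ′ g g′ c t r : Vec Bool n} → GSim a p p′ → Grab a b s σ σ′ g g′ c t →
  Swap p q r g σ c → ∃[ r′ ] ∃[ q′ ] Swap p′ q′ r′ g′ σ′ c × GSim b q q′
grab-swap s [] [] = _ , _ , [] , s
grab-swap s (g ∷ gs) (l ∷ ls) with gtile-swap s g l
... | _ , _ , l′ , s′ with grab-swap s′ gs ls
...   | _ , _ , ls′ , s″ = _ , _ , l′ ∷ ls′ , s″

gtile-det : ∀ {a b b₂ s σ σ′ σ₂ g g′ g₂ c t t₂} → GTile a b s σ σ′ g g′ c t → GTile a b₂ s σ σ₂ g g₂ c t₂ →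
  b ≡ b₂ × σ′ ≡ σ₂ × g′ ≡ g₂ × t ≡ t₂
gtile-det skip₀ skip₀ = refl , refl , refl , refl
gtile-det here  here  = refl , refl , refl , refl
gtile-det put   put   = refl , refl , refl , refl
gtile-det move  move  = refl , refl , refl , refl
gtile-det take  take  = refl , refl , refl , refl
gtile-det skip₁ skip₁ = refl , refl , refl , refl

grab-det : ∀ {a b b₂} {s σ σ′ σ₂ g g′ g₂ c t t₂ : Vec Bool n} →
  Grab a b s σ σ′ g g′ c t → Grab a b₂ s σ σ₂ g g₂ c t₂ → b ≡ b₂ × σ′ ≡ σ₂ × g′ ≡ g₂ × t ≡ t₂
grab-det [] [] = refl , refl , refl , refl
grab-det (g ∷ gs) (h ∷ hs) with gtile-det g h
... | refl , refl , refl , refl with grab-det gs hs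
...   | refl , refl , refl , refl = refl , refl , refl , refl

-- GrabNext s S S′ G G′ C t: t is the least element ≥ s of C ∖ G, and S′ = S ∪ {s}, G′ = G ∪ {t}.
GrabNext : ∀ {n} → ℕ → (S S′ G G′ C : Vec Bool n) → ℕ → Set
GrabNext {n} s S S′ G G′ C t = Grab before after (hot n s) S S′ G G′ C (hot n t)

GrabFirst : ∀ {n} → (S G G′ C : Vec Bool n) → ℕ → Set
GrabFirst {n} S G G′ C t = Grab carry after (zeros n) S S G G′ C (hot n t)

grab-skip : (S G C : Vec Bool n) → Grab after after (zeros n) S S G G C (zeros n)
grab-skip []      []      []      = []
grab-skip (_ ∷ S) (_ ∷ G) (_ ∷ C) = skip₁ ∷ grab-skip S G C

grab-after : ∀ {b} {s σ σ′ g g′ c t : Vec Bool n} → Grab after b s σ σ′ g g′ c t →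
  b ≡ after × σ ≡ σ′ × g ≡ g′ × s ≡ zeros n × t ≡ zeros n
grab-after [] = refl , refl , refl , refl , refl
grab-after (skip₁ ∷ gs) with grab-after gs
... | refl , refl , refl , refl , refl = refl , refl , refl , refl , refl

grabFirst-total : ∀ {p q} {R G S C : Vec Bool n} → Swap p q R G S C →
  (∃[ G′ ] ∃[ t ] GrabFirst S G G′ C t) ⊎ Grab carry carry (zeros n) S S G G C (zeros n)
grabFirst-total [] = inj₂ []
grabFirst-total {G = _ ∷ G} {_ ∷ S} {_ ∷ C} (free ∷ w) = inj₁ (_ , 0 , take ∷ grab-skip S G C)
grabFirst-total (none ∷ w)  = Sum.map (λ { (_ , t , g) → _ , suc t , move ∷ g }) (move ∷_) (grabFirst-total w)
grabFirst-total (open′ ∷ w) = Sum.map (λ { (_ , t , g) → _ , suc t , move ∷ g }) (move ∷_) (grabFirst-total w)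
grabFirst-total (close ∷ w) = Sum.map (λ { (_ , t , g) → _ , suc t , move ∷ g }) (move ∷_) (grabFirst-total w)
grabFirst-total (both ∷ w)  = Sum.map (λ { (_ , t , g) → _ , suc t , move ∷ g }) (move ∷_) (grabFirst-total w)

grabNext-total : ∀ {p q s} {R G S C : Vec Bool n} → s < n → ¬ (S ∋ s) → Swap p q R G S C →
  (∃[ G′ ] ∃[ t ] GrabNext s S (set s S) G G′ C t) ⊎ Grab before carry (hot n s) S (set s S) G G C (zeros n)
grabNext-total {s = zero} _ ∌ (none ∷ w) =
  Sum.map (λ { (_ , t , g) → _ , suc t , put ∷ g }) (put ∷_) (grabFirst-total w)
grabNext-total {s = zero} _ ∌ (close ∷ w) =
  Sum.map (λ { (_ , t , g) → _ , suc t , put ∷ g }) (put ∷_) (grabFirst-total w)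
grabNext-total {s = zero} {G = _ ∷ G} {_ ∷ S} {_ ∷ C} _ ∌ (free ∷ w) = inj₁ (_ , 0 , here ∷ grab-skip S G C)
grabNext-total {s = zero} _ ∌ (open′ ∷ w) = ⊥-elim (∌ here)
grabNext-total {s = zero} _ ∌ (both ∷ w)  = ⊥-elim (∌ here)
grabNext-total {s = suc s} (s≤s lt) ∌ (_ ∷ w) =
  Sum.map (λ { (_ , t , g) → _ , suc t , skip₀ ∷ g }) (skip₀ ∷_) (grabNext-total lt (λ m → ∌ (there m)) w)

grabFirst-set : ∀ {t} {s S S′ G G′ C : Vec Bool n} → Grab carry after s S S′ G G′ C (hot n t) → G′ ≡ set t G
grabFirst-set {t = zero}  (take ∷ g) with grab-after g
... | _ , _ , refl , _ = refl
grabFirst-set {t = suc t} (move ∷ g) = cong (_ ∷_) (grabFirst-set g)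

grabNext-set : ∀ {s t} {S S′ G G′ C : Vec Bool n} → GrabNext s S S′ G G′ C t → G′ ≡ set t G
grabNext-set {s = zero} {zero} (here ∷ g) with grab-after g
... | _ , _ , refl , _ = refl
grabNext-set {s = zero} {suc t} (put ∷ g) = cong (_ ∷_) (grabFirst-set g)
grabNext-set {s = suc s} {suc t} (skip₀ ∷ g) = cong (_ ∷_) (grabNext-set g)
grabNext-set {suc n} {s = suc s} {zero} (() ∷ _)

grab-carry-Σ : ∀ {b} {s S S′ G G′ C t : Vec Bool n} → Grab carry b s S S′ G G′ C t → s ≡ zeros n × S ≡ S′
grab-carry-Σ [] = refl , refl
grab-carry-Σ (move ∷ g) with grab-carry-Σ g
... | refl , refl = refl , refl
grab-carry-Σ (take ∷ g) with grab-after g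
... | _ , refl , _ , refl , _ = refl , refl

grabNext-setΣ : ∀ {s} {S S′ G G′ C t : Vec Bool n} → Grab before after (hot n s) S S′ G G′ C t → S′ ≡ set s S
grabNext-setΣ {suc n} {s = zero} (here ∷ g) with grab-after g
... | _ , refl , _ = refl
grabNext-setΣ {suc n} {s = zero} (put ∷ g) with grab-carry-Σ g
... | _ , refl = refl
grabNext-setΣ {suc n} {s = suc s} (skip₀ ∷ g) = cong (_ ∷_) (grabNext-setΣ g)

grabFirst-∋ : ∀ {t} {s S S′ G G′ C : Vec Bool n} → Grab carry after s S S′ G G′ C (hot n t) → C ∋ t × ¬ (G ∋ t)
grabFirst-∋ {t = zero}  (take ∷ g) = here , λ ()
grabFirst-∋ {t = suc t} (move ∷ g) with grabFirst-∋ g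
... | m , ∌ = there m , λ { (there m′) → ∌ m′ }

grabFirst-min : ∀ {t a} {s S S′ G G′ C : Vec Bool n} → Grab carry after s S S′ G G′ C (hot n t) →
  C ∋ a → ¬ (G ∋ a) → t ≤ a
grabFirst-min {t = zero}  _ _ _ = z≤n
grabFirst-min {t = suc t} (move ∷ g) here      ∌ = ⊥-elim (∌ here)
grabFirst-min {t = suc t} (move ∷ g) (there m) ∌ = s≤s (grabFirst-min g m (λ m′ → ∌ (there m′)))

grabNext-∋ : ∀ {s t} {S S′ G G′ C : Vec Bool n} → GrabNext s S S′ G G′ C t → C ∋ t × ¬ (G ∋ t)
grabNext-∋ {s = zero} {zero} (here ∷ g) = here , λ ()
grabNext-∋ {s = zero} {suc t} (put ∷ g) with grabFirst-∋ g
... | m , ∌ = there m , λ { (there m′) → ∌ m′ }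
grabNext-∋ {s = suc s} {suc t} (skip₀ ∷ g) with grabNext-∋ g
... | m , ∌ = there m , λ { (there m′) → ∌ m′ }
grabNext-∋ {suc n} {s = suc s} {zero} (() ∷ _)

grabNext-≤ : ∀ {s t} {S S′ G G′ C : Vec Bool n} → GrabNext s S S′ G G′ C t → s ≤ t
grabNext-≤ {s = zero} _ = z≤n
grabNext-≤ {s = suc s} {suc t} (skip₀ ∷ g) = s≤s (grabNext-≤ g)
grabNext-≤ {suc n} {s = suc s} {zero} (() ∷ _)

grabNext-min : ∀ {s t a} {S S′ G G′ C : Vec Bool n} → GrabNext s S S′ G G′ C t →
  C ∋ a → ¬ (G ∋ a) → s ≤ a → t ≤ a
grabNext-min {s = zero} {zero} _ _ _ _ = z≤n
grabNext-min {s = zero} {suc t} (put ∷ g) here ∌ _ = ⊥-elim (∌ here)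
grabNext-min {s = zero} {suc t} (put ∷ g) (there m) ∌ _ = s≤s (grabFirst-min g m (λ m′ → ∌ (there m′)))
grabNext-min {s = suc s} {suc t} (skip₀ ∷ g) (there m) ∌ (s≤s le) =
  s≤s (grabNext-min g m (λ m′ → ∌ (there m′)) le)
grabNext-min {suc n} {s = suc s} {zero} (() ∷ _) _ _ _

data Grabs {n} (C : Vec Bool n) : (S G : Vec Bool n) → Blocks → Blocks → (S′ G′ : Vec Bool n) → Set where
  []    : ∀ {S G} → Grabs C S G [] [] S G
  skip  : ∀ {S G S′ G′ T T′} → Grabs C S G T′ T S′ G′ → Grabs C S G ([] ∷ T′) ([] ∷ T) S′ G′
  first : ∀ {S G G₁ S′ G′ T T′ t} → GrabFirst S G G₁ C t → Grabs C S G₁ T′ T S′ G′ →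
          Grabs C S G ([] ∷ T′) ((t ∷ []) ∷ T) S′ G′
  next  : ∀ {S G S₁ G₁ S′ G′ T T′ s t r} → GrabNext s S S₁ G G₁ C t → Grabs C S₁ G₁ T′ T S′ G′ →
          Grabs C S G ((s ∷ r) ∷ T′) ((t ∷ s ∷ r) ∷ T) S′ G′

-- Key tableaux and the correspondence, column by column

-- The last index C of `Grabs` demands that the greedy choice use up the whole set.
Key : ℕ → ℕ → Blocks → Set
Key n zero    T = All (_≡ []) T
Key n (suc m) T = ∃[ C ] ∃[ T′ ] ∃[ S′ ] Grabs {n} C (zeros n) (zeros n) T′ T S′ C × Key n m T′

-- The correspondence, one column at a time; m bounds the number of columns.
Bij : ℕ → ℕ → Blocks → Blocks → Set
Bij n zero    T D = All (_≡ []) T × All (_≡ []) D × length T ≡ length D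
Bij n (suc m) T D = ∃[ C ] ∃[ T′ ] ∃[ D′ ] ∃[ S′ ]
  Grabs {n} C (zeros n) (zeros n) T′ T S′ C × PopRuns C D′ (zeros n) D × acts T ≡ acts D × Bij n m T′ D′

bij-key : ∀ m {T D} → Bij n m T D → Key n m T
bij-key zero    (es , _) = es
bij-key (suc m) (_ , _ , _ , _ , g , _ , _ , b) = _ , _ , _ , g , bij-key m b

-- In a `first` step there is no s to open the bracket of t, so an -∞ opens it. The summand `idle`
-- counts these steps, that is, the rows of T of length one.
grabs-swap : ∀ {p} {R C S G S′ G′ : Vec Bool n} {T T′} → Grabs C S G T′ T S′ G′ → Swap p 0 R G S C →
  ∃[ R′ ] Swap (p + idle (acts T) (acts T′)) 0 R′ G′ S′ C
grabs-swap {p = p} [] w rewrite +-identityʳ p = _ , w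
grabs-swap (skip gs) w = grabs-swap gs w
grabs-swap {p = p} (first {T = T} {T′} g gs) w with grab-swap kk g w
... | _ , _ , w′ , dd rewrite +-suc p (idle (acts T) (acts T′)) = grabs-swap gs w′
grabs-swap (next g gs) w with grab-swap bb g w
... | _ , _ , w′ , dd = grabs-swap gs w′

grabs-take : ∀ k {C S G S′ G′ : Vec Bool n} {T T′} → Grabs C S G T′ T S′ G′ →
  Grabs C S G (takeL k T′) (takeL k T) (heads S (takeL k T′)) (heads G (takeL k T))
grabs-take zero    gs           = []
grabs-take (suc k) []           = []
grabs-take (suc k) (skip gs)    = skip (grabs-take k gs)
grabs-take (suc k) (first g gs) with grabFirst-set g
... | refl = first g (grabs-take k gs)
grabs-take (suc k) (next g gs) with grabNext-set g | grabNext-setΣ g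
... | refl | refl = next g (grabs-take k gs)

grabs-heads : {C S G S′ G′ : Vec Bool n} {T T′ : Blocks} → Grabs C S G T′ T S′ G′ →
  S′ ≡ heads S T′ × G′ ≡ heads G T
grabs-heads []        = refl , refl
grabs-heads (skip gs) = grabs-heads gs
grabs-heads (first g gs) with grabFirst-set g
... | refl = grabs-heads gs
grabs-heads (next g gs) with grabNext-set g | grabNext-setΣ g
... | refl | refl = grabs-heads gs

grabs-act : {C S G S′ G′ : Vec Bool n} {T T′ : Blocks} → Grabs C S G T′ T S′ G′ → Act (acts T) T′
grabs-act []           = []
grabs-act (skip gs)    = off (grabs-act gs)
grabs-act (first g gs) = on (grabs-act gs)
grabs-act (next g gs)  = on (grabs-act gs)

acts-empty : ∀ {T D : Blocks} → All (_≡ []) T → All (_≡ []) D → length T ≡ length D → T ≡ D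
acts-empty []          []          _  = refl
acts-empty (refl ∷ es) (refl ∷ fs) eq = cong ([] ∷_) (acts-empty es fs (suc-injective eq))

bij-acts : ∀ m {T D} → Bij n m T D → acts T ≡ acts D
bij-acts zero    (es , fs , eq) = cong acts (acts-empty es fs eq)
bij-acts (suc m) (_ , _ , _ , _ , _ , _ , eq , _) = eq

-- The first k blocks of D insert, from the right, to the first column of the first k rows of T.
KP : ℕ → Blocks → Blocks → Set
KP n T D = ∀ A → Act A D → ∀ k →
  KRuns {n} (takeL k A) (takeL k D) (idle (takeL k A) (acts (takeL k T))) (heads (zeros n) (takeL k T))

kruns-empty : ∀ {A D} k → All (_≡ []) D → Act A D →
  KRuns {n} (takeL k A) (takeL k D) (idle (takeL k A) (acts (takeL k D))) (heads (zeros n) (takeL k D))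
kruns-empty zero    _           _       = []
kruns-empty (suc k) []          []      = []
kruns-empty (suc k) (_ ∷ es)    (off a) = off (kruns-empty k es a)
kruns-empty (suc k) (refl ∷ es) (on a)  = on (kruns-empty k es a) []

acts-take : ∀ k {X Y} → acts X ≡ acts Y → acts (takeL k X) ≡ acts (takeL k Y)
acts-take k {X} {Y} eq =
  trans (sym (take-map {f = nonempty} k X)) (trans (cong (takeL k) eq) (take-map {f = nonempty} k Y))

bij-kp : ∀ m {T D} → Bij n m T D → KP n T D
bij-kp zero (es , fs , eq) A a k with acts-empty es fs eq
... | refl = kruns-empty k fs a
bij-kp {n} (suc m) {T} {D} (C , T′ , D′ , S′ , gs , r , eq , b) A a k
  -- For D′ the marks are `acts D`: they tell which rows are nonempty once C is put in front. This
  -- use is the reason why `KP` quantifies over A.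
  with popRuns-take k r | bij-kp m b (acts D) (popRuns-act r) k
... | _ , r′ | ks rewrite take-map {f = nonempty} k D
  with kruns-popRuns r′ ks (act-take k a) | grabs-swap (grabs-take k gs) (swap-free C)
... | R , G , w , ks′ | _ , w₂ rewrite acts-take k eq with swap-det w w₂
... | _ , _ , refl = ks′

-- From key tableaux to words

-- Equality of e and d excludes `free`, and every other link has c = f.
swap-same : ∀ {p q} {R G S : Vec Bool n} → Swap p q R G S G → R ≡ S
swap-same []          = refl
swap-same (none ∷ w)  = cong (false ∷_) (swap-same w)
swap-same (open′ ∷ w) = cong (true ∷_) (swap-same w)
swap-same (close ∷ w) = cong (false ∷_) (swap-same w)
swap-same (both ∷ w)  = cong (true ∷_) (swap-same w)

-- `Swap p 0 Z C Z C` says that Z together with p elements -∞ is completely matched with C. One -∞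
-- and the least element of C can be given up together, since no bracket closes before that element.
swap-pop : ∀ {p} {Z C : Vec Bool n} → Swap (suc p) 0 Z C Z C →
  ∃[ C′ ] ∃[ x ] Pop C C′ x × Swap p 0 Z C′ Z C′
swap-pop (none ∷ w) with swap-pop w
... | _ , x , o , w′ = _ , suc x , move ∷ o , none ∷ w′
swap-pop (open′ ∷ w) with swap-pop w
... | _ , x , o , w′ = _ , suc x , move ∷ o , open′ ∷ w′
swap-pop {C = _ ∷ C} (close ∷ w) = _ , 0 , take ∷ pass-skip₁ C , none ∷ w
swap-pop {C = _ ∷ C} (both ∷ w)  = _ , 0 , take ∷ pass-skip₁ C , open′ ∷ w

swap-empty : {C : Vec Bool n} → Swap 0 0 (zeros n) C (zeros n) C → C ≡ zeros n
swap-empty {zero}  []         = refl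
swap-empty {suc n} (none ∷ w) = cong (false ∷_) (swap-empty w)

-- Undoing the insertion makes Z emit the letters of the block towards C. The complete matching
-- persists and guarantees that each letter finds something to replace; at the end the -∞ of the
-- block is given up, and C pops.
krun-total : ∀ {q q′} {Z Z′ C : Vec Bool n} → All (_< n) ys → KRun (suc q) Z ys q′ Z′ → Swap q′ 0 Z′ C Z′ C →
  ∃[ C′ ] ∃[ xs ] PopRun C ys C′ xs × Swap q 0 Z C′ Z C′
krun-total _ [] w with swap-pop w
... | _ , _ , o , w′ = _ , _ , pop o , w′
krun-total {C = C} (lt ∷ lts) (ins ks k) w with insert-total lt C
... | inj₂ (_ , a) = ⊥-elim (ins≢app k (proj₁ (proj₂ (ins-app-swap w k a))))
... | inj₁ (_ , _ , i) with ins-ins-swap w k i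
...   | _ , _ , _ , k′ , i′ , w′ with ins-det k k′
...     | refl , refl with ins-det i i′
...       | refl , refl with krun-total lts ks w′
...         | _ , _ , is , w″ = _ , _ , i ∷ is , w″
krun-total {C = C} (lt ∷ lts) (pop ks k) w with insert-total lt C
... | inj₂ (_ , a) = ⊥-elim (zeros-∌ (subst (_∋ _) (proj₁ (pop-app-swap w k a)) (pop-∋ k)))
... | inj₁ (_ , _ , i) with pop-ins-swap w k i
...   | _ , _ , _ , k′ , i′ , w′ with pop-det k k′
...     | refl , refl with ins-det i i′
...       | refl , refl with krun-total lts ks w′
...         | _ , _ , is , w″ = _ , _ , i ∷ is , w″

kruns-total : ∀ {q A} {Z C : Vec Bool n} → All (All (_< n)) Y → KRuns A Y q Z → Swap q 0 Z C Z C →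
  ∃[ X ] PopRuns C Y (zeros n) X × A ≡ acts X
kruns-total _ [] w with swap-empty w
... | refl = _ , [] , refl
kruns-total (_ ∷ lts) (off k) w with kruns-total lts k w
... | _ , r , eq = _ , skip r , cong (false ∷_) eq
kruns-total (lt ∷ lts) (on k ks) w with krun-total lt ks w
... | _ , _ , p@(pop _) , w′ with kruns-total lts k w′
...   | _ , r , eq = _ , blk p r , cong (true ∷_) eq
kruns-total (lt ∷ lts) (on k ks) w | _ , _ , p@(_ ∷ _) , w′ with kruns-total lts k w′
...   | _ , r , eq = _ , blk p r , cong (true ∷_) eq

popRun-decr : {C C′ : Vec Bool n} → Decr ys → PopRun C ys C′ xs → Decr xs
popRun-decr _   (pop _) = [-]
popRun-decr dec (i ∷ pop o) = ≤-trans (pop-min o (ins-∋′ i)) (ins-≤ i) ∷ [-]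
-- The letter y inserted by `i` is now in the column and at least the next letter, so the next
-- output is at most y, and y is at most the present output.
popRun-decr (le ∷ dec) (i ∷ is@(j ∷ _)) = ≤-trans (ins-min j (ins-∋′ i) le) (ins-≤ i) ∷ popRun-decr dec is

popRuns-decr : {C C′ : Vec Bool n} → All Decr Y → PopRuns C Y C′ X → All Decr X
popRuns-decr _            []        = []
popRuns-decr (_ ∷ decs)   (skip r)  = [] ∷ popRuns-decr decs r
popRuns-decr (dec ∷ decs) (blk p r) = popRun-decr dec p ∷ popRuns-decr decs r

popRun-< : {C C′ : Vec Bool n} → PopRun C ys C′ xs → All (_< n) xs
popRun-< (pop o)  = pop-< o ∷ []
popRun-< (i ∷ is) = ins-out-< i ∷ popRun-< is

popRuns-< : {C C′ : Vec Bool n} → PopRuns C Y C′ X → All (All (_< n)) X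
popRuns-< []        = []
popRuns-< (skip r)  = [] ∷ popRuns-< r
popRuns-< (blk p r) = popRun-< p ∷ popRuns-< r

empty-all : ∀ {P : List ℕ → Set} {X : Blocks} → P [] → All (_≡ []) X → All P X
empty-all p []          = []
empty-all p (refl ∷ es) = p ∷ empty-all p es

act-length : ∀ {A X} → Act A X → length A ≡ length X
act-length []      = refl
act-length (off a) = cong suc (act-length a)
act-length (on a)  = cong suc (act-length a)

bij-length : ∀ m {T D} → Bij n m T D → length T ≡ length D
bij-length m {T} {D} b = trans (sym (length-map nonempty T)) (trans (cong length (bij-acts m b)) (length-map nonempty D))

grabs-length : {C S G S′ G′ : Vec Bool n} {T T′ : Blocks} → Grabs C S G T′ T S′ G′ → length T′ ≡ length T
grabs-length {T = T} gs = trans (sym (act-length (grabs-act gs))) (length-map nonempty T)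

key⇒bij : ∀ m {T} → Key n m T →
  ∃[ D ] Bij n m T D × All Decr D × All (All (_< n)) D × Q n m D
key⇒bij zero {T} es = T , (es , es , refl) , empty-all [] es , empty-all [] es , es
key⇒bij {n} (suc m) {T} (C , T′ , S′ , gs , key) with key⇒bij m key
... | D′ , b , decs , lts , h
  with bij-kp m b (acts T) (act-cong D′ (bij-acts m b) (grabs-act gs)) (length T)
     | grabs-swap gs (swap-free C) | grabs-heads gs
... | ks | R , w | refl , _
  rewrite take-all (length T) (acts T) (≤-reflexive (length-map nonempty T))
        | take-all (length T) D′ (≤-reflexive (trans (sym (bij-length m b)) (grabs-length gs)))
        | take-all (length T) T′ (≤-reflexive (grabs-length gs))
  -- As all of C is used, e and d are both C. So the first column of T′, with an -∞ for every row of
  -- T of length one, is completely matched with C, as `kruns-total` requires.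
  with swap-same w
... | refl with kruns-total lts ks w
...   | D , r , eq = D , (C , T′ , D′ , _ , gs , r , eq , b) , popRuns-decr decs r , popRuns-< r , Q-popRuns m decs r h

-- From words to key tableaux

data Fresh {n} : Vec Bool n → Blocks → Set where
  []   : ∀ {S} → Fresh S []
  skip : ∀ {S T} → Fresh S T → Fresh S ([] ∷ T)
  blk  : ∀ {S T t r} → t < n → ¬ (S ∋ t) → Fresh (set t S) T → Fresh S ((t ∷ r) ∷ T)

grabs-fresh : {C S G S′ G′ : Vec Bool n} {T T′ : Blocks} → Grabs C S G T′ T S′ G′ → Fresh G T
grabs-fresh []        = []
grabs-fresh (skip gs) = skip (grabs-fresh gs)
grabs-fresh (first g gs) with grabFirst-set g
... | refl = blk (∋-< (proj₁ (grabFirst-∋ g))) (proj₂ (grabFirst-∋ g)) (grabs-fresh gs)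
grabs-fresh (next g gs) with grabNext-set g
... | refl = blk (∋-< (proj₁ (grabNext-∋ g))) (proj₂ (grabNext-∋ g)) (grabs-fresh gs)

fresh-empty : {S : Vec Bool n} {T : Blocks} → All (_≡ []) T → Fresh S T
fresh-empty []          = []
fresh-empty (refl ∷ es) = skip (fresh-empty es)

key-fresh : ∀ m {T} → Key n m T → Fresh (zeros n) T
key-fresh zero    es = fresh-empty es
key-fresh (suc m) (_ , _ , _ , gs , _) = grabs-fresh gs

trues : List Bool → ℕ
trues []          = 0
trues (true ∷ A)  = suc (trues A)
trues (false ∷ A) = trues A

set-count : ∀ {a} {S : Vec Bool n} → a < n → ¬ (S ∋ a) → size (set a S) ≡ suc (size S)
set-count {a = zero}  {true ∷ S}  _ ∌ = ⊥-elim (∌ here)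
set-count {a = zero}  {false ∷ S} _ ∌ = refl
set-count {a = suc a} {true ∷ S}  (s≤s lt) ∌ = cong suc (set-count lt (λ m → ∌ (there m)))
set-count {a = suc a} {false ∷ S} (s≤s lt) ∌ = set-count lt (λ m → ∌ (there m))

fresh-count : {S : Vec Bool n} {T : Blocks} → Fresh S T → size (heads S T) ≡ size S + trues (acts T)
fresh-count []       = sym (+-identityʳ _)
fresh-count (skip f) = fresh-count f
fresh-count {S = S} (blk {T = T} lt ∌ f) =
  trans (fresh-count f) (trans (cong (_+ trues (acts T)) (set-count lt ∌)) (sym (+-suc (size S) _)))

-- A search without result would leave its bracket pending at the end. But the `Swap` it reaches has
-- the same f, d and p as the one that `h` supplies for one row, which leaves nothing pending.
grabs-total : ∀ {p} {C S G R : Vec Bool n} {A T′} → Act A T′ → Fresh S T′ → Swap p 0 R G S C →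
  (∀ k → ∃[ R′ ] ∃[ G′ ] Swap (p + idle (takeL k A) (acts (takeL k T′))) 0 R′ G′ (heads S (takeL k T′)) C) →
  ∃[ T ] ∃[ S′ ] ∃[ G′ ] Grabs C S G T′ T S′ G′ × acts T ≡ A
grabs-total [] [] w h = _ , _ , _ , [] , refl
grabs-total (off a) (skip f) w h with grabs-total a f w (λ k → h (suc k))
... | _ , _ , _ , gs , refl = _ , _ , _ , skip gs , refl
grabs-total {p = p} {A = _ ∷ A} {_ ∷ T′} (on a) (skip f) w h with grabFirst-total w
... | inj₂ g with grab-swap kk g w | h 1
...   | _ , _ , w′ , kk | _ , _ , w″ rewrite +-suc p 0 | +-identityʳ p with swap-det w′ w″
...     | () , _
grabs-total {p = p} {C} {S} {A = _ ∷ A} {_ ∷ T′} (on a) (skip f) w h | inj₁ (_ , _ , g) with grab-swap kk g w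
... | _ , _ , w′ , dd with grabs-total a f w′ (λ k → subst (λ q → ∃[ R′ ] ∃[ G′ ] Swap q 0 R′ G′ (heads S (takeL k T′)) C)
                            (+-suc p (idle (takeL k A) (acts (takeL k T′)))) (h (suc k)))
...   | _ , _ , _ , gs , refl = _ , _ , _ , first g gs , refl
grabs-total {p = p} (on a) (blk lt ∌ f) w h with grabNext-total lt ∌ w
... | inj₂ g with grab-swap bb g w | h 1
...   | _ , _ , w′ , kk | _ , _ , w″ rewrite +-identityʳ p with swap-det w′ w″
...     | () , _
grabs-total (on a) (blk lt ∌ f) w h | inj₁ (_ , _ , g) with grab-swap bb g w
... | _ , _ , w′ , dd with grabs-total a f w′ (λ k → h (suc k))
...   | _ , _ , _ , gs , refl = _ , _ , _ , next g gs , refl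

popRun-count : {C C′ : Vec Bool n} → PopRun C ys C′ xs → size C ≡ suc (size C′)
popRun-count (pop o)  = pop-count o
popRun-count (i ∷ is) = trans (ins-count i) (popRun-count is)

popRuns-count : {C : Vec Bool n} → PopRuns C Y (zeros n) X → size C ≡ trues (acts X)
popRuns-count {n} []       = count-zeros n
popRuns-count (skip r)     = popRuns-count r
popRuns-count (blk p@(pop _) r) = trans (popRun-count p) (cong suc (popRuns-count r))
popRuns-count (blk p@(_ ∷ _) r) = trans (popRun-count p) (cong suc (popRuns-count r))

swap-⊆ : ∀ {p q} {R G S C : Vec Bool n} → Swap p q R G S C → size G ≤ size C
swap-⊆ []          = z≤n
swap-⊆ (none ∷ w)  = swap-⊆ w
swap-⊆ (open′ ∷ w) = swap-⊆ w
swap-⊆ (close ∷ w) = s≤s (swap-⊆ w)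
swap-⊆ (both ∷ w)  = s≤s (swap-⊆ w)
swap-⊆ (free ∷ w)  = m≤n⇒m≤1+n (swap-⊆ w)

swap-full : ∀ {p q} {R G S C : Vec Bool n} → Swap p q R G S C → size G ≡ size C → G ≡ C
swap-full []          _  = refl
swap-full (none ∷ w)  eq = cong (false ∷_) (swap-full w eq)
swap-full (open′ ∷ w) eq = cong (false ∷_) (swap-full w eq)
swap-full (close ∷ w) eq = cong (true ∷_) (swap-full w (suc-injective eq))
swap-full (both ∷ w)  eq = cong (true ∷_) (swap-full w (suc-injective eq))
swap-full (free ∷ w)  eq = ⊥-elim (1+n≰n (≤-trans (≤-reflexive (sym eq)) (swap-⊆ w)))

bij-popRuns-swap : ∀ m {C C′ : Vec Bool n} {T′ D′ D} → Bij n m T′ D′ → PopRuns C D′ C′ D → ∀ k →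
  ∃[ R ] ∃[ G ] Swap (idle (takeL k (acts D)) (acts (takeL k T′))) 0 R G (heads (zeros n) (takeL k T′)) C
bij-popRuns-swap {n} m {T′ = T′} {D′} {D} b r k with popRuns-take k r | bij-kp m b (acts D) (popRuns-act r) k
... | _ , r′ | ks rewrite take-map {f = nonempty} k D with kruns-popRuns r′ ks (act-acts (takeL k D))
...   | _ , _ , w , _ = _ , _ , w

-- Both sides count nonempty rows: G gains an element in each such row of T, and C loses one in each
-- such block of D until it is empty.
grabs-full : ∀ {C S′ G′ : Vec Bool n} {T T′ D′ D} → Grabs C (zeros n) (zeros n) T′ T S′ G′ →
  PopRuns C D′ (zeros n) D → acts T ≡ acts D → G′ ≡ C
grabs-full {n} {C} {S′} {G′} {T} {T′} {D′} {D} gs r eq = swap-full (proj₂ (grabs-swap gs (swap-free C))) (begin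
  size G′                          ≡⟨ cong size (proj₂ (grabs-heads gs)) ⟩
  size (heads (zeros n) T)         ≡⟨ fresh-count (grabs-fresh gs) ⟩
  size (zeros n) + trues (acts T)  ≡⟨ cong₂ _+_ (count-zeros n) (cong trues eq) ⟩
  trues (acts D)                    ≡⟨ popRuns-count r ⟨
  size C                           ∎)
  where open ≡-Reasoning

word⇒bij : ∀ m {D} → All (All (_< n)) D → All Decr D → Q n m D → ∃[ T ] Bij n m T D
word⇒bij zero {D} _ _ es = D , es , es , refl
word⇒bij {n} (suc m) {D} lts decs h with Q-popRuns⁻¹ m lts decs h
... | C , D′ , r , decs′ , lts′ , h′ with word⇒bij m lts′ decs′ h′
...   | T′ , b with grabs-total (act-cong T′ (sym (bij-acts m b)) (popRuns-act r)) (key-fresh m (bij-key m b))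
                                (swap-free C) (bij-popRuns-swap m b r)
...     | T , S′ , G′ , gs , eq with grabs-full gs r eq
...       | refl = T , C , T′ , D′ , S′ , gs , r , eq , b

-- The correspondence is one-to-one

grabs-tail : {C S G S′ G′ : Vec Bool n} {T T′ : Blocks} → Grabs C S G T′ T S′ G′ → T′ ≡ map (Data.List.drop 1) T
grabs-tail []           = refl
grabs-tail (skip gs)    = cong ([] ∷_) (grabs-tail gs)
grabs-tail (first g gs) = cong ([] ∷_) (grabs-tail gs)
grabs-tail (next g gs)  = cong (_ ∷_) (grabs-tail gs)

popRun-det : ∀ {C C′ C″ : Vec Bool n} {zs} → PopRun C ys C′ xs → PopRun C ys C″ zs → C′ ≡ C″ × xs ≡ zs
popRun-det (pop o) (pop u) with pop-det o u
... | refl , refl = refl , refl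
popRun-det (i ∷ is) (j ∷ js) with ins-det i j
... | refl , refl with popRun-det is js
...   | refl , refl = refl , refl

popRuns-det : ∀ {C C′ C″ : Vec Bool n} → PopRuns C Y C′ X → PopRuns C Y C″ Z → acts X ≡ acts Z → X ≡ Z
popRuns-det [] [] _ = refl
popRuns-det (skip r) (skip s) eq = cong ([] ∷_) (popRuns-det r s (cong (Data.List.drop 1) eq))
popRuns-det (skip r) (blk (pop _) s) ()
popRuns-det (blk (pop _) s) (skip r) ()
popRuns-det (blk p r) (blk o s) eq with popRun-det p o
... | refl , refl = cong (_ ∷_) (popRuns-det r s (cong (Data.List.drop 1) eq))

-- T determines the data of its outermost step: C is the set of its first-column entries, and T′ is
-- T without that column.
bij-det : ∀ m {T D D₂} → Bij n m T D → Bij n m T D₂ → D ≡ D₂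
bij-det zero (_ , fs , eq) (_ , fs₂ , eq₂) = acts-empty fs fs₂ (trans (sym eq) eq₂)
bij-det (suc m) (_ , _ , _ , _ , gs , r , eq , b) (_ , _ , _ , _ , gs₂ , r₂ , eq₂ , b₂)
  with trans (proj₂ (grabs-heads gs)) (sym (proj₂ (grabs-heads gs₂))) | trans (grabs-tail gs) (sym (grabs-tail gs₂))
... | refl | refl with bij-det m b b₂
...   | refl = popRuns-det r r₂ (trans (sym eq) eq₂)

popRun-detR : ∀ {C C₂ C′ : Vec Bool n} {zs} → PopRun C ys C′ xs → PopRun C₂ zs C′ xs → C ≡ C₂ × ys ≡ zs
popRun-detR (pop o) (pop u) = pop-detR o u , refl
popRun-detR (i ∷ is) (j ∷ js) with popRun-detR is js
... | refl , refl with ins-detR i j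
...   | refl , refl = refl , refl

popRuns-detR : ∀ {C C₂ C′ : Vec Bool n} → PopRuns C Y C′ X → PopRuns C₂ Z C′ X → C ≡ C₂ × Y ≡ Z
popRuns-detR [] [] = refl , refl
popRuns-detR (skip r) (skip s) with popRuns-detR r s
... | refl , refl = refl , refl
popRuns-detR (blk p r) (blk o s) with popRuns-detR r s
... | refl , refl with popRun-detR p o
...   | refl , refl = refl , refl

grabs-det : ∀ {C S G S′ G′ S₂ G₂ : Vec Bool n} {T T₂ T′} → Grabs C S G T′ T S′ G′ → Grabs C S G T′ T₂ S₂ G₂ →
  acts T ≡ acts T₂ → T ≡ T₂
grabs-det [] [] _ = refl
grabs-det (skip g) (skip h) eq = cong ([] ∷_) (grabs-det g h (cong (Data.List.drop 1) eq))
grabs-det (first g gs) (first h hs) eq with grab-det g h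
... | _ , _ , refl , te with hot-injective (∋-< (proj₁ (grabFirst-∋ g))) te
...   | refl = cong (_ ∷_) (grabs-det gs hs (cong (Data.List.drop 1) eq))
grabs-det (next g gs) (next h hs) eq with grab-det g h
... | _ , refl , refl , te with hot-injective (∋-< (proj₁ (grabNext-∋ g))) te
...   | refl = cong (_ ∷_) (grabs-det gs hs (cong (Data.List.drop 1) eq))

-- D determines C and D′, because its letters can be run backwards starting from the empty column.
bij-detR : ∀ m {T T₂ D} → Bij n m T D → Bij n m T₂ D → T ≡ T₂
bij-detR zero (es , _ , eq) (es₂ , _ , eq₂) = acts-empty es es₂ (trans eq (sym eq₂))
bij-detR (suc m) (_ , _ , _ , _ , gs , r , eq , b) (_ , _ , _ , _ , gs₂ , r₂ , eq₂ , b₂)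
  with popRuns-detR r r₂
... | refl , refl with bij-detR m b b₂
...   | refl = grabs-det gs gs₂ (trans eq (sym eq₂))

-- Weights

elems : ℕ → Vec Bool n → List ℕ
elems k []          = []
elems k (true ∷ v)  = k ∷ elems (suc k) v
elems k (false ∷ v) = elems (suc k) v

elems-zeros : ∀ k n → elems k (zeros n) ≡ []
elems-zeros k zero    = refl
elems-zeros k (suc n) = elems-zeros (suc k) n

elems-hot : ∀ k {n a} → a < n → elems k (hot n a) ≡ k + a ∷ []
elems-hot k {suc n} {zero}  _ = cong₂ _∷_ (sym (+-identityʳ k)) (elems-zeros (suc k) n)
elems-hot k {suc n} {suc a} (s≤s lt) = trans (elems-hot (suc k) lt) (cong (_∷ []) (sym (+-suc k a)))

pass-elems : ∀ k {s t} {y c c′ x : Vec Bool n} → Pass s t y c c′ x →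
  elems k y ++ elems k c ↭ elems k x ++ elems k c′
pass-elems k [] = ↭-refl
pass-elems k {y = _ ∷ y} {x = _ ∷ x} (skip₀ {true} ∷ p) =
  ↭-trans (shift k (elems _ y) _) (↭-trans (↭-prep k (pass-elems (suc k) p)) (↭-sym (shift k (elems _ x) _)))
pass-elems k (skip₀ {false} ∷ p) = pass-elems (suc k) p
pass-elems k {y = _ ∷ y} {x = _ ∷ x} (here ∷ p) = ↭-prep k
  (↭-trans (shift k (elems _ y) _) (↭-trans (↭-prep k (pass-elems (suc k) p)) (↭-sym (shift k (elems _ x) _))))
pass-elems k {x = _ ∷ x} (put ∷ p) = ↭-trans (↭-prep k (pass-elems (suc k) p)) (↭-sym (shift k (elems _ x) _))
pass-elems k (move ∷ p) = pass-elems (suc k) p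
pass-elems k {y = _ ∷ y} (take ∷ p) = ↭-trans (shift k (elems _ y) _) (↭-prep k (pass-elems (suc k) p))
pass-elems k {y = _ ∷ y} {x = _ ∷ x} (skip₁ {true} ∷ p) =
  ↭-trans (shift k (elems _ y) _) (↭-trans (↭-prep k (pass-elems (suc k) p)) (↭-sym (shift k (elems _ x) _)))
pass-elems k (skip₁ {false} ∷ p) = pass-elems (suc k) p

ins-elems : {c c′ : Vec Bool n} → Ins y c c′ x → y ∷ elems 0 c ↭ x ∷ elems 0 c′
ins-elems i with pass-elems 0 i
... | e rewrite elems-hot 0 (ins-in-< i) | elems-hot 0 (ins-out-< i) = e

pop-elems : {c c′ : Vec Bool n} → Pop c c′ x → elems 0 c ↭ x ∷ elems 0 c′
pop-elems {n} i with pass-elems 0 i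
... | e rewrite elems-zeros 0 n | elems-hot 0 (pop-< i) = e

popRun-elems : {C C′ : Vec Bool n} → PopRun C ys C′ xs → ys ++ elems 0 C ↭ xs ++ elems 0 C′
popRun-elems (pop o) = pop-elems o
popRun-elems {C = C} {C′} (_∷_ {y = y} {C₁ = C₁} {x = x} {ys = ys} {xs = xs} i is) = begin
  y ∷ ys ++ elems 0 C       ↭⟨ shift y ys _ ⟨
  ys ++ y ∷ elems 0 C       ↭⟨ ++⁺ˡ ys (ins-elems i) ⟩
  ys ++ x ∷ elems 0 C₁      ↭⟨ shift x ys _ ⟩
  x ∷ ys ++ elems 0 C₁      ↭⟨ ↭-prep x (popRun-elems is) ⟩
  x ∷ xs ++ elems 0 C′      ∎
  where open PermutationReasoning

popRuns-elems : {C C′ : Vec Bool n} → PopRuns C Y C′ X → concat Y ++ elems 0 C ↭ concat X ++ elems 0 C′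
popRuns-elems []       = ↭-refl
popRuns-elems (skip r) = popRuns-elems r
popRuns-elems {C = C} {C′} (blk {ys = ys} {C₁ = C₁} {xs = xs} {Y = Y} {X = X} p r) = begin
  (ys ++ concat Y) ++ elems 0 C   ≡⟨ ++-assoc ys (concat Y) _ ⟩
  ys ++ concat Y ++ elems 0 C     ↭⟨ shifts ys (concat Y) ⟩
  concat Y ++ ys ++ elems 0 C     ↭⟨ ++⁺ˡ (concat Y) (popRun-elems p) ⟩
  concat Y ++ xs ++ elems 0 C₁    ↭⟨ shifts (concat Y) xs ⟩
  xs ++ concat Y ++ elems 0 C₁    ↭⟨ ++⁺ˡ xs (popRuns-elems r) ⟩
  xs ++ concat X ++ elems 0 C′    ≡⟨ ++-assoc xs (concat X) _ ⟨
  (xs ++ concat X) ++ elems 0 C′  ∎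
  where open PermutationReasoning

set-elems : ∀ k {a} {S : Vec Bool n} → a < n → ¬ (S ∋ a) → elems k (set a S) ↭ k + a ∷ elems k S
set-elems k {zero}  {true ∷ S}  _ ∌ = ⊥-elim (∌ here)
set-elems k {zero}  {false ∷ S} _ ∌ rewrite +-identityʳ k = ↭-refl
set-elems k {suc a} {true ∷ S}  (s≤s lt) ∌ rewrite +-suc k a =
  ↭-trans (↭-prep k (set-elems (suc k) lt (λ m → ∌ (there m)))) (_↭_.swap k (suc (k + a)) ↭-refl)
set-elems k {suc a} {false ∷ S} (s≤s lt) ∌ rewrite +-suc k a = set-elems (suc k) lt (λ m → ∌ (there m))

grabs-elems : {C S G S′ G′ : Vec Bool n} {T T′ : Blocks} → Grabs C S G T′ T S′ G′ →
  concat T ++ elems 0 G ↭ concat T′ ++ elems 0 G′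
grabs-elems []        = ↭-refl
grabs-elems (skip gs) = grabs-elems gs
grabs-elems (first {G = G} {T = T} {t = t} g gs) with grabFirst-set g
... | refl = ↭-trans (↭-sym (shift t (concat T) (elems 0 G)))
  (↭-trans (++⁺ˡ (concat T) (↭-sym (set-elems 0 (∋-< (proj₁ (grabFirst-∋ g))) (proj₂ (grabFirst-∋ g))))) (grabs-elems gs))
grabs-elems (next {G = G} {G′ = G′} {T = T} {T′} {s} {t} {r} g gs) with grabNext-set g
... | refl = begin
  t ∷ s ∷ (r ++ concat T) ++ elems 0 G         ≡⟨ cong (λ l → t ∷ s ∷ l) (++-assoc r (concat T) _) ⟩
  t ∷ (s ∷ r) ++ concat T ++ elems 0 G         ↭⟨ shift t (s ∷ r) _ ⟨
  (s ∷ r) ++ t ∷ concat T ++ elems 0 G         ↭⟨ ++⁺ˡ (s ∷ r) (shift t (concat T) _) ⟨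
  (s ∷ r) ++ concat T ++ t ∷ elems 0 G         ↭⟨ ++⁺ˡ (s ∷ r) (++⁺ˡ (concat T) (set-elems 0 (∋-< (proj₁ (grabNext-∋ g))) (proj₂ (grabNext-∋ g)))) ⟨
  (s ∷ r) ++ concat T ++ elems 0 (set t G)     ↭⟨ ++⁺ˡ (s ∷ r) (grabs-elems gs) ⟩
  (s ∷ r) ++ concat T′ ++ elems 0 G′           ≡⟨ ++-assoc (s ∷ r) (concat T′) _ ⟨
  ((s ∷ r) ++ concat T′) ++ elems 0 G′         ∎
  where open PermutationReasoning

bij-↭ : ∀ m {T D} → Bij n m T D → concat T ↭ concat D
bij-↭ zero (es , fs , eq) with acts-empty es fs eq
... | refl = ↭-refl
bij-↭ {n} (suc m) {T} {D} (C , T′ , D′ , _ , gs , r , _ , b) = begin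
  concat T                        ≡⟨ ++-identityʳ (concat T) ⟨
  concat T ++ []                  ≡⟨ cong (concat T ++_) (elems-zeros 0 n) ⟨
  concat T ++ elems 0 (zeros n)   ↭⟨ grabs-elems gs ⟩
  concat T′ ++ elems 0 C          ↭⟨ ++⁺ʳ (elems 0 C) (bij-↭ m b) ⟩
  concat D′ ++ elems 0 C          ↭⟨ popRuns-elems r ⟩
  concat D ++ elems 0 (zeros n)   ≡⟨ cong (concat D ++_) (elems-zeros 0 n) ⟩
  concat D ++ []                  ≡⟨ ++-identityʳ (concat D) ⟩
  concat D                        ∎
  where open PermutationReasoning

-- Flags

_≼_ : Vec Bool n → ℕ → Set
Z ≼ b = ∀ {a} → Z ∋ a → a ≤ b

krun-≼ : ∀ {q q′ b} {Z Z′ : Vec Bool n} → KRun q Z ys q′ Z′ → Z ≼ b → All (_≤ b) ys → Z′ ≼ b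
krun-≼ []         bd _          = bd
krun-≼ (ins ks k) bd (le ∷ les) m with ins-old k m
... | inj₁ m′   = krun-≼ ks bd les m′
... | inj₂ refl = le
krun-≼ (pop ks k) bd (le ∷ les) m with pop-old k m
... | inj₁ m′   = krun-≼ ks bd les m′
... | inj₂ refl = le

-- A letter driven out by insertion from the right is at most its replacement, so a bound on the
-- final column bounds everything that was ever in it.
krun-≼⁻¹ : ∀ {q q′ b} {Z Z′ : Vec Bool n} → KRun q Z ys q′ Z′ → Z′ ≼ b → Z ≼ b × All (_≤ b) ys
krun-≼⁻¹ [] bd = bd , []
krun-≼⁻¹ {b = b} (ins {Z′ = Z₁} ks k) bd with krun-≼⁻¹ ks inner
  where
    inner : Z₁ ≼ b
    inner m with ins-new k m
    ... | inj₁ m′   = bd m′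
    ... | inj₂ refl = ≤-trans (ins-≤ k) (bd (ins-∋ k))
... | bd′ , les = bd′ , bd (ins-∋ k) ∷ les
krun-≼⁻¹ (pop ks k) bd with krun-≼⁻¹ ks (λ m → bd (proj₁ (pop-new k m)))
... | bd′ , les = bd′ , bd (pop-∋ k) ∷ les

kruns-≼ : ∀ {A q b} {Z : Vec Bool n} → KRuns A Y q Z → All (All (_≤ b)) Y → Z ≼ b
kruns-≼ []        _          m = ⊥-elim (zeros-∌ m)
kruns-≼ (off k)   (_ ∷ les)  m = kruns-≼ k les m
kruns-≼ (on k ks) (le ∷ les) m = krun-≼ ks (kruns-≼ k les) le m

kruns-≼⁻¹ : ∀ {A q b} {Z : Vec Bool n} → KRuns A Y q Z → Z ≼ b → All (All (_≤ b)) Y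
kruns-≼⁻¹ []        _  = []
kruns-≼⁻¹ (off k)   bd = [] ∷ kruns-≼⁻¹ k bd
kruns-≼⁻¹ (on k ks) bd with krun-≼⁻¹ ks bd
... | bd′ , les = les ∷ kruns-≼⁻¹ k bd′

set-∋ : ∀ {a} {v : Vec Bool n} → a < n → set a v ∋ a
set-∋ {a = zero}  {_ ∷ v} _        = here
set-∋ {a = suc a} {_ ∷ v} (s≤s lt) = there (set-∋ lt)

set-old : ∀ {a b} {v : Vec Bool n} → v ∋ b → set a v ∋ b
set-old {a = zero}  here      = here
set-old {a = zero}  (there m) = there m
set-old {a = suc a} here      = here
set-old {a = suc a} (there m) = there (set-old m)

set-new : ∀ {a b} {v : Vec Bool n} → set a v ∋ b → v ∋ b ⊎ b ≡ a
set-new {a = zero}  {v = _ ∷ v} here      = inj₂ refl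
set-new {a = zero}  {v = _ ∷ v} (there m) = inj₁ (there m)
set-new {a = suc a} {v = _ ∷ v} here      = inj₁ here
set-new {a = suc a} {v = _ ∷ v} (there m) = Sum.map there (cong suc) (set-new m)

decr-≤ : ∀ {b} → Decr (x ∷ xs) → x ≤ b → All (_≤ b) (x ∷ xs)
decr-≤ [-]        le = le ∷ []
decr-≤ (h ∷ dec)  le = le ∷ decr-≤ dec (≤-trans h le)

heads-≼ : ∀ {b} {S : Vec Bool n} T → S ≼ b → All (All (_≤ b)) T → heads S T ≼ b
heads-≼ []             bd _                = bd
heads-≼ ([] ∷ T)       bd (_ ∷ les)        = heads-≼ T bd les
heads-≼ {b = b} {S} ((t ∷ _) ∷ T) bd ((le ∷ _) ∷ les) = heads-≼ T bd′ les
  where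
    bd′ : set t S ≼ b
    bd′ m with set-new m
    ... | inj₁ m′   = bd m′
    ... | inj₂ refl = le

heads-old : ∀ {a} {S : Vec Bool n} T → S ∋ a → heads S T ∋ a
heads-old []             m = m
heads-old ([] ∷ T)       m = heads-old T m
heads-old ((t ∷ _) ∷ T)  m = heads-old T (set-old m)

heads-≼⁻¹ : ∀ {b} {S : Vec Bool n} {T} → All (All (_< n)) T → All Decr T → heads S T ≼ b → All (All (_≤ b)) T
heads-≼⁻¹ {T = []}           _           _            bd = []
heads-≼⁻¹ {T = [] ∷ T}       (_ ∷ lts)   (_ ∷ decs)   bd = [] ∷ heads-≼⁻¹ lts decs bd
heads-≼⁻¹ {T = (t ∷ r) ∷ T}  ((lt ∷ _) ∷ lts) (dec ∷ decs) bd =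
  decr-≤ dec (bd (heads-old T (set-∋ lt))) ∷ heads-≼⁻¹ lts decs bd

grabs-decr : {C S G S′ G′ : Vec Bool n} {T T′ : Blocks} → Grabs C S G T′ T S′ G′ → All Decr T′ → All Decr T
grabs-decr []           _            = []
grabs-decr (skip gs)    (_ ∷ decs)   = [] ∷ grabs-decr gs decs
grabs-decr (first g gs) (_ ∷ decs)   = [-] ∷ grabs-decr gs decs
grabs-decr (next g gs)  (dec ∷ decs) = (grabNext-≤ g ∷ dec) ∷ grabs-decr gs decs

key-decr : ∀ m {T} → Key n m T → All Decr T
key-decr zero    es = empty-all [] es
key-decr (suc m) (_ , _ , _ , gs , key) = grabs-decr gs (key-decr m key)

fresh-< : {S : Vec Bool n} {T : Blocks} → Fresh S T → All Decr T → All (All (_< n)) T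
fresh-< []          _            = []
fresh-< (skip f)    (_ ∷ decs)   = [] ∷ fresh-< f decs
fresh-< (blk lt _ f) (dec ∷ decs) = All.map (λ le → ≤-<-trans le lt) (decr-≤ dec ≤-refl) ∷ fresh-< f decs

all-take : ∀ {P : List ℕ → Set} k {X : Blocks} → All P X → All P (takeL k X)
all-take zero    _        = []
all-take (suc k) []       = []
all-take (suc k) (p ∷ ps) = p ∷ all-take k ps

bij-≤ : ∀ m {T D} → Bij n m T D → ∀ k {b} → All (All (_≤ b)) (takeL k T) → All (All (_≤ b)) (takeL k D)
bij-≤ m {T} {D} b k les =
  kruns-≼⁻¹ (bij-kp m b (acts D) (act-acts D) k) (heads-≼ (takeL k T) (λ z → ⊥-elim (zeros-∌ z)) les)

bij-≤⁻¹ : ∀ m {T D} → Bij n m T D → ∀ k {b} → All (All (_≤ b)) (takeL k D) → All (All (_≤ b)) (takeL k T)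
bij-≤⁻¹ m {T} {D} b k les =
  heads-≼⁻¹ (all-take k (fresh-< (key-fresh m keyT) (key-decr m keyT))) (all-take k (key-decr m keyT))
    (kruns-≼ (bij-kp m b (acts D) (act-acts D) k) les)
  where keyT = bij-key m b

-- Key tableaux in terms of pairs of rows

Above : ℕ → List ℕ → Set
Above b []      = ⊥
Above b (c ∷ _) = b < c

RowsOK : List ℕ → List ℕ → Set
RowsOK (a ∷ r) (b ∷ r′) = a ≢ b × (b < a → Above b r) × RowsOK r r′
RowsOK _       _        = ⊤

data Head (a : ℕ) : Blocks → Set where
  here  : ∀ {r T} → Head a ((a ∷ r) ∷ T)
  there : ∀ {r T} → Head a T → Head a (r ∷ T)

head-ok : ∀ {a t r T} → All (RowsOK (t ∷ r)) T → Head a T → t ≢ a × (a < t → Above a r)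
head-ok ((ne , ab , _) ∷ _) here      = ne , ab
head-ok (_ ∷ oks)           (there h) = head-ok oks h

head₂-ok : ∀ {a t s r T} → All (RowsOK (t ∷ s ∷ r)) T → Head a (map (drop 1) T) → s ≢ a
head₂-ok {T = (_ ∷ _ ∷ _) ∷ _} ((_ , _ , ne , _) ∷ _) here = ne
head₂-ok {T = _ ∷ _} (_ ∷ oks) (there h) = head₂-ok oks h

grabFirst-mk : ∀ {t} {G C : Vec Bool n} (S : Vec Bool n) → C ∋ t → ¬ (G ∋ t) → (∀ {a} → G ∋ a → C ∋ a) →
  (∀ {a} → C ∋ a → ¬ (G ∋ a) → t ≤ a) → GrabFirst S G (set t G) C t
grabFirst-mk {t = zero} {true ∷ G} (_ ∷ S) here ∌ ⊆ min = ⊥-elim (∌ here)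
grabFirst-mk {t = zero} {false ∷ G} {_ ∷ C} (_ ∷ S) here ∌ ⊆ min = take ∷ grab-skip S G C
grabFirst-mk {t = suc t} {true ∷ G} {true ∷ C} (_ ∷ S) (there m) ∌ ⊆ min = move ∷ grabFirst-mk S m (λ m′ → ∌ (there m′))
  (λ i → case′ (⊆ (there i))) (λ i j → s≤s⁻¹ (min (there i) λ { (there k) → j k }))
  where case′ : ∀ {a} → true ∷ C ∋ suc a → C ∋ a
        case′ (there m) = m
grabFirst-mk {t = suc t} {false ∷ G} {false ∷ C} (_ ∷ S) (there m) ∌ ⊆ min = move ∷ grabFirst-mk S m (λ m′ → ∌ (there m′))
  (λ i → case′ (⊆ (there i))) (λ i j → s≤s⁻¹ (min (there i) λ { (there k) → j k }))
  where case′ : ∀ {a} → false ∷ C ∋ suc a → C ∋ a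
        case′ (there m) = m
grabFirst-mk {t = suc t} {true ∷ G} {false ∷ C} (_ ∷ S) (there m) ∌ ⊆ min with ⊆ here
... | ()
grabFirst-mk {t = suc t} {false ∷ G} {true ∷ C} (_ ∷ S) (there m) ∌ ⊆ min with min here (λ ())
... | ()

grabNext-mk : ∀ {s t} {S G C : Vec Bool n} → s < n → ¬ (S ∋ s) → C ∋ t → ¬ (G ∋ t) → s ≤ t →
  (∀ {a} → G ∋ a → C ∋ a) → (∀ {a} → C ∋ a → ¬ (G ∋ a) → s ≤ a → t ≤ a) →
  GrabNext s S (set s S) G (set t G) C t
grabNext-mk {s = zero} {zero} {true ∷ S} _ ∌s _ _ _ _ _ = ⊥-elim (∌s here)
grabNext-mk {s = zero} {zero} {G = true ∷ G} _ _ _ ∌t _ _ _ = ⊥-elim (∌t here)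
grabNext-mk {s = zero} {zero} {false ∷ S} {false ∷ G} {_ ∷ C} _ _ here _ _ _ _ = here ∷ grab-skip S G C
grabNext-mk {s = zero} {suc t} {true ∷ S} _ ∌s _ _ _ _ _ = ⊥-elim (∌s here)
grabNext-mk {s = zero} {suc t} {false ∷ S} {true ∷ G} {true ∷ C} _ _ (there m) ∌t _ ⊆ min =
  put ∷ grabFirst-mk S m (λ m′ → ∌t (there m′)) (λ i → ∋-tail (⊆ (there i)))
    (λ i j → s≤s⁻¹ (min (there i) (λ { (there k) → j k }) z≤n))
  where ∋-tail : ∀ {a} → true ∷ C ∋ suc a → C ∋ a
        ∋-tail (there m) = m
grabNext-mk {s = zero} {suc t} {false ∷ S} {false ∷ G} {false ∷ C} _ _ (there m) ∌t _ ⊆ min =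
  put ∷ grabFirst-mk S m (λ m′ → ∌t (there m′)) (λ i → ∋-tail (⊆ (there i)))
    (λ i j → s≤s⁻¹ (min (there i) (λ { (there k) → j k }) z≤n))
  where ∋-tail : ∀ {a} → false ∷ C ∋ suc a → C ∋ a
        ∋-tail (there m) = m
grabNext-mk {s = zero} {suc t} {false ∷ S} {true ∷ G} {false ∷ C} _ _ _ _ _ ⊆ _ with ⊆ here
... | ()
grabNext-mk {s = zero} {suc t} {false ∷ S} {false ∷ G} {true ∷ C} _ _ _ _ _ _ min with min here (λ ()) z≤n
... | ()
grabNext-mk {s = suc s} {suc t} {_ ∷ S} {_ ∷ G} {_ ∷ C} (s≤s lt) ∌s (there m) ∌t (s≤s le) ⊆ min =
  skip₀ ∷ grabNext-mk lt (λ m′ → ∌s (there m′)) m (λ m′ → ∌t (there m′)) le (λ i → ∋-tail (⊆ (there i)))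
    (λ i j k → s≤s⁻¹ (min (there i) (λ { (there l) → j l }) (s≤s k)))
  where ∋-tail : ∀ {a b} → b ∷ C ∋ suc a → C ∋ a
        ∋-tail (there m) = m

∋-ext : {v w : Vec Bool n} → (∀ {a} → v ∋ a → w ∋ a) → (∀ {a} → w ∋ a → v ∋ a) → v ≡ w
∋-ext {v = []} {[]} _ _ = refl
∋-ext {v = b ∷ v} {b′ ∷ w} f g = cong₂ _∷_ (heads-≡ b b′ f g) (∋-ext (λ m → ∋-tail (f (there m))) (λ m → ∋-tail (g (there m))))
  where
    ∋-tail : ∀ {n a b} {v : Vec Bool n} → b ∷ v ∋ suc a → v ∋ a
    ∋-tail (there m) = m
    heads-≡ : ∀ b b′ → (∀ {a} → b ∷ v ∋ a → b′ ∷ w ∋ a) → (∀ {a} → b′ ∷ w ∋ a → b ∷ v ∋ a) → b ≡ b′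
    heads-≡ true  true  _ _ = refl
    heads-≡ false false _ _ = refl
    heads-≡ true  false f g with f here
    ... | ()
    heads-≡ false true  f g with g here
    ... | ()

KeyT : Blocks → Set
KeyT T = All Decr T × AllPairs RowsOK T

grabs-mk : ∀ {S G C : Vec Bool n} T → All (All (_< n)) T → KeyT T →
  (∀ {a} → Head a T → C ∋ a × ¬ (G ∋ a)) → (∀ {a} → C ∋ a → G ∋ a ⊎ Head a T) →
  (∀ {a} → G ∋ a → C ∋ a) → (∀ {a} → Head a (map (drop 1) T) → ¬ (S ∋ a)) →
  ∃[ S′ ] Grabs C S G (map (drop 1) T) T S′ C
grabs-mk {S = S} {G} {C} [] _ _ inc cov ⊆ new with ∋-ext {v = C} {G} (λ m → from (cov m)) ⊆
  where
    from : ∀ {a} → G ∋ a ⊎ Head a [] → G ∋ a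
    from (inj₁ m) = m
... | refl = S , []
grabs-mk ([] ∷ T) (_ ∷ lts) (_ ∷ decs , _ ∷ oks) inc cov ⊆ new
  with grabs-mk T lts (decs , oks) (λ h → inc (there h)) (λ m → Sum.map₂ (λ { (there h) → h }) (cov m)) ⊆ (λ h → new (there h))
... | _ , gs = _ , skip gs
grabs-mk {n} {S} {G} {C} ((t ∷ r) ∷ T) ((lt ∷ lt₂) ∷ lts) (dec ∷ decs , ok ∷ oks) inc cov ⊆ new = go r dec ok lt₂ new
  where
    inc′ : ∀ {r′ a} → All (RowsOK (t ∷ r′)) T → Head a T → C ∋ a × ¬ (set t G ∋ a)
    inc′ ok h = proj₁ (inc (there h)) , λ m → Sum.[ proj₂ (inc (there h)) , (λ eq → proj₁ (head-ok ok h) (sym eq)) ] (set-new m)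
    cov′ : ∀ {a} → C ∋ a → set t G ∋ a ⊎ Head a T
    cov′ m with cov m
    ... | inj₁ m′        = inj₁ (set-old m′)
    ... | inj₂ here      = inj₁ (set-∋ lt)
    ... | inj₂ (there h) = inj₂ h
    ⊆′ : ∀ {a} → set t G ∋ a → C ∋ a
    ⊆′ m with set-new m
    ... | inj₁ m′   = ⊆ m′
    ... | inj₂ refl = proj₁ (inc here)
    go : ∀ r → Decr (t ∷ r) → All (RowsOK (t ∷ r)) T → All (_< n) r →
         (∀ {a} → Head a (r ∷ map (drop 1) T) → ¬ (S ∋ a)) →
         ∃[ S′ ] Grabs C S G (r ∷ map (drop 1) T) ((t ∷ r) ∷ T) S′ C
    go [] _ ok _ new with grabs-mk T lts (decs , oks) (inc′ ok) cov′ ⊆′ (λ h → new (there h))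
    ... | _ , gs = _ , first (grabFirst-mk S (proj₁ (inc here)) (proj₂ (inc here)) ⊆ min) gs
      where
        min : ∀ {a} → C ∋ a → ¬ (G ∋ a) → t ≤ a
        min {a} m ∌ with cov m
        ... | inj₁ m′        = ⊥-elim (∌ m′)
        ... | inj₂ here      = ≤-refl
        ... | inj₂ (there h) with ≤-<-connex t a
        ...   | inj₁ le = le
        ...   | inj₂ lt = ⊥-elim (proj₂ (head-ok ok h) lt)
    go (s ∷ r) (le ∷ _) ok (s<n ∷ _) new
      with grabs-mk T lts (decs , oks) (inc′ ok) cov′ ⊆′
             (λ h m → Sum.[ new (there h) , (λ eq → head₂-ok ok h (sym eq)) ] (set-new m))
    ... | _ , gs = _ , next (grabNext-mk s<n (new here) (proj₁ (inc here)) (proj₂ (inc here)) le ⊆ min) gs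
      where
        min : ∀ {a} → C ∋ a → ¬ (G ∋ a) → s ≤ a → t ≤ a
        min {a} m ∌ s≤a with cov m
        ... | inj₁ m′        = ⊥-elim (∌ m′)
        ... | inj₂ here      = ≤-refl
        ... | inj₂ (there h) with ≤-<-connex t a
        ...   | inj₁ le = le
        ...   | inj₂ lt = ⊥-elim (<⇒≱ (proj₂ (head-ok ok h) lt) s≤a)

heads-∋ : ∀ {a} {S : Vec Bool n} T → All (All (_< n)) T → Head a T → heads S T ∋ a
heads-∋ ((t ∷ _) ∷ T) ((lt ∷ _) ∷ _) here = heads-old T (set-∋ lt)
heads-∋ ([] ∷ T)      (_ ∷ lts) (there h) = heads-∋ T lts h
heads-∋ ((t ∷ _) ∷ T) (_ ∷ lts) (there h) = heads-∋ T lts h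

heads-new : ∀ {a} {S : Vec Bool n} T → heads S T ∋ a → S ∋ a ⊎ Head a T
heads-new []            m = inj₁ m
heads-new ([] ∷ T)      m = Sum.map₂ there (heads-new T m)
heads-new ((t ∷ _) ∷ T) m with heads-new T m
... | inj₂ h = inj₂ (there h)
... | inj₁ m′ with set-new m′
...   | inj₁ m″   = inj₁ m″
...   | inj₂ refl = inj₂ here

rowsOK-tail : ∀ r r′ → RowsOK r r′ → RowsOK (drop 1 r) (drop 1 r′)
rowsOK-tail []       _        _            = tt
rowsOK-tail (_ ∷ []) []       _            = tt
rowsOK-tail (_ ∷ _ ∷ _) []    _            = tt
rowsOK-tail (_ ∷ r)  (_ ∷ r′) (_ , _ , ok) = ok

keyT-tail : ∀ {T} → KeyT T → KeyT (map (drop 1) T)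
keyT-tail ([] , [])                 = [] , []
keyT-tail {r ∷ T} (dec ∷ decs , ok ∷ oks) with keyT-tail (decs , oks)
... | decs′ , oks′ = decr-drop dec ∷ decs′ , all-tail T ok ∷ oks′
  where
    decr-drop : ∀ {r} → Decr r → Decr (drop 1 r)
    decr-drop []      = []
    decr-drop [-]     = []
    decr-drop (_ ∷ d) = d
    all-tail : ∀ T → All (RowsOK r) T → All (RowsOK (drop 1 r)) (map (drop 1) T)
    all-tail []       []         = []
    all-tail (r′ ∷ T) (ok ∷ oks) = rowsOK-tail r r′ ok ∷ all-tail T oks

keyT⇒key : ∀ m {T} → All (λ r → length r ≤ m) T → All (All (_< n)) T → KeyT T → Key n m T
keyT⇒key zero    []                 _ _ = []
keyT⇒key zero    {[] ∷ T} (_ ∷ les) (_ ∷ lts) (_ ∷ decs , _ ∷ oks) = refl ∷ keyT⇒key zero les lts (decs , oks)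
keyT⇒key {n} (suc m) {T} les lts k
  with grabs-mk {S = zeros n} {zeros n} {heads (zeros n) T} T lts k
         (λ h → heads-∋ T lts h , zeros-∌) (heads-new T) (λ m → ⊥-elim (zeros-∌ m)) (λ _ → zeros-∌)
... | _ , gs = _ , _ , _ , gs , keyT⇒key m (shorter les) (tails lts) (keyT-tail k)
  where
    shorter : ∀ {T : Blocks} → All (λ r → length r ≤ suc m) T → All (λ r → length r ≤ m) (map (drop 1) T)
    shorter []                         = []
    shorter {[] ∷ T}      (le ∷ les)   = z≤n ∷ shorter les
    shorter {(_ ∷ _) ∷ T} (le ∷ les)   = s≤s⁻¹ le ∷ shorter les
    tails : ∀ {T : Blocks} → All (All (_< n)) T → All (All (_< n)) (map (drop 1) T)
    tails []                 = []
    tails ([] ∷ lts)         = [] ∷ tails lts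
    tails ((_ ∷ lt) ∷ lts)   = lt ∷ tails lts

grabs-head : ∀ {a} {C S G S′ G′ : Vec Bool n} {T T′} → Grabs C S G T′ T S′ G′ → Head a T → C ∋ a × ¬ (G ∋ a)
grabs-head (skip gs)    (there h) = grabs-head gs h
grabs-head (first g gs) here = grabFirst-∋ g
grabs-head (first g gs) (there h) with grabFirst-set g | grabs-head gs h
... | refl | m , ∌ = m , λ m′ → ∌ (set-old m′)
grabs-head (next g gs)  here = grabNext-∋ g
grabs-head (next g gs)  (there h) with grabNext-set g | grabs-head gs h
... | refl | m , ∌ = m , λ m′ → ∌ (set-old m′)

grabs-all : ∀ {t s r} {C S G S′ G′ : Vec Bool n} {T T′} → Grabs C S G T′ T S′ G′ → r ≡ t ∷ s → All (RowsOK s) T′ →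
  (∀ {a} → Head a T → t ≢ a × (a < t → Above a s)) → All (RowsOK r) T
grabs-all [] refl _ _ = []
grabs-all (skip gs) refl (_ ∷ oks) h = tt ∷ grabs-all gs refl oks (λ i → h (there i))
grabs-all {s = s} (first g gs) refl (ok ∷ oks) h =
  (proj₁ (h here) , proj₂ (h here) , ok) ∷ grabs-all gs refl oks (λ i → h (there i))
grabs-all (next g gs) refl (ok ∷ oks) h =
  (proj₁ (h here) , proj₂ (h here) , ok) ∷ grabs-all gs refl oks (λ i → h (there i))

grabs-pairs : {C S G S′ G′ : Vec Bool n} {T T′ : Blocks} → Grabs C S G T′ T S′ G′ → AllPairs RowsOK T′ → AllPairs RowsOK T
grabs-pairs [] _ = []
grabs-pairs (skip gs) (_ ∷ oks) = All.universal (λ _ → tt) _ ∷ grabs-pairs gs oks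
grabs-pairs {C = C} (first {G = G} {T = T} {t = t} g gs) (ok ∷ oks) with grabFirst-set g
... | refl = grabs-all gs refl ok h ∷ grabs-pairs gs oks
  where
    h : ∀ {a} → Head a T → t ≢ a × (a < t → ⊥)
    h i with grabs-head gs i
    ... | m , ∌ = (λ { refl → ∌ (set-∋ (∋-< m)) }) , λ lt → <⇒≱ lt (grabFirst-min g m (λ m′ → ∌ (set-old m′)))
grabs-pairs {C = C} (next {G = G} {T = T} {s = s} {t = t} g gs) (ok ∷ oks) with grabNext-set g
... | refl = grabs-all gs refl ok h ∷ grabs-pairs gs oks
  where
    h : ∀ {a} → Head a T → t ≢ a × (a < t → a < s)
    h {a} i with grabs-head gs i
    ... | m , ∌ = (λ { refl → ∌ (set-∋ (∋-< m)) }) , λ lt → below lt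
      where
        below : a < t → a < s
        below lt with ≤-<-connex s a
        ... | inj₁ le = ⊥-elim (<⇒≱ lt (grabNext-min g m (λ m′ → ∌ (set-old m′)) le))
        ... | inj₂ lt′ = lt′

key⇒keyT : ∀ m {T} → Key n m T → KeyT T
key⇒keyT {n} m {T} key = key-decr m key , pairs m key
  where
    pairs : ∀ m {T} → Key n m T → AllPairs RowsOK T
    pairs zero [] = []
    pairs zero (refl ∷ es) = All.universal (λ _ → tt) _ ∷ pairs zero es
    pairs (suc m) (_ , _ , _ , gs , key) = grabs-pairs gs (pairs m key)

-- The Boolean test for key tableaux

∧-split : ∀ {a b} → a ∧ b ≡ true → a ≡ true × b ≡ true
∧-split {true} {true} _ = refl , refl

∧-join : ∀ {a b} → a ≡ true → b ≡ true → a ∧ b ≡ true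
∧-join refl refl = refl

T⇒true : ∀ {b} → T b → b ≡ true
T⇒true {true} _ = refl

true⇒T : ∀ {b} → b ≡ true → T b
true⇒T refl = tt

¬T⇒false : ∀ {b} → ¬ T b → b ≡ false
¬T⇒false {true}  f = ⊥-elim (f tt)
¬T⇒false {false} _ = refl

false⇒¬T : ∀ {b} → b ≡ false → ¬ T b
false⇒¬T refl ()

allB⁺ : ∀ {A : Set} (p : A → Bool) xs → (∀ {x} → x ∈ xs → p x ≡ true) → allB p xs ≡ true
allB⁺ p []       h = refl
allB⁺ p (x ∷ xs) h = ∧-join (h (here refl)) (allB⁺ p xs (λ m → h (there m)))

allB⁻ : ∀ {A : Set} (p : A → Bool) xs {x} → allB p xs ≡ true → x ∈ xs → p x ≡ true
allB⁻ p (x ∷ xs) eq (here refl) = proj₁ (∧-split eq)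
allB⁻ p (x ∷ xs) eq (there m)   = allB⁻ p xs (proj₂ (∧-split {p x} eq)) m

allB-All : ∀ {A : Set} {p : A → Bool} {P : A → Set} → (∀ x → p x ≡ true → P x) → ∀ xs → allB p xs ≡ true → All P xs
allB-All f []       _  = []
allB-All f (x ∷ xs) eq = f x (proj₁ (∧-split eq)) ∷ allB-All f xs (proj₂ (∧-split eq))

All-allB : ∀ {A : Set} {p : A → Bool} {P : A → Set} → (∀ x → P x → p x ≡ true) → ∀ {xs} → All P xs → allB p xs ≡ true
All-allB f []       = refl
All-allB f (p ∷ ps) = ∧-join (f _ p) (All-allB f ps)

weaklyDecr⁻ : ∀ r → weaklyDecr r ≡ true → Decr r
weaklyDecr⁻ []          _  = []
weaklyDecr⁻ (_ ∷ [])    _  = [-]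
weaklyDecr⁻ (a ∷ b ∷ r) eq = ≤ᵇ⇒≤ b a (true⇒T (proj₁ (∧-split eq))) ∷ weaklyDecr⁻ (b ∷ r) (proj₂ (∧-split eq))

weaklyDecr⁺ : ∀ r → Decr r → weaklyDecr r ≡ true
weaklyDecr⁺ []          _  = refl
weaklyDecr⁺ (_ ∷ [])    _  = refl
weaklyDecr⁺ (a ∷ b ∷ r) (le ∷ dec) = ∧-join (T⇒true (≤⇒≤ᵇ le)) (weaklyDecr⁺ (b ∷ r) dec)

pairB : Maybe ℕ → Maybe ℕ → Maybe ℕ → Bool
pairB (just a) (just b) m = not (a ≡ᵇ b) ∧ (if b <ᵇ a then boxAbove b m else true)
pairB _        _        _ = true

pairOK≡pairB : ∀ T i k j → pairOK T i k j ≡ pairB (entry T i j) (entry T k j) (entry T i (suc j))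
pairOK≡pairB T i k j with entry T i j | entry T k j
... | just _  | just _  = refl
... | just _  | nothing = refl
... | nothing | _       = refl

entry-nth : ∀ {T i r} j → nth T i ≡ just r → entry T i j ≡ nth r j
entry-nth {T} {i} j eq with nth T i
entry-nth j refl | just _ = refl

pairB-nothing : ∀ a m → pairB a nothing m ≡ true
pairB-nothing (just _) _ = refl
pairB-nothing nothing  _ = refl

rowsOK⇒pairB : ∀ r r′ → RowsOK r r′ → ∀ j → pairB (nth r j) (nth r′ j) (nth r (suc j)) ≡ true
rowsOK⇒pairB []      _  _ _ = refl
rowsOK⇒pairB (a ∷ r) [] _ j = pairB-nothing (nth (a ∷ r) j) (nth r j)
rowsOK⇒pairB (a ∷ r) (b ∷ r′) (_ , _ , ok) (suc j) = rowsOK⇒pairB r r′ ok j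
rowsOK⇒pairB (a ∷ r) (b ∷ r′) (ne , ab , _) zero with a ≡ᵇ b in e₁
... | true = ⊥-elim (ne (≡ᵇ⇒≡ a b (true⇒T e₁)))
... | false with b <ᵇ a in e₂
...   | false = refl
...   | true with r | ab (<ᵇ⇒< b a (true⇒T e₂))
...     | c ∷ _ | lt = T⇒true (<⇒<ᵇ lt)

pairB⇒rowsOK : ∀ r r′ → (∀ j → j < length r → pairB (nth r j) (nth r′ j) (nth r (suc j)) ≡ true) → RowsOK r r′
pairB⇒rowsOK []      _        _ = tt
pairB⇒rowsOK (a ∷ r) []       _ = tt
pairB⇒rowsOK (a ∷ r) (b ∷ r′) h = ne , above r (proj₂ (∧-split (h 0 (s≤s z≤n)))) , pairB⇒rowsOK r r′ (λ j lt → h (suc j) (s≤s lt))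
  where
    ne : a ≢ b
    ne eq with a ≡ᵇ b in e | proj₁ (∧-split {not (a ≡ᵇ b)} (h 0 (s≤s z≤n)))
    ... | false | _ = false⇒¬T e (≡⇒≡ᵇ a b eq)
    above : ∀ r → (if b <ᵇ a then boxAbove b (nth r 0) else true) ≡ true → b < a → Above b r
    above r eq lt with b <ᵇ a in e
    above []      () lt | true
    above (c ∷ _) eq lt | true = <ᵇ⇒< b c (true⇒T eq)
    ... | false = ⊥-elim (false⇒¬T e (<⇒<ᵇ lt))

nth-< : ∀ {A : Set} (xs : List A) {i x} → nth xs i ≡ just x → i < length xs
nth-< (x ∷ xs) {zero}  _  = s≤s z≤n
nth-< (x ∷ xs) {suc i} eq = s≤s (nth-< xs eq)

nth-all : ∀ {A : Set} {P : A → Set} {xs i x} → All P xs → nth xs i ≡ just x → P x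
nth-all {i = zero}  (p ∷ _)  refl = p
nth-all {i = suc i} (_ ∷ ps) eq   = nth-all ps eq

all-nth : ∀ {A : Set} {P : A → Set} xs → (∀ i {x} → nth xs i ≡ just x → P x) → All P xs
all-nth []       h = []
all-nth (x ∷ xs) h = h 0 refl ∷ all-nth xs (λ i → h (suc i))

allPairs-nth : ∀ {A : Set} {R : A → A → Set} {xs i k x y} → AllPairs R xs → i < k →
  nth xs i ≡ just x → nth xs k ≡ just y → R x y
allPairs-nth {i = zero}  {suc k} (r ∷ _)  _        refl eq  = nth-all r eq
allPairs-nth {i = suc i} {suc k} (_ ∷ rs) (s≤s lt) eq   eq′ = allPairs-nth rs lt eq eq′

nth-allPairs : ∀ {A : Set} {R : A → A → Set} xs →
  (∀ i k {x y} → i < k → nth xs i ≡ just x → nth xs k ≡ just y → R x y) → AllPairs R xs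
nth-allPairs []       h = []
nth-allPairs (x ∷ xs) h =
  all-nth xs (λ k → h 0 (suc k) (s≤s z≤n) refl) ∷ nth-allPairs xs (λ i k lt → h (suc i) (suc k) (s≤s lt))

≤-maxL : ∀ xs → All (_≤ maxL xs) xs
≤-maxL []       = []
≤-maxL (x ∷ xs) = m≤m⊔n x (maxL xs) ∷ All.map (λ le → ≤-trans le (m≤n⊔m x (maxL xs))) (≤-maxL xs)

length-≤-maxL : (T : Blocks) → All (λ r → length r ≤ maxL (map length T)) T
length-≤-maxL T = unmap T (≤-maxL (map length T))
  where
    unmap : ∀ {b} T → All (_≤ b) (map length T) → All (λ r → length r ≤ b) T
    unmap []      []         = []
    unmap (r ∷ T) (le ∷ les) = le ∷ unmap T les

cellB : Blocks → ℕ → ℕ → ℕ → Bool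
cellB T i k j = not (i <ᵇ k) ∨ pairOK T i k j

rowB : Blocks → ℕ → ℕ → Bool
rowB T i k = allB (cellB T i k) (upTo (maxL (map length T)))

isKey⇒keyT : ∀ T → isKey T ≡ true → KeyT T
isKey⇒keyT T eq with ∧-split {allB weaklyDecr T} eq
... | eq₁ , eq₂ = allB-All weaklyDecr⁻ T eq₁ , nth-allPairs T pair
  where
    pair : ∀ i k {r r′} → i < k → nth T i ≡ just r → nth T k ≡ just r′ → RowsOK r r′
    pair i k {r} {r′} i<k eqᵢ eqₖ = pairB⇒rowsOK r r′ λ j lt → cell j
      (allB⁻ (cellB T i k) (upTo (maxL (map length T)))
        (allB⁻ (rowB T i) (upTo (length T))
          (allB⁻ (λ i → allB (rowB T i) (upTo (length T))) (upTo (length T)) eq₂ (∈-upTo⁺ (nth-< T eqᵢ)))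
          (∈-upTo⁺ (nth-< T eqₖ)))
        (∈-upTo⁺ (<-≤-trans lt (nth-all (length-≤-maxL T) eqᵢ))))
      where
        cell : ∀ j → cellB T i k j ≡ true → pairB (nth r j) (nth r′ j) (nth r (suc j)) ≡ true
        cell j h rewrite T⇒true (<⇒<ᵇ i<k) | pairOK≡pairB T i k j | entry-nth {T} j eqᵢ | entry-nth {T} j eqₖ
                       | entry-nth {T} (suc j) eqᵢ = h

keyT⇒isKey : ∀ T → KeyT T → isKey T ≡ true
keyT⇒isKey T (decs , oks) = ∧-join (All-allB weaklyDecr⁺ decs)
  (allB⁺ (λ i → allB (rowB T i) (upTo (length T))) (upTo (length T)) λ {i} _ →
    allB⁺ (rowB T i) (upTo (length T)) λ {k} _ → allB⁺ (cellB T i k) (upTo (maxL (map length T))) λ {j} _ → cell i k j)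
  where
    cell : ∀ i k j → cellB T i k j ≡ true
    cell i k j with i <ᵇ k in e
    ... | false = refl
    ... | true rewrite pairOK≡pairB T i k j with nth T i in eqᵢ | nth T k in eqₖ
    ...   | nothing | _       = refl
    ...   | just r  | nothing = pairB-nothing (nth r j) (nth r (suc j))
    ...   | just r  | just r′ = rowsOK⇒pairB r r′ (allPairs-nth oks (<ᵇ⇒< i k (true⇒T e)) eqᵢ eqₖ) j

-- Column insertion on lists of entries

∈-elems⁺ : ∀ k {a} {v : Vec Bool n} → v ∋ a → k + a ∈ elems k v
∈-elems⁺ k here = here (+-identityʳ k)
∈-elems⁺ k {suc a} {true ∷ v}  (there m) rewrite +-suc k a = there (∈-elems⁺ (suc k) m)
∈-elems⁺ k {suc a} {false ∷ v} (there m) rewrite +-suc k a = ∈-elems⁺ (suc k) m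

∈-elems⁻ : ∀ k {b} (v : Vec Bool n) → b ∈ elems k v → ∃[ a ] b ≡ k + a × v ∋ a
∈-elems⁻ k (true ∷ v) (here refl) = 0 , sym (+-identityʳ k) , here
∈-elems⁻ k (true ∷ v) (there m) with ∈-elems⁻ (suc k) v m
... | a , eq , m′ = suc a , trans eq (sym (+-suc k a)) , there m′
∈-elems⁻ k (false ∷ v) m with ∈-elems⁻ (suc k) v m
... | a , eq , m′ = suc a , trans eq (sym (+-suc k a)) , there m′

allB-false : ∀ {A : Set} (p : A → Bool) xs {x} → x ∈ xs → p x ≡ false → allB p xs ≡ false
allB-false p (x ∷ xs) (here refl) eq rewrite eq = refl
allB-false p (x ∷ xs) (there m)   eq with p x
... | true  = allB-false p xs m eq
... | false = refl

anyB-true : ∀ {A : Set} (p : A → Bool) xs {x} → x ∈ xs → p x ≡ true → anyB p xs ≡ true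
anyB-true p (x ∷ xs) (here refl) eq rewrite eq = refl
anyB-true p (x ∷ xs) (there m)   eq with p x
... | true  = refl
... | false = anyB-true p xs m eq

anyB-false : ∀ {A : Set} (p : A → Bool) xs → (∀ {x} → x ∈ xs → p x ≡ false) → anyB p xs ≡ false
anyB-false p []       h = refl
anyB-false p (x ∷ xs) h rewrite h (here refl) = anyB-false p xs (λ m → h (there m))

app-elems : ∀ k {x} {E E′ : Vec Bool n} → App x E E′ → elems k E′ ≡ elems k E ++ [ k + x ]
app-elems {suc n} k {zero} (put ∷ p) with pass-carry-carry p
... | _ , refl , refl , _ rewrite elems-zeros (suc k) n | +-identityʳ k = refl
app-elems k {suc x} (skip₀ {true} ∷ p)  rewrite +-suc k x = cong (k ∷_) (app-elems (suc k) p)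
app-elems k {suc x} (skip₀ {false} ∷ p) rewrite +-suc k x = app-elems (suc k) p

pop-elems≡ : ∀ k {x} {E E′ : Vec Bool n} → Pop E E′ x → elems k E ≡ k + x ∷ elems k E′
pop-elems≡ k {zero} {_ ∷ E} (take ∷ p) with pass-after p
... | _ , _ , refl , _ = cong (_∷ elems (suc k) E) (sym (+-identityʳ k))
pop-elems≡ k {suc x} (move ∷ p) rewrite +-suc k x = pop-elems≡ (suc k) p

bump-hit : ∀ {x z zs} → x < z → bump x (z ∷ zs) ≡ (x ∷ zs , z)
bump-hit lt rewrite T⇒true (<⇒<ᵇ lt) = refl

bump-miss : ∀ {x z zs} → ¬ (x < z) → bump x (z ∷ zs) ≡ (z ∷ proj₁ (bump x zs) , proj₂ (bump x zs))
bump-miss {x} {z} nlt rewrite ¬T⇒false (λ t → nlt (<ᵇ⇒< x z t)) = refl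

ins-bump : ∀ k {x z} {E E′ : Vec Bool n} → x < z → Ins x E E′ z → bump (k + x) (elems k E) ≡ (elems k E′ , k + z)
ins-bump k {zero} {suc z} _ (put ∷ p) rewrite pop-elems≡ (suc k) p | +-identityʳ k | +-suc k z =
  bump-hit (s≤s (m≤m+n k z))
ins-bump k {suc x} {suc z} (s≤s lt) (skip₀ {true} ∷ p) rewrite +-suc k x | +-suc k z =
  trans (bump-miss (≤⇒≯ (m≤n⇒m≤1+n (m≤m+n k x)))) (cong (λ r → k ∷ proj₁ r , proj₂ r) (ins-bump (suc k) lt p))
ins-bump k {suc x} {suc z} (s≤s lt) (skip₀ {false} ∷ p) rewrite +-suc k x | +-suc k z = ins-bump (suc k) lt p

ins-same : ∀ {x} {E E′ : Vec Bool n} → Ins x E E′ x → E ≡ E′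
ins-same {x = zero} (here ∷ p) with pass-after p
... | _ , _ , refl , _ = refl
ins-same {x = suc x} (skip₀ ∷ p) = cong (_ ∷_) (ins-same p)

app-less : ∀ {x b} {E E′ : Vec Bool n} → App x E E′ → b ∈ elems 0 E → (b <ᵇ x) ≡ true
app-less {E = E} a m with ∈-elems⁻ 0 E m
... | _ , refl , m′ = T⇒true (<⇒<ᵇ (app-max a m′))

colInsert-app : ∀ {x cols} {E E′ : Vec Bool n} → App x E E′ → colInsert x (elems 0 E ∷ cols) ≡ (elems 0 E′ ∷ cols , 0)
colInsert-app {x = x} {E = E} a rewrite allB⁺ (_<ᵇ x) (elems 0 E) (app-less a) | app-elems 0 a = refl

ins-distinct : ∀ {x z b} {E E′ : Vec Bool n} → x < z → Ins x E E′ z → b ∈ elems 0 E → (x ≡ᵇ b) ≡ false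
ins-distinct {x = x} {E = E} x<z i m with ∈-elems⁻ 0 E m
... | b , refl , m′ = ¬T⇒false λ t → contra (≡ᵇ⇒≡ x b t) m′
  where
    contra : ∀ {b} → x ≡ b → E ∋ b → ⊥
    contra refl m = <⇒≱ x<z (ins-min i m ≤-refl)

-- The two ways of going on to the next column are one notion here: if x already lies in the column,
-- it replaces itself, which is the tile `here`.
colInsert-ins : ∀ {x z cols} {E E′ : Vec Bool n} → Ins x E E′ z →
  colInsert x (elems 0 E ∷ cols) ≡ (elems 0 E′ ∷ proj₁ (colInsert z cols) , suc (proj₂ (colInsert z cols)))
colInsert-ins {x = x} {z} {E = E} i
  rewrite allB-false (_<ᵇ x) (elems 0 E) (∈-elems⁺ 0 (ins-∋ i)) (¬T⇒false (λ t → ≤⇒≯ (ins-≤ i) (<ᵇ⇒< z x t)))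
  with m≤n⇒m<n∨m≡n (ins-≤ i)
... | inj₂ refl rewrite anyB-true (x ≡ᵇ_) (elems 0 E) (∈-elems⁺ 0 (ins-∋ i)) (T⇒true (≡⇒≡ᵇ x x refl)) | ins-same i = refl
... | inj₁ x<z rewrite anyB-false (x ≡ᵇ_) (elems 0 E) (ins-distinct x<z i) | ins-bump 0 x<z i = refl

-- Lands c xs P P′: column inserting the letters xs into P creates boxes in columns c, c+1, …
data Lands : ℕ → List ℕ → Blocks → Blocks → Set where
  []  : ∀ {c P} → Lands c [] P P
  _∷_ : ∀ {c x xs P P₁ P′} → colInsert x P ≡ (P₁ , c) → Lands (suc c) xs P₁ P′ → Lands c (x ∷ xs) P P′

data AllLand : Blocks → Blocks → Blocks → Set where
  []  : ∀ {P} → AllLand [] P P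
  _∷_ : ∀ {xs X P P₁ P′} → Lands 0 xs P P₁ → AllLand X P₁ P′ → AllLand (xs ∷ X) P P′

lands-insRun : ∀ {c xs Ps P′} {E : Vec Bool n} → All (_< n) xs → Lands (suc c) xs (elems 0 E ∷ Ps) P′ →
  ∃[ E′ ] ∃[ zs ] ∃[ Ps′ ] InsRun E xs E′ zs × Lands c zs Ps Ps′ × P′ ≡ elems 0 E′ ∷ Ps′
lands-insRun _ [] = _ , _ , _ , [] , [] , refl
lands-insRun {Ps = Ps} {E = E} (lt ∷ lts) (_∷_ {x = x} eq l) with insert-total lt E
... | inj₂ (_ , a) with trans (sym (colInsert-app {cols = Ps} a)) eq
...   | ()
lands-insRun {Ps = Ps} {E = E} (lt ∷ lts) (_∷_ {x = x} eq l) | inj₁ (E₁ , z , i) with colInsert z Ps in eq′ | trans (sym (colInsert-ins {cols = Ps} i)) eq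
... | _ , _ | refl with lands-insRun {E = E₁} lts l
...   | _ , _ , _ , is , l′ , refl = _ , _ , _ , i ∷ is , eq′ ∷ l′ , refl

insRun-< : {C C′ : Vec Bool n} → InsRun C ys C′ xs → All (_< n) xs
insRun-< []       = []
insRun-< (i ∷ is) = ins-out-< i ∷ insRun-< is

insRun-lands : ∀ {c Ps Ps′} {E E′ : Vec Bool n} → InsRun E xs E′ zs → Lands c zs Ps Ps′ →
  Lands (suc c) xs (elems 0 E ∷ Ps) (elems 0 E′ ∷ Ps′)
insRun-lands [] [] = []
insRun-lands {Ps = Ps} (i ∷ is) (eq ∷ l) =
  trans (colInsert-ins i) (cong (λ r → _ ∷ proj₁ r , suc (proj₂ r)) eq) ∷ insRun-lands is l

-- Landing in column 0 means being appended to the first column, landing further right means passing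
-- through it. Splitting off this column gives `QCols`, and the bumped letters land one index lower,
-- again starting from 0.
allLand-qcols : ∀ {X Ps P′} {E : Vec Bool n} → All (All (_< n)) X → AllLand X (elems 0 E ∷ Ps) P′ →
  ∃[ E′ ] ∃[ Z ] ∃[ Ps′ ] QCols E X E′ Z × AllLand Z Ps Ps′ × All (All (_< n)) Z
allLand-qcols _ [] = _ , _ , _ , [] , [] , []
allLand-qcols (_ ∷ lts) ([] ∷ ls) with allLand-qcols lts ls
... | _ , _ , _ , q , ls′ , lts′ = _ , _ , _ , skip q , [] ∷ ls′ , [] ∷ lts′
allLand-qcols {Ps = Ps} {E = E} ((lt ∷ lt₂) ∷ lts) ((_∷_ {x = x} eq l) ∷ ls) with insert-total lt E
... | inj₁ (_ , z , i) with trans (sym (colInsert-ins {cols = Ps} i)) eq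
...   | ()
allLand-qcols {Ps = Ps} {E = E} ((lt ∷ lt₂) ∷ lts) ((_∷_ {x = x} eq l) ∷ ls) | inj₂ (E₁ , a) with trans (sym (colInsert-app {cols = Ps} a)) eq
... | refl with lands-insRun {E = E₁} lt₂ l
...   | E₂ , _ , _ , is , l′ , refl with allLand-qcols {E = E₂} lts ls
...     | _ , _ , _ , q , ls′ , lts′ = _ , _ , _ , blk a is q , l′ ∷ ls′ , insRun-< is ∷ lts′

qcols-allLand : ∀ {Ps Ps′} {E E′ : Vec Bool n} → QCols E X E′ Z → AllLand Z Ps Ps′ →
  AllLand X (elems 0 E ∷ Ps) (elems 0 E′ ∷ Ps′)
qcols-allLand [] [] = []
qcols-allLand (skip q) ([] ∷ ls) = [] ∷ qcols-allLand q ls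
qcols-allLand (blk a is q) (l ∷ ls) = (colInsert-app a ∷ insRun-lands is l) ∷ qcols-allLand q ls

-- The list of entries of `zeros n` is an empty column, not a missing one. The first letter inserted
-- removes the difference.
allLand-pad : ∀ {X P′} → AllLand X [] P′ → ∃[ P″ ] AllLand X ([] ∷ []) P″
allLand-pad []                = _ , []
allLand-pad ([] ∷ ls)         = _ , [] ∷ proj₂ (allLand-pad ls)
allLand-pad ((eq ∷ l) ∷ ls)   = _ , (eq ∷ l) ∷ ls

allLand-unpad : ∀ {X P′} → AllLand X ([] ∷ []) P′ → ∃[ P″ ] AllLand X [] P″
allLand-unpad []                = _ , []
allLand-unpad ([] ∷ ls)         = _ , [] ∷ proj₂ (allLand-unpad ls)
allLand-unpad ((eq ∷ l) ∷ ls)   = _ , (eq ∷ l) ∷ ls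

qcols-length : ∀ {m} {E E′ : Vec Bool n} → QCols E X E′ Z → All (λ r → length r ≤ suc m) X → All (λ r → length r ≤ m) Z
qcols-length []       _          = []
qcols-length (skip q) (_ ∷ les)  = z≤n ∷ qcols-length q les
qcols-length {m = m} (blk _ is q) (s≤s le ∷ les) = ≤-trans (≤-reflexive (run is)) le ∷ qcols-length q les
  where
    run : ∀ {n xs zs} {C C′ : Vec Bool n} → InsRun C xs C′ zs → length zs ≡ length xs
    run []       = refl
    run (_ ∷ is) = cong suc (run is)

allLand⇒Q : ∀ m {X P′} → All (λ r → length r ≤ m) X → All (All (_< n)) X → AllLand X [] P′ → Q n m X
allLand⇒Q zero    les _ _ = empties les
  where
    empties : ∀ {X : Blocks} → All (λ r → length r ≤ 0) X → All (_≡ []) X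
    empties []                   = []
    empties {[] ∷ X} (_ ∷ les)   = refl ∷ empties les
allLand⇒Q {n} (suc m) {X} les lts ls with allLand-qcols {E = zeros n} lts
  (subst (λ c → AllLand X (c ∷ []) (proj₁ (allLand-pad ls))) (sym (elems-zeros 0 n)) (proj₂ (allLand-pad ls)))
... | _ , _ , _ , q , ls′ , lts′ = _ , _ , q , allLand⇒Q m (qcols-length q les) lts′ ls′

Q⇒allLand : ∀ m {X} → Q n m X → ∃[ P′ ] AllLand X [] P′
Q⇒allLand zero    []          = _ , []
Q⇒allLand {n} zero (refl ∷ es) = _ , [] ∷ proj₂ (Q⇒allLand {n} zero es)
Q⇒allLand {n} (suc m) {X} (E , _ , q , h) with Q⇒allLand m h
... | P , ls = allLand-unpad (subst (λ c → AllLand X (c ∷ []) (elems 0 E ∷ P)) (elems-zeros 0 n) (qcols-allLand q ls))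

upFrom : ℕ → ℕ → List ℕ
upFrom c zero    = []
upFrom c (suc k) = c ∷ upFrom (suc c) k

blockCols : List ℕ → List ℕ
blockCols α = concat (map (upFrom 0) α)

-- Recording tableaux

landing : List ℕ → Blocks → List ℕ
landing []       P = []
landing (x ∷ xs) P = proj₂ (colInsert x P) ∷ landing xs (proj₁ (colInsert x P))

addAll : ℕ → List ℕ → Blocks → Blocks
addAll j []       R = R
addAll j (c ∷ cs) R = addAll (suc j) cs (addAt c j R)

insertAll-addAll : ∀ j xs P R → proj₂ (insertAll j xs P R) ≡ addAll j (landing xs P) R
insertAll-addAll j []       P R = refl
insertAll-addAll j (x ∷ xs) P R = insertAll-addAll (suc j) xs (proj₁ (colInsert x P)) (addAt (proj₂ (colInsert x P)) j R)

lands-landing : ∀ {c xs ys P P′ cs} → Lands c xs P P′ → landing ys P′ ≡ cs → landing (xs ++ ys) P ≡ upFrom c (length xs) ++ cs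
lands-landing []       eq = eq
lands-landing (e ∷ l)  eq rewrite e = cong (_ ∷_) (lands-landing l eq)

landing-lands : ∀ {c} xs {ys P cs} → landing (xs ++ ys) P ≡ upFrom c (length xs) ++ cs →
  ∃[ P′ ] Lands c xs P P′ × landing ys P′ ≡ cs
landing-lands []       eq = _ , [] , eq
landing-lands (x ∷ xs) {P = P} eq with landing-lands xs (∷-injectiveʳ eq)
... | P′ , l , eq′ = P′ , (cong (proj₁ (colInsert x P) ,_) (∷-injectiveˡ eq) ∷ l) , eq′

allLand-landing : ∀ {X P P′} → AllLand X P P′ → landing (concat X) P ≡ blockCols (map length X)
allLand-landing []       = refl
allLand-landing (l ∷ ls) = lands-landing l (allLand-landing ls)

landing-allLand : ∀ X {P} → landing (concat X) P ≡ blockCols (map length X) → ∃[ P′ ] AllLand X P P′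
landing-allLand []       _  = _ , []
landing-allLand (xs ∷ X) eq with landing-lands xs eq
... | _ , l , eq′ with landing-allLand X eq′
...   | _ , ls = _ , l ∷ ls

data At (j : ℕ) : ℕ → Blocks → Set where
  here  : ∀ {q R} → j ∈ q → At j 0 (q ∷ R)
  there : ∀ {c q R} → At j c R → At j (suc c) (q ∷ R)

addAt-∋ : ∀ c j R → At j c (addAt c j R)
addAt-∋ zero    j []      = here (here refl)
addAt-∋ zero    j (q ∷ R) = here (∈-++⁺ʳ q (here refl))
addAt-∋ (suc c) j []      = there (addAt-∋ c j [])
addAt-∋ (suc c) j (q ∷ R) = there (addAt-∋ c j R)

addAt-old : ∀ c j {i d R} → At i d R → At i d (addAt c j R)
addAt-old zero    j (here m)  = here (∈-++⁺ˡ m)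
addAt-old zero    j (there a) = there a
addAt-old (suc c) j (here m)  = here m
addAt-old (suc c) j (there a) = there (addAt-old c j a)

addAt-new : ∀ c j {i d} R → At i d (addAt c j R) → At i d R ⊎ (i ≡ j × d ≡ c)
addAt-new zero    j []      (here (here refl)) = inj₂ (refl , refl)
addAt-new zero    j (q ∷ R) (here m) with ∈-++⁻ q m
... | inj₁ m′          = inj₁ (here m′)
... | inj₂ (here refl) = inj₂ (refl , refl)
addAt-new zero    j (q ∷ R) (there a) = inj₁ (there a)
addAt-new (suc c) j []      (there a) with addAt-new c j [] a
... | inj₂ (e , e′) = inj₂ (e , cong suc e′)
addAt-new (suc c) j (q ∷ R) (here m) = inj₁ (here m)
addAt-new (suc c) j (q ∷ R) (there a) with addAt-new c j R a
... | inj₁ a′ = inj₁ (there a′)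
... | inj₂ (e , e′) = inj₂ (e , cong suc e′)

addAll-old : ∀ j cs {i d R} → At i d R → At i d (addAll j cs R)
addAll-old j []       a = a
addAll-old j (c ∷ cs) a = addAll-old (suc j) cs (addAt-old c j a)

addAll-new : ∀ j cs {i d} R → i < j → At i d (addAll j cs R) → At i d R
addAll-new j []       R _  a = a
addAll-new j (c ∷ cs) R lt a with addAt-new c j R (addAll-new (suc j) cs (addAt c j R) (m≤n⇒m≤1+n lt) a)
... | inj₁ a′         = a′
... | inj₂ (refl , _) = ⊥-elim (1+n≰n lt)

-- The tableau shows where j was added: the entries present before are smaller than j, and those
-- added afterwards are larger.
addAll-injective : ∀ j cs cs′ {R R′} → length cs ≡ length cs′ →
  (∀ {i d} → At i d R → i < j) → (∀ {i d} → At i d R′ → i < j) →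
  addAll j cs R ≡ addAll j cs′ R′ → cs ≡ cs′
addAll-injective j []       []         _   _ _  _  = refl
addAll-injective j (c ∷ cs) (c′ ∷ cs′) {R} {R′} len b b′ eq
  with addAt-new c′ j R′ (addAll-new (suc j) cs′ (addAt c′ j R′) ≤-refl
         (subst (At j c) eq (addAll-old (suc j) cs (addAt-∋ c j R))))
... | inj₁ a          = ⊥-elim (1+n≰n (b′ a))
... | inj₂ (_ , refl) = cong (c ∷_) (addAll-injective (suc j) cs cs′ (suc-injective len) (bound b) (bound b′) eq)
  where
    bound : ∀ {R} → (∀ {i d} → At i d R → i < j) → ∀ {i d} → At i d (addAt c j R) → i < suc j
    bound {R} b a with addAt-new c j R a
    ... | inj₁ a′         = m≤n⇒m≤1+n (b a′)
    ... | inj₂ (refl , _) = ≤-refl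

length-landing : ∀ xs P → length (landing xs P) ≡ length xs
length-landing []       P = refl
length-landing (x ∷ xs) P = cong suc (length-landing xs (proj₁ (colInsert x P)))

length-upFrom : ∀ c k → length (upFrom c k) ≡ k
length-upFrom c zero    = refl
length-upFrom c (suc k) = cong suc (length-upFrom (suc c) k)

length-blockCols : ∀ (X : Blocks) → length (blockCols (map length X)) ≡ length (concat X)
length-blockCols []       = refl
length-blockCols (xs ∷ X) = trans (length-++ (upFrom 0 (length xs)))
  (trans (cong₂ _+_ (length-upFrom 0 (length xs)) (length-blockCols X)) (sym (length-++ xs)))

rowAdd : ℕ → ℕ → Blocks → Blocks
rowAdd zero    o R       = R
rowAdd (suc a) o []      = [ o ] ∷ rowAdd a (suc o) []
rowAdd (suc a) o (q ∷ R) = (q ++ [ o ]) ∷ rowAdd a (suc o) R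

addAt-++ : ∀ (pre : Blocks) j R → addAt (length pre) j (pre ++ R) ≡ pre ++ addAt 0 j R
addAt-++ []        j R = refl
addAt-++ (q ∷ pre) j R = cong (q ∷_) (addAt-++ pre j R)

addAll-upFrom : ∀ a o pre R cs → addAll o (upFrom (length pre) a ++ cs) (pre ++ R) ≡ addAll (o + a) cs (pre ++ rowAdd a o R)
addAll-upFrom zero    o pre R cs rewrite +-identityʳ o = refl
addAll-upFrom (suc a) o pre R cs rewrite addAt-++ pre o R | +-suc o a = step R
  where
    snoc : ∀ q R′ → addAll (suc o) (upFrom (suc (length pre)) a ++ cs) (pre ++ q ∷ R′) ≡
                    addAll (suc (o + a)) cs (pre ++ q ∷ rowAdd a (suc o) R′)
    snoc q R′ = begin
      addAll (suc o) (upFrom (suc (length pre)) a ++ cs) (pre ++ q ∷ R′)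
        ≡⟨ cong₂ (λ l r → addAll (suc o) (upFrom l a ++ cs) r)
             (sym (trans (length-++ pre {[ q ]}) (+-comm (length pre) 1))) (sym (++-assoc pre [ q ] R′)) ⟩
      addAll (suc o) (upFrom (length (pre ++ [ q ])) a ++ cs) ((pre ++ [ q ]) ++ R′)
        ≡⟨ addAll-upFrom a (suc o) (pre ++ [ q ]) R′ cs ⟩
      addAll (suc (o + a)) cs ((pre ++ [ q ]) ++ rowAdd a (suc o) R′)
        ≡⟨ cong (addAll (suc (o + a)) cs) (++-assoc pre [ q ] _) ⟩
      addAll (suc (o + a)) cs (pre ++ q ∷ rowAdd a (suc o) R′) ∎
      where open ≡-Reasoning
    step : ∀ R → addAll (suc o) (upFrom (suc (length pre)) a ++ cs) (pre ++ addAt 0 o R) ≡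
                 addAll (suc (o + a)) cs (pre ++ rowAdd (suc a) o R)
    step []      = snoc [ o ] []
    step (q ∷ R) = snoc (q ++ [ o ]) R

applyUpTo-cong : ∀ {A : Set} {f g : ℕ → A} w → (∀ m → f m ≡ g m) → applyUpTo f w ≡ applyUpTo g w
applyUpTo-cong zero    h = refl
applyUpTo-cong (suc w) h = cong₂ _∷_ (h 0) (applyUpTo-cong w (λ m → h (suc m)))

cell : ℕ → ℕ → ℕ → List ℕ
cell o a m = if m <ᵇ a then [ o + m ] else []

-- Presenting the columns as values of a function that is `[]` from w on treats extending an old
-- column and creating a new one alike.
rowAdd-applyUpTo : ∀ a o w (f : ℕ → List ℕ) → (∀ {m} → w ≤ m → f m ≡ []) →
  rowAdd a o (applyUpTo f w) ≡ applyUpTo (λ m → f m ++ cell o a m) (w ⊔ a)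
rowAdd-applyUpTo zero o w f h rewrite ⊔-identityʳ w = applyUpTo-cong w (λ m → sym (++-identityʳ (f m)))
rowAdd-applyUpTo (suc a) o zero f h = cong₂ _∷_ (cong₂ _++_ (sym (h z≤n)) (cong [_] (sym (+-identityʳ o))))
  (trans (rowAdd-applyUpTo a (suc o) 0 (λ m → f (suc m)) (λ _ → h z≤n))
    (applyUpTo-cong a λ m → cong (λ k → f (suc m) ++ (if m <ᵇ a then [ k ] else [])) (sym (+-suc o m))))
rowAdd-applyUpTo (suc a) o (suc w) f h = cong₂ _∷_ (cong (λ k → f 0 ++ [ k ]) (sym (+-identityʳ o)))
  (trans (rowAdd-applyUpTo a (suc o) w (λ m → f (suc m)) (λ le → h (s≤s le)))
    (applyUpTo-cong (w ⊔ a) λ m → cong (λ k → f (suc m) ++ (if m <ᵇ a then [ k ] else [])) (sym (+-suc o m))))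

-- Column m, counted from 0, when rows of lengths α are numbered consecutively from o, row after
-- row, and the boxes of each column are then pushed together.
column : ℕ → List ℕ → ℕ → List ℕ
column o []      m = []
column o (a ∷ α) m = cell o a m ++ column (o + a) α m

cell-≥ : ∀ {o a m} → a ≤ m → cell o a m ≡ []
cell-≥ {o} {a} {m} le rewrite ¬T⇒false (λ t → ≤⇒≯ le (<ᵇ⇒< m a t)) = refl

addAll-blockCols : ∀ α o w (f : ℕ → List ℕ) → (∀ {m} → w ≤ m → f m ≡ []) →
  addAll o (blockCols α) (applyUpTo f w) ≡ applyUpTo (λ m → f m ++ column o α m) (w ⊔ maxL α)
addAll-blockCols [] o w f h rewrite ⊔-identityʳ w = applyUpTo-cong w (λ m → sym (++-identityʳ (f m)))
addAll-blockCols (a ∷ α) o w f h = begin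
  addAll o (upFrom 0 a ++ blockCols α) (applyUpTo f w)
    ≡⟨ addAll-upFrom a o [] (applyUpTo f w) (blockCols α) ⟩
  addAll (o + a) (blockCols α) (rowAdd a o (applyUpTo f w))
    ≡⟨ cong (addAll (o + a) (blockCols α)) (rowAdd-applyUpTo a o w f h) ⟩
  addAll (o + a) (blockCols α) (applyUpTo (λ m → f m ++ cell o a m) (w ⊔ a))
    ≡⟨ addAll-blockCols α (o + a) (w ⊔ a) _ (λ {m} le → cong₂ _++_ (h (≤-trans (m≤m⊔n w a) le)) (cell-≥ {o} (≤-trans (m≤n⊔m w a) le))) ⟩
  applyUpTo (λ m → (f m ++ cell o a m) ++ column (o + a) α m) ((w ⊔ a) ⊔ maxL α)
    ≡⟨ cong (applyUpTo _) (⊔-assoc w a (maxL α)) ⟩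
  applyUpTo (λ m → (f m ++ cell o a m) ++ column (o + a) α m) (w ⊔ (a ⊔ maxL α))
    ≡⟨ applyUpTo-cong (w ⊔ (a ⊔ maxL α)) (λ m → ++-assoc (f m) (cell o a m) _) ⟩
  applyUpTo (λ m → f m ++ column o (a ∷ α) m) (w ⊔ (a ⊔ maxL α)) ∎
  where open ≡-Reasoning

-- The standardization of a key tableau

stdFrom : Blocks → List ℕ → Blocks → Blocks
stdFrom T prev []           = []
stdFrom T prev (col ∷ cols) =
  map (λ v → suc (length (filterᵇ (_<ᵇ v) (concat T)) + count v prev)) col ∷ stdFrom T (prev ++ col) cols

-- The left-hand side of std-go is the local function of std, which has no name outside Defs:
-- it is inferred from its use in std≡stdFrom.
mutual
  std-go : ∀ T prev cols → _ ≡ stdFrom T prev cols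

  std≡stdFrom : ∀ T → std T ≡ stdFrom T [] T
  std≡stdFrom []       = refl
  std≡stdFrom (a ∷ []) = refl
  -- Abstracting the whole tableau and the prefix `a ++ b` turns the arguments of the local function
  -- into distinct variables, and the unknown left-hand side then has a unique solution.
  std≡stdFrom (a ∷ b ∷ cs) with List._∷_ a (List._∷_ b cs) | a ++ b
  ... | T | p = cong (λ l → _ ∷ _ ∷ l) (std-go T p cs)

  std-go T prev []           = refl
  std-go T prev (col ∷ cols) = cong (_ ∷_) (std-go T (prev ++ col) cols)

pairs : ℕ → List ℕ → List (ℕ × ℕ)
pairs i []      = []
pairs i (a ∷ α) = (i , a) ∷ pairs (suc i) α

zip-pairs : ∀ i α (f : ℕ → ℕ) → (∀ t → f t ≡ i + t) → zip (applyUpTo f (length α)) α ≡ pairs i α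
zip-pairs i []      f h = refl
zip-pairs i (a ∷ α) f h = cong₂ _∷_ (cong (_, a) (trans (h 0) (+-identityʳ i)))
  (zip-pairs (suc i) α (f ∘ suc) (λ t → trans (h (suc t)) (+-suc i t)))

keyCol : List (ℕ × ℕ) → ℕ → List ℕ
keyCol ps c = map proj₁ (filterᵇ (λ p → c ≤ᵇ proj₂ p) ps)

range1≡ : ∀ m → range1 m ≡ applyUpTo suc m
range1≡ m = map-upTo suc m

map-range1 : ∀ {A : Set} (f : ℕ → A) m → map f (range1 m) ≡ applyUpTo (f ∘ suc) m
map-range1 f m = trans (sym (map-∘ (upTo m))) (map-upTo (f ∘ suc) m)

key≡ : ∀ α → key α ≡ map (keyCol (pairs 1 α)) (range1 (maxL α))
key≡ α = cong (λ ps → map (keyCol ps) (range1 (maxL α)))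
  (trans (cong (λ r → zip r α) (range1≡ (length α))) (zip-pairs 1 α suc (λ t → refl)))

stdFrom-applyUpTo : ∀ T prev (f : ℕ → List ℕ) w → stdFrom T prev (applyUpTo f w) ≡
  applyUpTo (λ m → map (λ v → suc (length (filterᵇ (_<ᵇ v) (concat T)) + count v (prev ++ concat (applyUpTo f m)))) (f m)) w
stdFrom-applyUpTo T prev f zero    = refl
stdFrom-applyUpTo T prev f (suc w) = cong₂ _∷_
  (cong (λ l → map (λ v → suc (length (filterᵇ (_<ᵇ v) (concat T)) + count v l)) (f 0)) (sym (++-identityʳ prev)))
  (trans (stdFrom-applyUpTo T (prev ++ f 0) (f ∘ suc) w) (applyUpTo-cong w λ m →
    cong (λ l → map (λ v → suc (length (filterᵇ (_<ᵇ v) (concat T)) + count v l)) (f (suc m)))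
      (++-assoc prev (f 0) (concat (applyUpTo (f ∘ suc) m)))))

below : ℕ → List ℕ → ℕ
below a cs = length (filterᵇ (_≤ᵇ a) cs)

suc-∸-suc : ∀ {k a} → k < a → suc (a ∸ suc k) ≡ a ∸ k
suc-∸-suc {zero}  {suc a} _        = refl
suc-∸-suc {suc k} {suc a} (s≤s lt) = suc-∸-suc lt

below-applyUpTo : ∀ a k (f : ℕ → ℕ) m → (∀ t → f t ≡ suc k + t) → below a (applyUpTo f m) ≡ (a ∸ k) ⊓ m
below-applyUpTo a k f zero    h = sym (⊓-zeroʳ (a ∸ k))
below-applyUpTo a k f (suc m) h with below-applyUpTo a (suc k) (f ∘ suc) m (λ t → trans (h (suc t)) (cong suc (+-suc k t)))
... | ih rewrite trans (h 0) (+-identityʳ (suc k)) with k <ᵇ a in e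
...   | true  rewrite sym (suc-∸-suc (<ᵇ⇒< k a (true⇒T e))) = cong suc ih
...   | false = trans ih (trans (cong (_⊓ m) (m≤n⇒m∸n≡0 (m≤n⇒m≤1+n a≤k))) (sym (cong (_⊓ suc m) (m≤n⇒m∸n≡0 a≤k))))
  where
    a≤k : a ≤ k
    a≤k = ≮⇒≥ (λ lt → false⇒¬T e (<⇒<ᵇ lt))

below-range1 : ∀ a m → below a (range1 m) ≡ a ⊓ m
below-range1 a m = trans (cong (below a) (range1≡ m)) (below-applyUpTo a 0 suc m (λ t → refl))

-- Double counting for key tableaux: letter i lies in column c exactly if c ≤ a, so a count over the
-- columns `cs` becomes a sum over the letters.
tally : (ℕ → Bool) → List ℕ → List (ℕ × ℕ) → ℕ
tally p cs []             = 0
tally p cs ((i , a) ∷ ps) = (if p i then below a cs else 0) + tally p cs ps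

tally-[] : ∀ p ps → tally p [] ps ≡ 0
tally-[] p []             = refl
tally-[] p ((i , a) ∷ ps) with p i
... | true  = tally-[] p ps
... | false = tally-[] p ps

tally-∷ : ∀ p c cs ps → length (filterᵇ p (keyCol ps c)) + tally p cs ps ≡ tally p (c ∷ cs) ps
tally-∷ p c cs [] = refl
tally-∷ p c cs ((i , a) ∷ ps) with c ≤ᵇ a | tally-∷ p c cs ps
... | false | ih = lemma (p i) (length (filterᵇ p (keyCol ps c))) (tally p cs ps) ih
  where
    lemma : ∀ b l t {t′} → l + t ≡ t′ → l + ((if b then below a cs else 0) + t) ≡ (if b then below a cs else 0) + t′
    lemma true  l t refl = trans (sym (+-assoc l _ t)) (trans (cong (_+ t) (+-comm l (below a cs))) (+-assoc (below a cs) l t))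
    lemma false _ _ eq = eq
... | true  | ih with p i
...   | false = ih
...   | true  = cong suc (trans (sym (+-assoc l _ t)) (trans (cong (_+ t) (+-comm l (below a cs))) (trans (+-assoc (below a cs) l t) (cong (below a cs +_) ih))))
  where
    l = length (filterᵇ p (keyCol ps c))
    t = tally p cs ps

filterᵇ-++ : ∀ (p : ℕ → Bool) xs ys → filterᵇ p (xs ++ ys) ≡ filterᵇ p xs ++ filterᵇ p ys
filterᵇ-++ p []       ys = refl
filterᵇ-++ p (x ∷ xs) ys with p x
... | true  = cong (x ∷_) (filterᵇ-++ p xs ys)
... | false = filterᵇ-++ p xs ys

length-filter-key : ∀ p cs ps → length (filterᵇ p (concat (map (keyCol ps) cs))) ≡ tally p cs ps
length-filter-key p []       ps = sym (tally-[] p ps)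
length-filter-key p (c ∷ cs) ps = begin
  length (filterᵇ p (keyCol ps c ++ concat (map (keyCol ps) cs)))
    ≡⟨ cong length (filterᵇ-++ p (keyCol ps c) _) ⟩
  length (filterᵇ p (keyCol ps c) ++ filterᵇ p (concat (map (keyCol ps) cs)))
    ≡⟨ length-++ (filterᵇ p (keyCol ps c)) ⟩
  length (filterᵇ p (keyCol ps c)) + length (filterᵇ p (concat (map (keyCol ps) cs)))
    ≡⟨ cong (length (filterᵇ p (keyCol ps c)) +_) (length-filter-key p cs ps) ⟩
  length (filterᵇ p (keyCol ps c)) + tally p cs ps
    ≡⟨ tally-∷ p c cs ps ⟩
  tally p (c ∷ cs) ps ∎
  where open ≡-Reasoning

tally-pairs-++ : ∀ p cs i β γ → tally p cs (pairs i (β ++ γ)) ≡ tally p cs (pairs i β) + tally p cs (pairs (i + length β) γ)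
tally-pairs-++ p cs i []      γ rewrite +-identityʳ i = refl
tally-pairs-++ p cs i (a ∷ β) γ rewrite +-suc i (length β) =
  trans (cong ((if p i then below a cs else 0) +_) (tally-pairs-++ p cs (suc i) β γ)) (sym (+-assoc (if p i then below a cs else 0) _ _))

tally-true : ∀ p cs i β → (∀ j → j < i + length β → p j ≡ true) → All (λ a → below a cs ≡ a) β →
  tally p cs (pairs i β) ≡ sum β
tally-true p cs i []      h _          = refl
tally-true p cs i (a ∷ β) h (eq ∷ eqs) rewrite h i (m<m+n i (s≤s z≤n)) | eq | +-suc i (length β) =
  cong (a +_) (tally-true p cs (suc i) β h eqs)

tally-false : ∀ p cs i γ → (∀ j → i ≤ j → j < i + length γ → p j ≡ false) → tally p cs (pairs i γ) ≡ 0
tally-false p cs i []      h = refl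
tally-false p cs i (a ∷ γ) h rewrite h i ≤-refl (m<m+n i (s≤s z≤n)) | +-suc i (length γ) =
  tally-false p cs (suc i) γ (λ j le → h j (<⇒≤ le))

smaller-key : ∀ β γ → length (filterᵇ (_<ᵇ suc (length β)) (concat (key (β ++ γ)))) ≡ sum β
smaller-key β γ = begin
  length (filterᵇ p (concat (key (β ++ γ))))
    ≡⟨ cong (length ∘ filterᵇ p ∘ concat) (key≡ (β ++ γ)) ⟩
  length (filterᵇ p (concat (map (keyCol (pairs 1 (β ++ γ))) cs)))
    ≡⟨ length-filter-key p cs (pairs 1 (β ++ γ)) ⟩
  tally p cs (pairs 1 (β ++ γ))
    ≡⟨ tally-pairs-++ p cs 1 β γ ⟩
  tally p cs (pairs 1 β) + tally p cs (pairs (suc (length β)) γ)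
    ≡⟨ cong₂ _+_ (tally-true p cs 1 β (λ j lt → T⇒true (<⇒<ᵇ lt)) (full β (≤-maxL (β ++ γ))))
                 (tally-false p cs (suc (length β)) γ (λ j le _ → ¬T⇒false (λ t → ≤⇒≯ le (<ᵇ⇒< j _ t)))) ⟩
  sum β + 0
    ≡⟨ +-identityʳ (sum β) ⟩
  sum β ∎
  where
    open ≡-Reasoning
    p  = _<ᵇ suc (length β)
    cs = range1 (maxL (β ++ γ))
    full : ∀ β {w} → All (_≤ w) (β ++ γ) → All (λ a → below a (range1 w) ≡ a) β
    full []      _          = []
    full (a ∷ β) {w} (le ∷ les) = trans (below-range1 a w) (m≤n⇒m⊓n≡m le) ∷ full β les

count-key : ∀ β a γ m → m < a → count (suc (length β)) (concat (map (keyCol (pairs 1 (β ++ a ∷ γ))) (range1 m))) ≡ m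
count-key β a γ m lt = begin
  length (filterᵇ p (concat (map (keyCol (pairs 1 (β ++ a ∷ γ))) cs)))
    ≡⟨ length-filter-key p cs (pairs 1 (β ++ a ∷ γ)) ⟩
  tally p cs (pairs 1 (β ++ a ∷ γ))
    ≡⟨ tally-pairs-++ p cs 1 β (a ∷ γ) ⟩
  tally p cs (pairs 1 β) + ((if p (suc (length β)) then below a cs else 0) + tally p cs (pairs (suc (suc (length β))) γ))
    ≡⟨ cong₂ _+_ (tally-false p cs 1 β (λ j _ lt → ≢-false j (λ { refl → 1+n≰n lt })))
         (cong₂ _+_ (trans (cong (λ b → if b then below a cs else 0) (T⇒true (≡⇒≡ᵇ (length β) (length β) refl)))
                           (trans (below-range1 a m) (m≥n⇒m⊓n≡n (<⇒≤ lt))))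
                    (tally-false p cs (suc (suc (length β))) γ (λ j le _ → ≢-false j (λ { refl → 1+n≰n le })))) ⟩
  m + 0
    ≡⟨ +-identityʳ m ⟩
  m ∎
  where
    open ≡-Reasoning
    p  = suc (length β) ≡ᵇ_
    cs = range1 m
    ≢-false : ∀ j → ¬ (suc (length β) ≡ j) → p j ≡ false
    ≢-false j ne = ¬T⇒false (λ t → ne (≡ᵇ⇒≡ _ j t))

sum-∷ʳ : ∀ β a → sum (β ++ [ a ]) ≡ sum β + a
sum-∷ʳ []      a = +-identityʳ a
sum-∷ʳ (b ∷ β) a = trans (cong (b +_) (sum-∷ʳ β a)) (sym (+-assoc b (sum β) a))

-- In column m + 1 of the key, the letter following those of β has `sum β` smaller letters in the
-- tableau and m copies of itself to its left, one in each earlier column.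
std-column : ∀ m β γ →
  map (λ v → suc (length (filterᵇ (_<ᵇ v) (concat (key (β ++ γ)))) + count v (concat (map (keyCol (pairs 1 (β ++ γ))) (range1 m)))))
      (keyCol (pairs (suc (length β)) γ) (suc m)) ≡ column (suc (sum β)) γ m
std-column m β [] = refl
std-column m β (a ∷ γ) with std-column m (β ++ [ a ]) γ
... | ih rewrite ++-assoc β [ a ] γ | length-++ β {[ a ]} | +-comm (length β) 1 | sum-∷ʳ β a with m <ᵇ a in e
...   | false = ih
...   | true  = cong₂ _∷_ (cong suc (cong₂ _+_ (smaller-key β (a ∷ γ)) (count-key β a γ m (<ᵇ⇒< m a (true⇒T e))))) ih

std-key : ∀ α → std (key α) ≡ addAll 1 (blockCols α) []
std-key α = begin
  std (key α)
    ≡⟨ std≡stdFrom (key α) ⟩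
  stdFrom (key α) [] (key α)
    ≡⟨ cong (stdFrom (key α) []) (trans (key≡ α) (map-range1 K (maxL α))) ⟩
  stdFrom (key α) [] (applyUpTo (K ∘ suc) (maxL α))
    ≡⟨ stdFrom-applyUpTo (key α) [] (K ∘ suc) (maxL α) ⟩
  applyUpTo (λ m → map (val (concat (applyUpTo (K ∘ suc) m))) (K (suc m))) (maxL α)
    ≡⟨ applyUpTo-cong (maxL α) (λ m → trans (cong (λ l → map (val (concat l)) (K (suc m))) (sym (map-range1 K m))) (std-column m [] α)) ⟩
  applyUpTo (column 1 α) (maxL α)
    ≡⟨ addAll-blockCols α 1 0 (λ _ → []) (λ _ → refl) ⟨
  addAll 1 (blockCols α) [] ∎
  where
    open ≡-Reasoning
    K = keyCol (pairs 1 α)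
    val : List ℕ → ℕ → ℕ
    val prev v = suc (length (filterᵇ (_<ᵇ v) (concat (key α))) + count v prev)

-- Maximal factorizations

reverseAcc-linked : ∀ {A : Set} {R : A → A → Set} {x : A} {acc} xs →
  Linked R (x ∷ xs) → Linked (flip R) (x ∷ acc) → Linked (flip R) (reverseAcc (x ∷ acc) xs)
reverseAcc-linked []       _        ls = ls
reverseAcc-linked (y ∷ xs) (r ∷ rs) ls = reverseAcc-linked xs rs (r ∷ ls)

reverse-linked : ∀ {A : Set} {R : A → A → Set} {xs : List A} → Linked R xs → Linked (flip R) (reverse xs)
reverse-linked {xs = []}     _  = []
reverse-linked {xs = x ∷ xs} ls = reverseAcc-linked xs ls [-]

weaklyIncr⁻ : ∀ r → weaklyIncr r ≡ true → Linked _≤_ r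
weaklyIncr⁻ []          _  = []
weaklyIncr⁻ (_ ∷ [])    _  = [-]
weaklyIncr⁻ (a ∷ b ∷ r) eq = ≤ᵇ⇒≤ a b (true⇒T (proj₁ (∧-split eq))) ∷ weaklyIncr⁻ (b ∷ r) (proj₂ (∧-split eq))

weaklyIncr⁺ : ∀ r → Linked _≤_ r → weaklyIncr r ≡ true
weaklyIncr⁺ []          _  = refl
weaklyIncr⁺ (_ ∷ [])    _  = refl
weaklyIncr⁺ (a ∷ b ∷ r) (le ∷ inc) = ∧-join (T⇒true (≤⇒≤ᵇ le)) (weaklyIncr⁺ (b ∷ r) inc)

reverse-concat : ∀ {A : Set} (xss : List (List A)) → reverse (concat (reverse xss)) ≡ concat (map reverse xss)
reverse-concat []         = refl
reverse-concat (xs ∷ xss) = begin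
  reverse (concat (reverse (xs ∷ xss)))           ≡⟨ cong (reverse ∘ concat) (unfold-reverse xs xss) ⟩
  reverse (concat (reverse xss ++ [ xs ]))        ≡⟨ cong reverse (sym (concat-++ (reverse xss) [ xs ])) ⟩
  reverse (concat (reverse xss) ++ xs ++ [])      ≡⟨ cong (λ l → reverse (concat (reverse xss) ++ l)) (++-identityʳ xs) ⟩
  reverse (concat (reverse xss) ++ xs)            ≡⟨ reverse-++ (concat (reverse xss)) xs ⟩
  reverse xs ++ reverse (concat (reverse xss))    ≡⟨ cong (reverse xs ++_) (reverse-concat xss) ⟩
  reverse xs ++ concat (map reverse xss)          ∎
  where open ≡-Reasoning

map-reverse-involutive : ∀ (X : Blocks) → map reverse (map reverse X) ≡ X
map-reverse-involutive X = trans (sym (map-∘ X)) (trans (map-cong reverse-involutive X) (map-id X))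

map-length-reverse : ∀ (X : Blocks) → map length (map reverse X) ≡ map length X
map-length-reverse X = trans (sym (map-∘ X)) (map-cong length-reverse X)

insRun-last : ∀ {E E′ : Vec Bool n} → E ∋ x → InsRun E xs E′ zs → E′ ∋ lastN (x ∷ xs)
insRun-last m []            = m
insRun-last m (i ∷ [])      = ins-∋′ i
insRun-last m (i ∷ is@(_ ∷ _)) = insRun-last (ins-∋′ i) is

Adjacent : List ℕ → List ℕ → Set
Adjacent b a = lastN b < headN a

-- When a block has passed, its last letter lies in the column. The first letter of the next
-- nonempty block is appended, hence larger. This yields the maximality of the factorization
-- belonging to T.
qcols-linked : ∀ {b} {E E′ : Vec Bool n} → E ∋ lastN b → QCols E X E′ Z → Linked Adjacent (b ∷ filterᵇ nonempty X)
qcols-linked m []           = [-]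
qcols-linked m (skip q)     = qcols-linked m q
qcols-linked m (blk a is q) = app-max a m ∷ qcols-linked (insRun-last (app-∋ a) is) q

qcols-maximal : ∀ {E E′ : Vec Bool n} → QCols E X E′ Z → Linked Adjacent (filterᵇ nonempty X)
qcols-maximal []           = []
qcols-maximal (skip q)     = qcols-maximal q
qcols-maximal (blk a is q) = qcols-linked (insRun-last (app-∋ a) is) q

Q-maximal : ∀ m {X} → Q n m X → Linked Adjacent (filterᵇ nonempty X)
Q-maximal zero    []          = []
Q-maximal {n} zero (refl ∷ es) = Q-maximal {n} zero es
Q-maximal (suc m) (_ , _ , q , _) = qcols-maximal q

adjOK⁺ : ∀ X → Linked (λ a b → headN b < lastN a) X → adjOK X ≡ true
adjOK⁺ []          _        = refl
adjOK⁺ (_ ∷ [])    _        = refl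
adjOK⁺ (a ∷ b ∷ X) (l ∷ ls) = ∧-join (T⇒true (<⇒<ᵇ l)) (adjOK⁺ (b ∷ X) ls)

lastN-∷ʳ : ∀ xs x → lastN (xs ++ [ x ]) ≡ x
lastN-∷ʳ []           x = refl
lastN-∷ʳ (_ ∷ [])     x = refl
lastN-∷ʳ (_ ∷ y ∷ xs) x = lastN-∷ʳ (y ∷ xs) x

lastN-reverse : ∀ xs → lastN (reverse xs) ≡ headN xs
lastN-reverse []       = refl
lastN-reverse (x ∷ xs) = trans (cong lastN (unfold-reverse x xs)) (lastN-∷ʳ (reverse xs) x)

headN-reverse : ∀ xs → headN (reverse xs) ≡ lastN xs
headN-reverse xs = trans (sym (lastN-reverse (reverse xs))) (cong lastN (reverse-involutive xs))

filter-nonempty-reverse : ∀ (X : Blocks) → filterᵇ nonempty (reverse X) ≡ reverse (filterᵇ nonempty X)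
filter-nonempty-reverse []       = refl
filter-nonempty-reverse (x ∷ X) = trans (cong (filterᵇ nonempty) (unfold-reverse x X))
  (trans (split (reverse X) [ x ]) (trans (cong (_++ filterᵇ nonempty [ x ]) (filter-nonempty-reverse X)) (join x)))
  where
    split : ∀ (X Y : Blocks) → filterᵇ nonempty (X ++ Y) ≡ filterᵇ nonempty X ++ filterᵇ nonempty Y
    split []             Y = refl
    split ([] ∷ X)       Y = split X Y
    split ((x ∷ r) ∷ X)  Y = cong ((x ∷ r) ∷_) (split X Y)
    join : ∀ x → reverse (filterᵇ nonempty X) ++ filterᵇ nonempty [ x ] ≡ reverse (filterᵇ nonempty (x ∷ X))
    join []      = ++-identityʳ _
    join (a ∷ r) = sym (unfold-reverse (a ∷ r) (filterᵇ nonempty X))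

nonempty-reverse : ∀ x → nonempty (reverse x) ≡ nonempty x
nonempty-reverse []      = refl
nonempty-reverse (a ∷ r) = trans (cong nonempty (unfold-reverse a r)) (snoc (reverse r))
  where
    snoc : ∀ l → nonempty (l ++ [ a ]) ≡ true
    snoc []      = refl
    snoc (_ ∷ _) = refl

filter-nonempty-map-reverse : ∀ X → filterᵇ nonempty (map reverse X) ≡ map reverse (filterᵇ nonempty X)
filter-nonempty-map-reverse []            = refl
filter-nonempty-map-reverse ([] ∷ X)      = filter-nonempty-map-reverse X
filter-nonempty-map-reverse ((a ∷ r) ∷ X) rewrite nonempty-reverse (a ∷ r) =
  cong (reverse (a ∷ r) ∷_) (filter-nonempty-map-reverse X)

linked-map-reverse : ∀ {X} → Linked Adjacent X → Linked (λ b a → headN b < lastN a) (map reverse X)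
linked-map-reverse []        = []
linked-map-reverse [-]       = [-]
linked-map-reverse {b ∷ a ∷ X} (l ∷ ls) =
  subst₂ _<_ (sym (headN-reverse b)) (sym (lastN-reverse a)) l ∷ linked-map-reverse ls

isMaximal⁺ : ∀ {X} → All Decr X → Linked Adjacent (filterᵇ nonempty X) → isMaximal (map reverse X) ≡ true
isMaximal⁺ {X} decs ls = ∧-join (All-allB weaklyIncr⁺ (incr decs))
  (trans (cong adjOK (trans (filter-nonempty-reverse (map reverse X)) (cong reverse (filter-nonempty-map-reverse X))))
    (adjOK⁺ _ (reverse-linked (linked-map-reverse ls))))
  where
    incr : ∀ {X} → All Decr X → All (Linked _≤_) (map reverse X)
    incr []           = []
    incr (dec ∷ decs) = reverse-linked dec ∷ incr decs

isMaximal⁻ : ∀ fs → isMaximal fs ≡ true → All Decr (map reverse fs)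
isMaximal⁻ fs eq = decr (allB-All weaklyIncr⁻ fs (proj₁ (∧-split eq)))
  where
    decr : ∀ {fs} → All (Linked _≤_) fs → All Decr (map reverse fs)
    decr []           = []
    decr (inc ∷ incs) = reverse-linked inc ∷ decr incs

eqL⁺ : ∀ xs → eqL xs xs ≡ true
eqL⁺ []       = refl
eqL⁺ (x ∷ xs) = ∧-join (T⇒true (≡⇒≡ᵇ x x refl)) (eqL⁺ xs)

eqL⁻ : ∀ xs ys → eqL xs ys ≡ true → xs ≡ ys
eqL⁻ []       []       _  = refl
eqL⁻ (x ∷ xs) (y ∷ ys) eq = cong₂ _∷_ (≡ᵇ⇒≡ x y (true⇒T (proj₁ (∧-split eq)))) (eqL⁻ xs ys (proj₂ (∧-split {x ≡ᵇ y} eq)))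

eqLL⁺ : ∀ X → eqLL X X ≡ true
eqLL⁺ []       = refl
eqLL⁺ (x ∷ X) = ∧-join (eqL⁺ x) (eqLL⁺ X)

eqLL⁻ : ∀ X Y → eqLL X Y ≡ true → X ≡ Y
eqLL⁻ []       []       _  = refl
eqLL⁻ (x ∷ X) (y ∷ Y) eq = cong₂ _∷_ (eqL⁻ x y (proj₁ (∧-split eq))) (eqLL⁻ X Y (proj₂ (∧-split {eqL x y} eq)))

rsk≡addAll : ∀ fs → proj₂ (rsk (word fs)) ≡ addAll 1 (landing (concat (map reverse fs)) []) []
rsk≡addAll fs = trans (insertAll-addAll 1 (reverse (word fs)) [] [])
  (cong (λ w → addAll 1 (landing w []) []) (reverse-concat fs))

allLand⇒rsk : ∀ {fs P} → AllLand (map reverse fs) [] P → proj₂ (rsk (word fs)) ≡ std (key (map length fs))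
allLand⇒rsk {fs} ls = begin
  proj₂ (rsk (word fs))                                      ≡⟨ rsk≡addAll fs ⟩
  addAll 1 (landing (concat (map reverse fs)) []) []         ≡⟨ cong (λ cs → addAll 1 cs []) (allLand-landing ls) ⟩
  addAll 1 (blockCols (map length (map reverse fs))) []      ≡⟨ cong (λ α → addAll 1 (blockCols α) []) (map-length-reverse fs) ⟩
  addAll 1 (blockCols (map length fs)) []                    ≡⟨ std-key (map length fs) ⟨
  std (key (map length fs))                                  ∎
  where open ≡-Reasoning

rsk⇒allLand : ∀ fs → proj₂ (rsk (word fs)) ≡ std (key (map length fs)) → ∃[ P ] AllLand (map reverse fs) [] P
rsk⇒allLand fs eq = landing-allLand blocks (addAll-injective 1 _ _
    (trans (length-landing (concat blocks) []) (sym (length-blockCols blocks))) (λ ()) (λ ()) (begin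
  addAll 1 (landing (concat blocks) []) []        ≡⟨ rsk≡addAll fs ⟨
  proj₂ (rsk (word fs))                      ≡⟨ eq ⟩
  std (key (map length fs))                  ≡⟨ std-key (map length fs) ⟩
  addAll 1 (blockCols (map length fs)) []    ≡⟨ cong (λ α → addAll 1 (blockCols α) []) (map-length-reverse fs) ⟨
  addAll 1 (blockCols (map length blocks)) []     ∎))
  where
    open ≡-Reasoning
    blocks = map reverse fs

-- Enumeration of flagged fillings

data Flagged (φ : ℕ → ℕ) : ℕ → List ℕ → Blocks → Set where
  []  : ∀ {i} → Flagged φ i [] []
  _∷_ : ∀ {i a α x X} → length x ≡ a × All (λ v → 1 ≤ v × v ≤ φ i) x → Flagged φ (suc i) α X →
        Flagged φ i (a ∷ α) (x ∷ X)

concatMap-map : ∀ {A B C : Set} (f : A → B → C) xs ys →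
  concatMap (λ x → map (f x) ys) xs ≡ cartesianProductWith f xs ys
concatMap-map f []       ys = refl
concatMap-map f (x ∷ xs) ys = cong (map (f x) ys ++_) (concatMap-map f xs ys)

∈-range1⁺ : ∀ {m v} → 1 ≤ v → v ≤ m → v ∈ range1 m
∈-range1⁺ {v = suc v} _ le = ∈-map⁺ suc (∈-upTo⁺ le)

∈-range1⁻ : ∀ {m v} → v ∈ range1 m → 1 ≤ v × v ≤ m
∈-range1⁻ i with ∈-map⁻ suc i
... | _ , j , refl = s≤s z≤n , ∈-upTo⁻ j

∈-allLists⁺ : ∀ ℓ {m x} → length x ≡ ℓ → All (λ v → 1 ≤ v × v ≤ m) x → x ∈ allLists ℓ m
∈-allLists⁺ zero    {x = []} _ _ = here refl
∈-allLists⁺ (suc ℓ) {m} {v ∷ x} eq ((l , u) ∷ bs) =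
  subst (v ∷ x ∈_) (sym (concatMap-map _∷_ (range1 m) (allLists ℓ m)))
    (∈-cartesianProductWith⁺ _∷_ (∈-range1⁺ l u) (∈-allLists⁺ ℓ (suc-injective eq) bs))

∈-allLists⁻ : ∀ ℓ {m x} → x ∈ allLists ℓ m → length x ≡ ℓ × All (λ v → 1 ≤ v × v ≤ m) x
∈-allLists⁻ zero    (here refl) = refl , []
∈-allLists⁻ (suc ℓ) {m} {x} i
  with ∈-cartesianProductWith⁻ _∷_ (range1 m) (allLists ℓ m) (subst (x ∈_) (concatMap-map _∷_ (range1 m) (allLists ℓ m)) i)
... | v , x′ , iv , ix , refl with ∈-allLists⁻ ℓ ix
...   | eq , bs = cong suc eq , ∈-range1⁻ iv ∷ bs

∈-fillings⁺ : ∀ {φ i α X} → Flagged φ i α X → X ∈ flaggedFillings φ i α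
∈-fillings⁺ [] = here refl
∈-fillings⁺ {φ} {i} {a ∷ α} {x ∷ X} ((eq , bs) ∷ fl) =
  subst (x ∷ X ∈_) (sym (concatMap-map _∷_ (allLists a (φ i)) (flaggedFillings φ (suc i) α)))
    (∈-cartesianProductWith⁺ _∷_ (∈-allLists⁺ a eq bs) (∈-fillings⁺ fl))

∈-fillings⁻ : ∀ {φ i} α {X} → X ∈ flaggedFillings φ i α → Flagged φ i α X
∈-fillings⁻ [] (here refl) = []
∈-fillings⁻ {φ} {i} (a ∷ α) {X} m
  with ∈-cartesianProductWith⁻ _∷_ (allLists a (φ i)) (flaggedFillings φ (suc i) α)
         (subst (X ∈_) (concatMap-map _∷_ (allLists a (φ i)) (flaggedFillings φ (suc i) α)) m)
... | x , X′ , ix , iX , refl = ∈-allLists⁻ a ix ∷ ∈-fillings⁻ α iX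

unique-allLists : ∀ ℓ m → Unique (allLists ℓ m)
unique-allLists zero    m = [] ∷ []
unique-allLists (suc ℓ) m = subst Unique (sym (concatMap-map _∷_ (range1 m) (allLists ℓ m)))
  (cartesianProductWith⁺ _∷_ ∷-injective (unique-map⁺ suc-injective (upTo⁺ m)) (unique-allLists ℓ m))

unique-fillings : ∀ φ i α → Unique (flaggedFillings φ i α)
unique-fillings φ i []      = [] ∷ []
unique-fillings φ i (a ∷ α) = subst Unique (sym (concatMap-map _∷_ (allLists a (φ i)) (flaggedFillings φ (suc i) α)))
  (cartesianProductWith⁺ _∷_ ∷-injective (unique-allLists a (φ i)) (unique-fillings φ (suc i) α))

factors≡fillings : ∀ φ i α → flaggedFactors φ i α ≡ flaggedFillings φ i α
factors≡fillings φ i []      = refl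
factors≡fillings φ i (a ∷ α) = cong (λ l → concatMap (λ r → map (r ∷_) l) (allLists a (φ i))) (factors≡fillings φ (suc i) α)

-- Weights, lengths and flags

count-∷ : ∀ j x u → count j (x ∷ u) ≡ (if j ≡ᵇ x then 1 else 0) + count j u
count-∷ j x u with j ≡ᵇ x
... | true  = refl
... | false = refl

count-↭ : ∀ j {u v} → u ↭ v → count j u ≡ count j v
count-↭ j _↭_.refl = refl
count-↭ j (prep {xs = u} {v} x p) = trans (count-∷ j x u)
  (trans (cong ((if j ≡ᵇ x then 1 else 0) +_) (count-↭ j p)) (sym (count-∷ j x v)))
count-↭ j (swap {xs = u} {v} x y p) = begin
  count j (x ∷ y ∷ u)        ≡⟨ count-∷ j x (y ∷ u) ⟩
  b x + count j (y ∷ u)      ≡⟨ cong (b x +_) (count-∷ j y u) ⟩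
  b x + (b y + count j u)    ≡⟨ cong (λ k → b x + (b y + k)) (count-↭ j p) ⟩
  b x + (b y + count j v)    ≡⟨ +-assoc (b x) (b y) _ ⟨
  b x + b y + count j v      ≡⟨ cong (_+ count j v) (+-comm (b x) (b y)) ⟩
  b y + b x + count j v      ≡⟨ +-assoc (b y) (b x) _ ⟩
  b y + (b x + count j v)    ≡⟨ cong (b y +_) (count-∷ j x v) ⟨
  b y + count j (x ∷ v)      ≡⟨ count-∷ j y (x ∷ v) ⟨
  count j (y ∷ x ∷ v)        ∎
  where
    open ≡-Reasoning
    b : ℕ → ℕ
    b z = if j ≡ᵇ z then 1 else 0
count-↭ j (_↭_.trans p q) = trans (count-↭ j p) (count-↭ j q)

maxL-↭ : ∀ {u v} → u ↭ v → maxL u ≡ maxL v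
maxL-↭ _↭_.refl = refl
maxL-↭ (prep x p) = cong (x ⊔_) (maxL-↭ p)
maxL-↭ {u = _ ∷ _ ∷ u} (swap x y p) =
  trans (sym (⊔-assoc x y (maxL u))) (trans (cong₂ _⊔_ (⊔-comm x y) (maxL-↭ p)) (⊔-assoc y x _))
maxL-↭ (_↭_.trans p q) = trans (maxL-↭ p) (maxL-↭ q)

wt-↭ : ∀ {u v} → u ↭ v → wt u ≡ wt v
wt-↭ {u} {v} p = trans (cong (λ m → map (λ j → count j u) (range1 m)) (maxL-↭ p))
  (map-cong (λ j → count-↭ j p) (range1 (maxL v)))

popRun-length : {C C′ : Vec Bool n} → PopRun C ys C′ xs → length xs ≡ suc (length ys)
popRun-length (pop _)  = refl
popRun-length (_ ∷ is) = cong suc (popRun-length is)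

bij-lengths-step : ∀ {C₁ S G S′ G′ C C′ : Vec Bool n} {T T′ D D′} → Grabs C₁ S G T′ T S′ G′ → PopRuns C D′ C′ D →
  acts T ≡ acts D → map length T′ ≡ map length D′ → map length T ≡ map length D
bij-lengths-step [] [] _ _ = refl
bij-lengths-step (skip gs) (skip r) eq eq′ = cong (0 ∷_) (bij-lengths-step gs r (cong (drop 1) eq) (cong (drop 1) eq′))
bij-lengths-step (skip gs) (blk (pop _) r) () _
bij-lengths-step (skip gs) (blk (_ ∷ _) r) () _
bij-lengths-step (first g gs) (blk p r) eq eq′ = cong₂ _∷_
  (trans (cong suc (proj₁ (∷-injective eq′))) (sym (popRun-length p)))
  (bij-lengths-step gs r (cong (drop 1) eq) (cong (drop 1) eq′))
bij-lengths-step (next g gs) (blk p r) eq eq′ = cong₂ _∷_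
  (trans (cong suc (proj₁ (∷-injective eq′))) (sym (popRun-length p)))
  (bij-lengths-step gs r (cong (drop 1) eq) (cong (drop 1) eq′))

bij-lengths : ∀ m {T D} → Bij n m T D → map length T ≡ map length D
bij-lengths zero (es , fs , eq) = cong (map length) (acts-empty es fs eq)
bij-lengths (suc m) (_ , _ , _ , _ , gs , r , eq , b) = bij-lengths-step gs r eq (bij-lengths m b)

flagged-lengths : ∀ {φ i α X} → Flagged φ i α X → map length X ≡ α
flagged-lengths []              = refl
flagged-lengths ((eq , _) ∷ fl) = cong₂ _∷_ eq (flagged-lengths fl)

flagged-positive : ∀ {φ i α X} → Flagged φ i α X → All (All (1 ≤_)) X
flagged-positive []              = []
flagged-positive ((_ , bs) ∷ fl) = All.map proj₁ bs ∷ flagged-positive fl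

flagged-≤ : ∀ {φ i α X b} k → Flagged φ i α X → (∀ j → i ≤ j → j < i + k → φ j ≤ b) → All (All (_≤ b)) (takeL k X)
flagged-≤ zero    _               _ = []
flagged-≤ (suc k) []              _ = []
flagged-≤ {i = i} (suc k) ((_ , bs) ∷ fl) h =
  All.map (λ b → ≤-trans (proj₂ b) (h i ≤-refl (m<m+n i (s≤s z≤n)))) bs
  ∷ flagged-≤ k fl (λ j le lt → h j (<⇒≤ le) (<-≤-trans lt (≤-reflexive (sym (+-suc i k)))))

flagged-mk : ∀ {φ} i X → All (All (1 ≤_)) X → (∀ k → All (All (_≤ φ (i + k))) (takeL (suc k) X)) →
  Flagged φ i (map length X) X
flagged-mk i [] _ _ = []
flagged-mk {φ} i (x ∷ X) (pos ∷ poss) h with h 0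
... | le ∷ _ rewrite +-identityʳ i = (refl , All.zip (pos , le)) ∷ flagged-mk (suc i) X poss next′
  where
    next′ : ∀ k → All (All (_≤ φ (suc i + k))) (takeL (suc k) X)
    next′ k with h (suc k)
    ... | _ ∷ les rewrite +-suc i k = les

flagged-reverse : ∀ {φ i α X} → Flagged φ i α X → Flagged φ i α (map reverse X)
flagged-reverse []               = []
flagged-reverse {X = x ∷ X} ((eq , bs) ∷ fl) =
  (trans (length-reverse x) eq , All-resp-↭ (↭-sym (↭-reverse x)) bs) ∷ flagged-reverse fl

-- Induction on xs: the partner of the first element is cut out of ys. As partners are unique on
-- both sides and the lists have no repetitions, the other elements keep theirs.
map-↭ : ∀ {A B W : Set} {R : A → B → Set} (f : A → W) (g : B → W) {xs : List A} {ys : List B} →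
  Unique xs → Unique ys →
  (∀ {x} → x ∈ xs → ∃[ y ] y ∈ ys × R x y) → (∀ {y} → y ∈ ys → ∃[ x ] x ∈ xs × R x y) →
  (∀ {x y y′} → R x y → R x y′ → y ≡ y′) → (∀ {x x′ y} → R x y → R x′ y → x ≡ x′) →
  (∀ {x y} → R x y → f x ≡ g y) → map f xs ↭ map g ys
map-↭ f g {[]} {[]}     _ _ _ _ _ _ _ = ↭-refl
map-↭ f g {[]} {y ∷ ys} _ _ _ from _ _ _ with from (here refl)
... | _ , () , _
map-↭ {R = R} f g {x ∷ xs} {ys} (x∉ ∷ uxs) uys to from det inj eq with to (here refl)
... | y , y∈ , r with ∈-∃++ y∈
...   | ls , rs , refl = ↭-trans
  (↭-trans (↭-reflexive (cong (_∷ map f xs) (eq r)))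
           (↭-prep (g y) (map-↭ f g uxs (proj₁ split) to′ from′ det inj eq)))
  (map⁺ g (↭-sym (shift y ls rs)))
  where
    restore : ∀ ls {z} → z ∈ ls ++ rs → z ∈ ls ++ y ∷ rs
    restore []       m         = there m
    restore (l ∷ ls) (here e)  = here e
    restore (l ∷ ls) (there m) = there (restore ls m)
    unique-mid : ∀ ls → Unique (ls ++ y ∷ rs) → Unique (ls ++ rs) × (∀ {z} → z ∈ ls ++ rs → z ≢ y)
    unique-mid []       (y∉ ∷ u) = u , λ m e → All.lookup y∉ m (sym e)
    unique-mid (l ∷ ls) (l∉ ∷ u) with unique-mid ls u
    ... | u′ , ne = All.tabulate (λ m → All.lookup l∉ (restore ls m)) ∷ u′ ,
                    λ { (here refl) e → All.lookup l∉ (∈-++⁺ʳ ls (here refl)) e ; (there m) → ne m }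
    split : Unique (ls ++ rs) × (∀ {z} → z ∈ ls ++ rs → z ≢ y)
    split = unique-mid ls uys
    remove : ∀ ls {z} → z ∈ ls ++ y ∷ rs → z ≢ y → z ∈ ls ++ rs
    remove []       (here e)  ne = ⊥-elim (ne e)
    remove []       (there m) ne = m
    remove (l ∷ ls) (here e)  ne = here e
    remove (l ∷ ls) (there m) ne = there (remove ls m ne)
    to′ : ∀ {x′} → x′ ∈ xs → ∃[ y′ ] y′ ∈ ls ++ rs × R x′ y′
    to′ m with to (there m)
    ... | y′ , y′∈ , r′ = y′ , remove ls y′∈ (λ { refl → All.lookup x∉ m (inj r r′) }) , r′
    from′ : ∀ {y′} → y′ ∈ ls ++ rs → ∃[ x′ ] x′ ∈ xs × R x′ y′
    from′ m with from (restore ls m)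
    ... | _ , here refl , r′ = ⊥-elim (proj₂ split m (det r′ r))
    ... | x′ , there x′∈ , r′ = x′ , x′∈ , r′

-- The bijection between key tableaux and factorizations

module Correspondence (α : List ℕ) (φ : ℕ → ℕ) (flag : IsFlag φ) where

  open IsFlag flag

  width height : ℕ
  width  = maxL α
  -- For monotone φ the entries are at most φ(length α). Letter v occupies position v of a bit
  -- vector and position 0 stays free, whence the `suc`.
  height = suc (φ (length α))

  flagged-< : ∀ {X} → Flagged φ 1 α X → All (All (_< height)) X
  flagged-< {X} fl = subst (All (All (_< height))) (take-all (length α) X (≤-reflexive |X|))
    (All.map (All.map s≤s) (flagged-≤ (length α) fl (λ j 1≤j j< → monotone j (length α) 1≤j (s≤s⁻¹ j<))))
    where
      |X| : length X ≡ length α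
      |X| = trans (sym (length-map length X)) (cong length (flagged-lengths fl))

  flagged-width : ∀ {X} → Flagged φ 1 α X → All (λ r → length r ≤ width) X
  flagged-width {X} fl = subst (λ β → All (λ r → length r ≤ maxL β) X) (flagged-lengths fl) (length-≤-maxL X)

  flagged-prefix : ∀ {X} → Flagged φ 1 α X → ∀ k → All (All (_≤ φ k)) (takeL k X)
  flagged-prefix fl k = flagged-≤ k fl (λ j 1≤j j< → monotone j k 1≤j (s≤s⁻¹ j<))

  -- Only bounds on whole prefixes carry over between T and D. Monotonicity turns the row bounds of
  -- X into prefix bounds, and the last row of each prefix of Y gives the row bound back.
  flagged-transfer : ∀ {X Y} → Flagged φ 1 α X → map length X ≡ map length Y → concat X ↭ concat Y →
    (∀ k {b} → All (All (_≤ b)) (takeL k X) → All (All (_≤ b)) (takeL k Y)) → Flagged φ 1 α Y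
  flagged-transfer {Y = Y} fl lens p bound = subst (λ β → Flagged φ 1 β Y) (trans (sym lens) (flagged-lengths fl))
    (flagged-mk 1 Y (concat⁻ (All-resp-↭ p (concat⁺ (flagged-positive fl)))) (λ k → bound (suc k) (flagged-prefix fl (suc k))))

  _≈_ : Blocks → Blocks → Set
  T ≈ fs = Bij height width T (map reverse fs)

  ∈-SSKT⁻ : ∀ {T} → T ∈ SSKT α φ → Flagged φ 1 α T × isKey T ≡ true
  ∈-SSKT⁻ m with ∈-filter⁻ (T? ∘ isKey) {xs = flaggedFillings φ 1 α} m
  ... | m′ , t = ∈-fillings⁻ α m′ , T⇒true t

  ∈-SSKT⁺ : ∀ {T} → Flagged φ 1 α T → isKey T ≡ true → T ∈ SSKT α φ
  ∈-SSKT⁺ fl eq = ∈-filter⁺ (T? ∘ isKey) (∈-fillings⁺ fl) (true⇒T eq)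

  ∈-𝒲⁻ : ∀ {fs} → fs ∈ 𝒲 α φ → Flagged φ 1 α fs × isMaximal fs ≡ true × proj₂ (rsk (word fs)) ≡ std (key α)
  ∈-𝒲⁻ {fs} m with ∈-filter⁻ (T? ∘ λ fs → isMaximal fs ∧ eqLL (proj₂ (rsk (word fs))) (std (key α))) {xs = flaggedFactors φ 1 α} m
  ... | m′ , t with ∧-split {isMaximal fs} (T⇒true t)
  ...   | mx , eq = ∈-fillings⁻ α (subst (fs ∈_) (factors≡fillings φ 1 α) m′) , mx , eqLL⁻ _ _ eq

  ∈-𝒲⁺ : ∀ {fs} → Flagged φ 1 α fs → isMaximal fs ≡ true → proj₂ (rsk (word fs)) ≡ std (key α) → fs ∈ 𝒲 α φ
  ∈-𝒲⁺ {fs} fl mx eq = ∈-filter⁺ (T? ∘ λ fs → isMaximal fs ∧ eqLL (proj₂ (rsk (word fs))) (std (key α)))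
    (subst (fs ∈_) (sym (factors≡fillings φ 1 α)) (∈-fillings⁺ fl))
    (true⇒T (∧-join mx (trans (cong (λ r → eqLL r (std (key α))) eq) (eqLL⁺ (std (key α))))))

  SSKT⇒𝒲 : ∀ {T} → T ∈ SSKT α φ → ∃[ fs ] fs ∈ 𝒲 α φ × T ≈ fs
  SSKT⇒𝒲 {T} m with ∈-SSKT⁻ m
  ... | fl , eq with key⇒bij width (keyT⇒key width (flagged-width fl) (flagged-< fl) (isKey⇒keyT T eq))
  ...   | D , b , decs , lts , h with Q⇒allLand width h
  ...     | _ , ls = map reverse D , ∈-𝒲⁺ (flagged-reverse flD) (isMaximal⁺ decs (Q-maximal width h))
                (trans (allLand⇒rsk (subst (λ X → AllLand X [] _) (sym (map-reverse-involutive D)) ls))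
                       (cong (std ∘ key) (flagged-lengths (flagged-reverse flD))))
              , subst (Bij height width T) (sym (map-reverse-involutive D)) b
    where
      flD : Flagged φ 1 α D
      flD = flagged-transfer fl (bij-lengths width b) (bij-↭ width b) (bij-≤ width b)

  𝒲⇒SSKT : ∀ {fs} → fs ∈ 𝒲 α φ → ∃[ T ] T ∈ SSKT α φ × T ≈ fs
  𝒲⇒SSKT {fs} m with ∈-𝒲⁻ m
  ... | fl , mx , eq with rsk⇒allLand fs (trans eq (cong (std ∘ key) (sym (flagged-lengths fl))))
  ...   | _ , ls with allLand⇒Q width (flagged-width (flagged-reverse fl)) (flagged-< (flagged-reverse fl)) ls
  ...     | h with word⇒bij width (flagged-< (flagged-reverse fl)) (isMaximal⁻ fs mx) h
  ...       | T , b = T , ∈-SSKT⁺ (flagged-transfer (flagged-reverse fl) (sym (bij-lengths width b)) (↭-sym (bij-↭ width b)) (bij-≤⁻¹ width b))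
                            (keyT⇒isKey T (key⇒keyT width (bij-key width b))) , b

  ≈-det : ∀ {T fs gs} → T ≈ fs → T ≈ gs → fs ≡ gs
  ≈-det {fs = fs} {gs} b b′ = trans (sym (map-reverse-involutive fs))
    (trans (cong (map reverse) (bij-det width b b′)) (map-reverse-involutive gs))

  ≈-wt : ∀ {T fs} → T ≈ fs → wt (concat T) ≡ wt (word fs)
  ≈-wt {T} {fs} b = wt-↭ (↭-trans (bij-↭ width b)
    (↭-trans (↭-reflexive (sym (reverse-concat fs))) (↭-reverse (word fs))))

theorem4p17 : (α : List ℕ) (φ : ℕ → ℕ) → IsFlag φ →
    map (λ T → wt (concat T)) (SSKT α φ) ↭ map (λ fs → wt (word fs)) (𝒲 α φ)
theorem4p17 α φ flag = map-↭ {R = _≈_} (λ T → wt (concat T)) (λ fs → wt (word fs))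
  (filter⁺ (T? ∘ isKey) (unique-fillings φ 1 α))
  (filter⁺ (T? ∘ λ fs → isMaximal fs ∧ eqLL (proj₂ (rsk (word fs))) (std (key α)))
    (subst Unique (sym (factors≡fillings φ 1 α)) (unique-fillings φ 1 α)))
  SSKT⇒𝒲 𝒲⇒SSKT ≈-det (bij-detR width) ≈-wt
  where open Correspondence α φ flag
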